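{- Let $p$ be a prime, $k$ a positive integer, and $q=p^k$ with $q\equiv 1\pmod 3$. Let $n$ be a positive integer with $\gcd\big(n,\frac{q-1}{3}\big)=1$. Then the number of elements $a\in\mathbb{F}_q$ for which $x^n\big(x^{\frac{q-1}{3}}+a\big)$ is a permutation polynomial of $\mathbb{F}_q$ equals $$\frac{2q-3(\epsilon_1+\epsilon_2)-10-2\big(\pi_p^{\,k}+\overline{\pi_p}^{\,k}\big)}{9},$$ where $\epsilon_1=-2$ if $q-3n\equiv 1\pmod 9$ and $\epsilon_1=1$ otherwise, and $\epsilon_2=-2$ if $n\equiv 0\pmod 3$ and $\epsilon_2=1$ otherwise.
   Context: A polynomial is a permutation polynomial of $\mathbb{F}_q$ if it induces a bijection of $\mathbb{F}_q$. Note $q\equiv1\pmod 3$ forces $p\neq3$. For a prime $p\neq 3$ define the integer $\kappa_p$ as follows: $\kappa_7=1$, $\kappa_{13}=-5$; if $p\equiv 1\pmod 3$ and $p\ge 19$, $\kappa_p$ is the unique integer with $|\kappa_p|\le 2\sqrt p$ and $\kappa_p\equiv-\binom{\frac{p-1}{2}}{\frac{p-1}{3}}\cdot 4^{ -\frac{p-1}{6}}\pmod p$; if $p\equiv 2\pmod 3$ (including $p=2$), $\kappa_p=0$. Define the complex number $\pi_p=\frac{ -\kappa_p}{2}+i\sqrt{p-\frac{\kappa_p^2}{4}}$, and $\overline{\pi_p}$ its complex conjugate. -}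

module Defs where

open import Level using (Level; _⊔_) renaming (suc to lsuc)
open import Algebra.Bundles using (CommutativeRing)
open import Data.Bool.Base using (if_then_else_)
open import Data.Fin.Base using (Fin)
open import Data.Fin.Properties using (all?; any?; inj⇒≟) renaming (_≟_ to _≟ᶠ_)
open import Data.Integer.Base as ℤ using (ℤ; +_; -[1+_]; ∣_∣; 0ℤ; 1ℤ)
open import Data.List.Base using (List; []; _∷_; _++_; map; replicate; filter; upTo)
open import Data.Nat.Base as ℕ using (ℕ; zero; suc; NonZero)
open import Data.Nat.Combinatorics using (_C_)
open import Data.Nat.Divisibility as ℕ∣ using ()
open import Data.Integer.Divisibility using (_∣_)
open import Data.Nat.DivMod using (_/_; _%_)
import Data.Nat.Properties as ℕₚ
open import Data.Product.Base using (∃; _×_; _,_)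
open import Data.Rational.Base as ℚ using (ℚ; 0ℚ; 1ℚ)
open import Data.Vec.Base using (Vec; tabulate)
open import Function.Bundles using (Inverse)
open import Function.Definitions using (Bijective; Injective; Surjective)
open import Function.Properties.Inverse using (Inverse⇒Injection)
open import Relation.Binary.Core using (Rel)
open import Relation.Binary.Definitions using (Decidable)
open import Relation.Binary.PropositionalEquality using (_≡_; setoid; sym; trans)
open import Relation.Nullary.Decidable using (Dec; does; map′; _×-dec_; _→-dec_)
open import Relation.Nullary.Negation using (¬_)

record FiniteField (c ℓ : Level) (q : ℕ) : Set (lsuc (c ⊔ ℓ)) where
  field
    commutativeRing : CommutativeRing c ℓ

  open CommutativeRing commutativeRing public
    renaming (setoid to ≈-setoid)

  field
    1≉0         : ¬ (1# ≈ 0#)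
    invertible  : ∀ x → ¬ (x ≈ 0#) → ∃ λ y → x * y ≈ 1#
    enumeration : Inverse ≈-setoid (setoid (Fin q))

  open Inverse enumeration public
    using (to; from; to-cong; inverseˡ; inverseʳ; strictlyInverseˡ; strictlyInverseʳ)

  -- Each element of the field occurs exactly once, up to _≈_.
  elements : Vec Carrier q
  elements = tabulate from

  _≈?_ : Decidable _≈_
  _≈?_ = inj⇒≟ (Inverse⇒Injection enumeration)

module Polynomials {c ℓ} (R : CommutativeRing c ℓ) where

  open CommutativeRing R
    using (Carrier; _≈_; _+_; _*_; 0#; 1#; +-cong; *-cong)
    renaming (refl to ≈-refl)

  infixl 6 _+ₚ_
  infixl 7 _*ₚ_

  -- Coefficient lists, constant coefficient first; trailing zeros allowed.
  Poly : Set c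
  Poly = List Carrier

  C : Carrier → Poly
  C a = a ∷ []

  X^_ : ℕ → Poly
  X^ n = replicate n 0# ++ (1# ∷ [])

  _+ₚ_ : Poly → Poly → Poly
  []      +ₚ g       = g
  (a ∷ f) +ₚ []      = a ∷ f
  (a ∷ f) +ₚ (b ∷ g) = (a + b) ∷ (f +ₚ g)

  _*ₚ_ : Poly → Poly → Poly
  []      *ₚ g = []
  (a ∷ f) *ₚ g = map (a *_) g +ₚ (0# ∷ (f *ₚ g))

  eval : Poly → Carrier → Carrier
  eval []      x = 0#
  eval (a ∷ f) x = a + x * eval f x

  IsPermutationPolynomial : Poly → Set (c ⊔ ℓ)
  IsPermutationPolynomial f = Bijective _≈_ _≈_ (eval f)

  eval-cong : ∀ f {x y} → x ≈ y → eval f x ≈ eval f y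
  eval-cong []      x≈y = ≈-refl
  eval-cong (a ∷ f) x≈y = +-cong ≈-refl (*-cong x≈y (eval-cong f x≈y))

module _ {c ℓ q} (F : FiniteField c ℓ q) where

  open FiniteField F
    renaming (sym to ≈-sym; trans to ≈-trans)
  open Polynomials commutativeRing

  private
    module _ (f : Poly) where

      injective? : Dec (Injective _≈_ _≈_ (eval f))
      injective? = map′ ⇒ ⇐
        (all? λ i → all? λ j → (eval f (from i) ≈? eval f (from j)) →-dec (i ≟ᶠ j))
        where
        from-to : ∀ x → from (to x) ≈ x
        from-to = strictlyInverseʳ

        ⇒ : (∀ i j → eval f (from i) ≈ eval f (from j) → i ≡ j) →
            Injective _≈_ _≈_ (eval f)
        ⇒ h {x} {y} fx≈fy = ≈-trans (≈-sym (from-to x)) (inverseʳ (h (to x) (to y)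
          (≈-trans (eval-cong f (from-to x))
            (≈-trans fx≈fy (≈-sym (eval-cong f (from-to y)))))))

        ⇐ : Injective _≈_ _≈_ (eval f) →
            ∀ i j → eval f (from i) ≈ eval f (from j) → i ≡ j
        ⇐ inj i j e = trans (sym (strictlyInverseˡ i))
          (trans (to-cong (inj e)) (strictlyInverseˡ j))

      surjective? : Dec (Surjective _≈_ _≈_ (eval f))
      surjective? = map′ ⇒ ⇐ (all? λ i → any? λ j → eval f (from j) ≈? from i)
        where
        ⇒ : (∀ i → ∃ λ j → eval f (from j) ≈ from i) →
            Surjective _≈_ _≈_ (eval f)
        ⇒ h y with h (to y)
        ... | j , e = from j , λ z≈ →
          ≈-trans (eval-cong f z≈) (≈-trans e (strictlyInverseʳ y))

        ⇐ : Surjective _≈_ _≈_ (eval f) →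
            ∀ i → ∃ λ j → eval f (from j) ≈ from i
        ⇐ surj i with surj (from i)
        ... | x , e = to x , e (strictlyInverseʳ x)

  isPermutationPolynomial? : (f : Poly) → Dec (IsPermutationPolynomial f)
  isPermutationPolynomial? f = injective? f ×-dec surjective? f

infix 4 _≡_[mod_] _≡?_[mod_]

_≡_[mod_] : ℤ → ℤ → ℕ → Set
a ≡ b [mod m ] = + m ∣ a ℤ.- b

_≡?_[mod_] : ∀ a b m → Dec (a ≡ b [mod m ])
a ≡? b [mod m ] = m ℕ∣.∣? ∣ a ℤ.- b ∣

-- The bound |z| ≤ 2√p is written |z|² ≤ 4p. As p is odd when this is used,
-- 4 is a unit modulo p, and z ≡ - binom · 4^-e (mod p) is written
-- z · 4^e ≡ - binom (mod p).

κ-Condition : ℕ → ℤ → Set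
κ-Condition p z =
    ∣ z ∣ ℕ.* ∣ z ∣ ℕ.≤ 4 ℕ.* p
  × z ℤ.* + (4 ℕ.^ ((p ℕ.∸ 1) / 6))
      ≡ ℤ.- + (((p ℕ.∸ 1) / 2) C ((p ℕ.∸ 1) / 3)) [mod p ]

κ-condition? : ∀ p z → Dec (κ-Condition p z)
κ-condition? p z = (_ ℕₚ.≤? _) ×-dec (p ℕ∣.∣? _)

-- Without repetition; contains every z with |z|² ≤ 4p.
integersUpTo2p : ℕ → List ℤ
integersUpTo2p p = map (λ i → + i ℤ.- + (2 ℕ.* p)) (upTo (suc (4 ℕ.* p)))

-- The only entry of a one-element list; the value 0 otherwise is junk.
theUnique : List ℤ → ℤ
theUnique (z ∷ []) = z
theUnique _        = 0ℤ

-- Meaningful for primes p ≠ 3 only.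
κ : ℕ → ℤ
κ 7  = 1ℤ
κ 13 = ℤ.- + 5
κ p  = if does (p % 3 ℕₚ.≟ 1)
       then theUnique (filter (κ-condition? p) (integersUpTo2p p))
       else 0ℤ

ε₁ : (q n : ℕ) → ℤ
ε₁ q n = if does (+ q ℤ.- + (3 ℕ.* n) ≡? 1ℤ [mod 9 ]) then ℤ.- + 2 else 1ℤ

ε₂ : (n : ℕ) → ℤ
ε₂ n = if does (+ n ≡? 0ℤ [mod 3 ]) then ℤ.- + 2 else 1ℤ

-- The complex numbers x + y·i√D with x, y rational.  For D > 0 these form a
-- subfield of the complex numbers closed under conjugation, and x + y·i√D
-- determines x and y (its real part is x, its imaginary part y√D).  Hence
-- propositional equality below is equality of complex numbers.

record ℚ[i√_] (D : ℚ) : Set where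
  constructor _⊕_i√D
  field
    re    : ℚ
    coeff : ℚ

module _ {D : ℚ} where

  infixl 6 _+ᶜ_ _-ᶜ_
  infixl 7 _*ᶜ_
  infixr 8 _^ᶜ_

  rational : ℚ → ℚ[i√ D ]
  rational x = x ⊕ 0ℚ i√D

  integer : ℤ → ℚ[i√ D ]
  integer z = rational (z ℚ./ 1)

  _+ᶜ_ _-ᶜ_ _*ᶜ_ : ℚ[i√ D ] → ℚ[i√ D ] → ℚ[i√ D ]
  (x ⊕ y i√D) +ᶜ (u ⊕ v i√D) = (x ℚ.+ u) ⊕ (y ℚ.+ v) i√D
  (x ⊕ y i√D) -ᶜ (u ⊕ v i√D) = (x ℚ.- u) ⊕ (y ℚ.- v) i√D
  (x ⊕ y i√D) *ᶜ (u ⊕ v i√D) =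
    (x ℚ.* u ℚ.- D ℚ.* (y ℚ.* v)) ⊕ (x ℚ.* v ℚ.+ y ℚ.* u) i√D

  _^ᶜ_ : ℚ[i√ D ] → ℕ → ℚ[i√ D ]
  z ^ᶜ zero  = integer 1ℤ
  z ^ᶜ suc k = z *ᶜ z ^ᶜ k

  conj : ℚ[i√ D ] → ℚ[i√ D ]
  conj (x ⊕ y i√D) = x ⊕ (ℚ.- y) i√D

-- p - κ²/4; positive for primes p ≠ 3, since |κ| ≤ 2√p and 4p is not a square.
Δ : ℕ → ℚ
Δ p = (+ p) ℚ./ 1 ℚ.- (κ p ℤ.* κ p) ℚ./ 4

π : (p : ℕ) → ℚ[i√ Δ p ]
π p = ((ℤ.- κ p) ℚ./ 2) ⊕ 1ℚ i√D

-- Let s = (q - 1)/3, and let χ be the cubic character x ↦ x^s.  As gcd(n, s) = 1, the polynomial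
-- x^n (x^s + a) permutes F if and only if ζ ↦ ζ^n χ(ζ + a) permutes the cube roots of unity.
-- Three cube roots of unity are distinct if and only if their product is 1 and they are not all
-- equal, so the count is a character sum.  Everything reduces to the Jacobi sum
-- J = Σ χ(u) χ(u + 1) in ℤ[ω], and 9 N = 2 q - 3 (ε₁ + ε₂) - 10 + 2 tr J.
--
-- The Hasse-Davenport relation is replaced by arithmetic in ℤ[ω]: -J has norm q = p^k, is congruent
-- to 1 modulo 3, and tr J ≡ - C(2s, s) modulo p.  If p ≡ 2 modulo 3, then p is inert in ℤ[ω] and
-- -J = (-p)^(k/2).  If p ≡ 1 modulo 3, then p does not divide C(2s, s), hence it does not divide J,
-- and -J is the k-th power of -J' or of its conjugate, where J' is the Jacobi sum of ℤ/p.  Finally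
-- tr J' = κ, by the congruence C(4m, 2m) 4^m ≡ C(3m, 2m) modulo p = 6m + 1, or, if p is 7 or 13,
-- because 4 p = (tr J')² + 27 d² and tr J' ≡ 1 modulo 3.
module Submission where

open import Defs
open import Level using (0ℓ)
open import Algebra.Bundles using (CommutativeMonoid; CommutativeRing)
import Algebra.Properties.CommutativeMonoid.Sum as MonoidSum
import Algebra.Properties.Semiring.Exp as Exp
import Algebra.Properties.Semiring.Sum as SemiringSum
import Algebra.Solver.CommutativeMonoid as CommutativeMonoidSolver
import Algebra.Solver.Ring as RingSolver
open import Algebra.Solver.Ring.AlmostCommutativeRing using (AlmostCommutativeRing; fromCommutativeRing; _-Raw-AlmostCommutative⟶_)
open import Algebra.Structures using (IsCommutativeRing)
open import Data.Bool.Base using (true; false; if_then_else_)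
open import Data.Empty using (⊥)
open import Data.Fin.Base as Fin using (Fin; zero; suc; toℕ)
open import Data.Fin.Permutation using (permutation)
import Data.Fin.Properties as Finₚ
open import Data.Integer.Base as ℤ using (ℤ; +_; -[1+_]; 0ℤ; 1ℤ)
open import Data.Integer.DivMod using (_%ℕ_; _/ℕ_; n%ℕd<d; a≡a%ℕn+[a/ℕn]*n)
import Data.Integer.Divisibility.Signed as ℤ∣
open ℤ∣ using (divides)
import Data.Integer.Properties as ℤₚ
open import Data.Integer.Tactic.RingSolver using () renaming (solve-∀ to ℤ-solve)
open import Data.List.Base using (List; filter)
open import Data.List.Membership.Propositional using (_∈_)
open import Data.List.Membership.Propositional.Properties using (∈-map⁺; ∈-upTo⁺)
open import Data.List.Properties using (filter-none)
import Data.List.Relation.Unary.All as All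
open import Data.List.Relation.Unary.AllPairs using (_∷_)
open import Data.List.Relation.Unary.Any using (here; there)
open import Data.List.Relation.Unary.Unique.Propositional using (Unique)
import Data.List.Relation.Unary.Unique.Propositional.Properties as Unique
open import Data.Maybe.Base using (Maybe; just; nothing)
open import Data.Nat.Base as ℕ using (ℕ; zero; suc; NonZero; _!)
open import Data.Nat.Combinatorics using (_C_; nCk≡n!/k![n-k]!; k![n∸k]!∣n!)
open import Data.Nat.Coprimality using (Coprime; coprime-Bézout; gcd≡1⇒coprime)
open import Data.Nat.DivMod using (_/_; _%_; m/n*n≡m; m*n/n≡m; [m+kn]%n≡m%n; m≡m%n+[m/n]*n)
import Data.Nat.Divisibility as ℕ∣
open import Data.Nat.GCD using (gcd; module Bézout)
open import Data.Nat.Primality using (Prime; prime⇒irreducible; prime⇒nonZero; prime⇒nonTrivial; euclidsLemma)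
import Data.Nat.Properties as ℕₚ
open import Data.Nat.Tactic.RingSolver using () renaming (solve-∀ to ℕ-solve)
open import Data.Product.Base using (∃; _,_; proj₁; proj₂) renaming (_×_ to _∧_)
open import Data.Rational.Base as ℚ using (ℚ; 0ℚ; 1ℚ; fromℚᵘ)
import Data.Rational.Properties as ℚₚ
open import Data.Rational.Unnormalised.Base as ℚᵘ using (mkℚᵘ; *≡*)
import Data.Rational.Unnormalised.Properties as ℚᵘₚ
open import Data.Sum.Base using (_⊎_; inj₁; inj₂; [_,_]′)
open import Data.Vec.Base as Vec using (Vec; []; _∷_)
open import Function.Base using (_∘_; id)
open import Function.Bundles using (mk⇔)
open import Function.Definitions using (Injective; Surjective)
open import Relation.Binary.Core using (Rel)
open import Relation.Binary.Definitions using (DecidableEquality; tri<; tri≈; tri>)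
open import Relation.Binary.PropositionalEquality as ≡ using (_≡_; _≢_)
open import Relation.Nullary using (¬_; Dec; yes; no; contradiction)
open import Relation.Nullary.Decidable using (does; map′; ¬?; _×-dec_; _⊎-dec_; _→-dec_; from-yes; from-no; does-⇔; dec-true; dec-false)
open import Relation.Unary using (Pred; Decidable)

-- The sum that the count produces is not a Jacobi sum: the product of the three values has the
-- argument (a + 1)(a + w)(a + w²) = a³ + 1. The curves y³ = a³ + 1 and y³ = v (v + 1) are
-- isomorphic of genus one, by a Möbius transformation that exists because F contains w. The
-- condition of not being all equal yields only ratios of linear factors, whose sums are elementary:
-- they give the term with ε₂, and the three a at which a value vanishes give the term with ε₁.
--
-- Each fact on -J removes one ambiguity. For p ≡ 1 modulo 3 the norm allows π^i times the j-th
-- power of the conjugate of π, with i + j = k, up to the six units; the congruence modulo 3 leaves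
-- only the unit 1; and p not dividing J leaves only i = 0 or j = 0. The remaining choice is
-- conjugation, to which the trace is blind.
--
-- The residue of the trace modulo p determines it only if two integers of size at most 2√p cannot
-- differ by p, that is, if 4√p < p. This fails for 7 and 13 and holds from 19 on.

module IntegersIn {c ℓ} (R : CommutativeRing c ℓ) where

  open CommutativeRing R hiding (zero)
  open import Algebra.Properties.Ring ring using (-0#≈0#; -‿involutive; -‿+-comm; -‿distribʳ-*)
  open import Algebra.Properties.Monoid.Mult +-monoid using (_×_; ×-homo-+)
  open import Algebra.Properties.Monoid.Mult.TCOptimised +-monoid using (×ᵤ≈×) renaming (_×_ to _×′_)
  open import Algebra.Properties.Semiring.Mult semiring using (×1-homo-*)
  open import Relation.Binary.Reasoning.Setoid setoid

  private
    -- The homomorphism laws are proved for this copy, whose successor case unfolds to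
    -- `1# + n × 1#`, and then carried over to `ι`.
    ι₀ : ℤ → Carrier
    ι₀ (+ n)      = n × 1#
    ι₀ (-[1+ n ]) = - (suc n × 1#)

    cancel : ∀ x y z → x + y ≈ (z + x) + (- z + y)
    cancel x y z = sym (begin
      (z + x) + (- z + y)  ≈⟨ +-congʳ (+-comm z x) ⟩
      (x + z) + (- z + y)  ≈⟨ +-assoc x z _ ⟩
      x + (z + (- z + y))  ≈⟨ +-congˡ (+-assoc z (- z) y) ⟨
      x + ((z + - z) + y)  ≈⟨ +-congˡ (+-congʳ (-‿inverseʳ z)) ⟩
      x + (0# + y)         ≈⟨ +-congˡ (+-identityˡ y) ⟩
      x + y                ∎)

    ι₀-⊖ : ∀ m n → ι₀ (m ℤ.⊖ n) ≈ m × 1# + - (n × 1#)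
    ι₀-⊖ m       zero    = begin
      m × 1#         ≈⟨ +-identityʳ _ ⟨
      m × 1# + 0#    ≈⟨ +-congˡ -0#≈0# ⟨
      m × 1# + - 0#  ∎
    ι₀-⊖ zero    (suc n) = sym (+-identityˡ _)
    ι₀-⊖ (suc m) (suc n) = begin
      ι₀ (suc m ℤ.⊖ suc n)                      ≡⟨ ≡.cong ι₀ (ℤₚ.[1+m]⊖[1+n]≡m⊖n m n) ⟩
      ι₀ (m ℤ.⊖ n)                              ≈⟨ ι₀-⊖ m n ⟩
      m × 1# + - (n × 1#)                      ≈⟨ cancel _ _ 1# ⟩
      (1# + m × 1#) + (- 1# + - (n × 1#))      ≈⟨ +-congˡ (-‿+-comm 1# _) ⟩
      (1# + m × 1#) + - (1# + n × 1#)          ∎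

    ι₀-+ : ∀ i j → ι₀ (i ℤ.+ j) ≈ ι₀ i + ι₀ j
    ι₀-+ (+ m)      (+ n)      = ×-homo-+ 1# m n
    ι₀-+ (+ m)      (-[1+ n ]) = ι₀-⊖ m (suc n)
    ι₀-+ (-[1+ m ]) (+ n)      = trans (ι₀-⊖ n (suc m)) (+-comm _ _)
    ι₀-+ (-[1+ m ]) (-[1+ n ]) = begin
      - ((suc (suc (m ℕ.+ n))) × 1#)      ≡⟨ ≡.cong (λ k → - (k × 1#)) (ℕₚ.+-suc (suc m) n) ⟨
      - ((suc m ℕ.+ suc n) × 1#)          ≈⟨ -‿cong (×-homo-+ 1# (suc m) (suc n)) ⟩
      - (suc m × 1# + suc n × 1#)         ≈⟨ -‿+-comm _ _ ⟨
      - (suc m × 1#) + - (suc n × 1#)     ∎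

    ι₀-neg : ∀ i → ι₀ (ℤ.- i) ≈ - ι₀ i
    ι₀-neg (+ zero)   = sym -0#≈0#
    ι₀-neg (+ suc n)  = refl
    ι₀-neg (-[1+ n ]) = sym (-‿involutive _)

    ι₀-*⁺ : ∀ m n → ι₀ (+ m ℤ.* + n) ≈ ι₀ (+ m) * ι₀ (+ n)
    ι₀-*⁺ m n = begin
      ι₀ (+ m ℤ.* + n)      ≡⟨ ≡.cong ι₀ (ℤₚ.pos-* m n) ⟨
      (m ℕ.* n) × 1#       ≈⟨ ×1-homo-* m n ⟩
      ι₀ (+ m) * ι₀ (+ n)    ∎

    ι₀-*⁻ : ∀ i n → (∀ m → ι₀ (i ℤ.* + m) ≈ ι₀ i * ι₀ (+ m)) → ι₀ (i ℤ.* -[1+ n ]) ≈ ι₀ i * ι₀ -[1+ n ]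
    ι₀-*⁻ i n h = begin
      ι₀ (i ℤ.* (ℤ.- + suc n))    ≡⟨ ≡.cong ι₀ (ℤₚ.neg-distribʳ-* i (+ suc n)) ⟨
      ι₀ (ℤ.- (i ℤ.* + suc n))    ≈⟨ ι₀-neg (i ℤ.* + suc n) ⟩
      - ι₀ (i ℤ.* + suc n)        ≈⟨ -‿cong (h (suc n)) ⟩
      - (ι₀ i * ι₀ (+ suc n))      ≈⟨ -‿distribʳ-* _ _ ⟩
      ι₀ i * - ι₀ (+ suc n)        ∎

    ι₀-*ʳ : ∀ i m → ι₀ (i ℤ.* + m) ≈ ι₀ i * ι₀ (+ m)
    ι₀-*ʳ (+ k)      m = ι₀-*⁺ k m
    ι₀-*ʳ (-[1+ k ]) m = begin
      ι₀ (-[1+ k ] ℤ.* + m)       ≡⟨ ≡.cong ι₀ (ℤₚ.*-comm -[1+ k ] (+ m)) ⟩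
      ι₀ (+ m ℤ.* -[1+ k ])       ≈⟨ ι₀-*⁻ (+ m) k (ι₀-*⁺ m) ⟩
      ι₀ (+ m) * ι₀ -[1+ k ]       ≈⟨ *-comm _ _ ⟩
      ι₀ -[1+ k ] * ι₀ (+ m)       ∎

    ι₀-* : ∀ i j → ι₀ (i ℤ.* j) ≈ ι₀ i * ι₀ j
    ι₀-* i (+ n)      = ι₀-*ʳ i n
    ι₀-* i (-[1+ n ]) = ι₀-*⁻ i n (ι₀-*ʳ i)

  -- Multiples are left-nested without a trailing 0#, so that ι 1ℤ is 1# judgementally.
  ι : ℤ → Carrier
  ι (+ n)      = n ×′ 1#
  ι (-[1+ n ]) = - (suc n ×′ 1#)

  ι-pos : ∀ n → ι (+ n) ≈ n × 1#
  ι-pos n = sym (×ᵤ≈× n 1#)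

  private
    ι≈ι₀ : ∀ i → ι i ≈ ι₀ i
    ι≈ι₀ (+ n)      = ι-pos n
    ι≈ι₀ (-[1+ n ]) = -‿cong (ι-pos (suc n))

  ι-+ : ∀ i j → ι (i ℤ.+ j) ≈ ι i + ι j
  ι-+ i j = trans (ι≈ι₀ (i ℤ.+ j)) (trans (ι₀-+ i j) (+-cong (sym (ι≈ι₀ i)) (sym (ι≈ι₀ j))))

  ι-* : ∀ i j → ι (i ℤ.* j) ≈ ι i * ι j
  ι-* i j = trans (ι≈ι₀ (i ℤ.* j)) (trans (ι₀-* i j) (*-cong (sym (ι≈ι₀ i)) (sym (ι≈ι₀ j))))

  ι-neg : ∀ i → ι (ℤ.- i) ≈ - ι i
  ι-neg i = trans (ι≈ι₀ (ℤ.- i)) (trans (ι₀-neg i) (-‿cong (sym (ι≈ι₀ i))))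

  private
    almostCommutativeRing : AlmostCommutativeRing c ℓ
    almostCommutativeRing = fromCommutativeRing R

    -- With integers as coefficients the solver can normalise identities with constants in any
    -- commutative ring, even one whose own equality is not decidable.
    morphism : ℤ.+-*-rawRing -Raw-AlmostCommutative⟶ almostCommutativeRing
    morphism = record
      { ⟦_⟧ = ι ; +-homo = ι-+ ; *-homo = ι-* ; -‿homo = ι-neg
      ; 0-homo = refl ; 1-homo = refl }

    ι-≟ : ∀ i j → Maybe (ι i ≈ ι j)
    ι-≟ i j with i ℤₚ.≟ j
    ... | yes ≡.refl = just refl
    ... | no _       = nothing

  open RingSolver ℤ.+-*-rawRing almostCommutativeRing morphism ι-≟ public
    using (Polynomial; solve; con; _:+_; _:*_; _:-_; :-_; _:=_; _:^_)

-- The Eisenstein integers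

infix 5 _+ω_

record ℤ[ω] : Set where
  constructor _+ω_
  field
    constant : ℤ
    ω-coefficient : ℤ


module Eisenstein where

  infixl 6 _+_
  infixl 7 _*_

  0# 1# ω ω² : ℤ[ω]
  0# = 0ℤ +ω 0ℤ
  1# = 1ℤ +ω 0ℤ
  ω  = 0ℤ +ω 1ℤ
  ω² = ℤ.-1ℤ +ω ℤ.-1ℤ

  -- Products are reduced by ω² = -1 - ω, which is also the conjugate of ω.
  _+_ _*_ : ℤ[ω] → ℤ[ω] → ℤ[ω]
  (a +ω b) + (c +ω d) = (a ℤ.+ c) +ω (b ℤ.+ d)
  (a +ω b) * (c +ω d) = (a ℤ.* c ℤ.- b ℤ.* d) +ω (a ℤ.* d ℤ.+ b ℤ.* c ℤ.- b ℤ.* d)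

  -_ conjugate : ℤ[ω] → ℤ[ω]
  - (a +ω b)         = (ℤ.- a) +ω (ℤ.- b)
  conjugate (a +ω b) = (a ℤ.- b) +ω (ℤ.- b)

  norm trace : ℤ[ω] → ℤ
  norm (a +ω b)  = a ℤ.* a ℤ.- a ℤ.* b ℤ.+ b ℤ.* b
  trace (a +ω b) = a ℤ.+ a ℤ.- b

  fromℤ : ℤ → ℤ[ω]
  fromℤ a = a +ω 0ℤ

  isCommutativeRing : IsCommutativeRing _≡_ _+_ _*_ -_ 0# 1#
  isCommutativeRing = record
    { isRing = record
      { +-isAbelianGroup = record
        { isGroup = record
          { isMonoid = record
            { isSemigroup = record
              { isMagma = record { isEquivalence = ≡.isEquivalence ; ∙-cong = ≡.cong₂ _+_ }
              ; assoc = λ (a +ω b) (c +ω d) (e +ω f) → ≡.cong₂ _+ω_ (ℤₚ.+-assoc a c e) (ℤₚ.+-assoc b d f) }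
            ; identity = (λ (a +ω b) → ≡.cong₂ _+ω_ (ℤₚ.+-identityˡ a) (ℤₚ.+-identityˡ b))
                       , (λ (a +ω b) → ≡.cong₂ _+ω_ (ℤₚ.+-identityʳ a) (ℤₚ.+-identityʳ b)) }
          ; inverse = (λ (a +ω b) → ≡.cong₂ _+ω_ (ℤₚ.+-inverseˡ a) (ℤₚ.+-inverseˡ b))
                    , (λ (a +ω b) → ≡.cong₂ _+ω_ (ℤₚ.+-inverseʳ a) (ℤₚ.+-inverseʳ b))
          ; ⁻¹-cong = ≡.cong -_ }
        ; comm = λ (a +ω b) (c +ω d) → ≡.cong₂ _+ω_ (ℤₚ.+-comm a c) (ℤₚ.+-comm b d) }
      ; *-cong = ≡.cong₂ _*_
      ; *-assoc = λ (a +ω b) (c +ω d) (e +ω f) → ≡.cong₂ _+ω_ (assoc-re a b c d e f) (assoc-im a b c d e f)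
      ; *-identity = (λ x → ≡.trans (*-comm 1# x) (identityʳ x)) , identityʳ
      ; distrib = distribˡ
                , (λ x y z → ≡.trans (*-comm (y + z) x) (≡.trans (distribˡ x y z) (≡.cong₂ _+_ (*-comm x y) (*-comm x z)))) }
    ; *-comm = *-comm }
    where
    comm-re : ∀ a b c d → a ℤ.* c ℤ.- b ℤ.* d ≡ c ℤ.* a ℤ.- d ℤ.* b
    comm-re = ℤ-solve
    comm-im : ∀ a b c d → a ℤ.* d ℤ.+ b ℤ.* c ℤ.- b ℤ.* d ≡ c ℤ.* b ℤ.+ d ℤ.* a ℤ.- d ℤ.* b
    comm-im = ℤ-solve
    *-comm : ∀ x y → x * y ≡ y * x
    *-comm (a +ω b) (c +ω d) = ≡.cong₂ _+ω_ (comm-re a b c d) (comm-im a b c d)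
    id-re : ∀ a b → a ℤ.* 1ℤ ℤ.- b ℤ.* 0ℤ ≡ a
    id-re = ℤ-solve
    id-im : ∀ a b → a ℤ.* 0ℤ ℤ.+ b ℤ.* 1ℤ ℤ.- b ℤ.* 0ℤ ≡ b
    id-im = ℤ-solve
    identityʳ : ∀ x → x * 1# ≡ x
    identityʳ (a +ω b) = ≡.cong₂ _+ω_ (id-re a b) (id-im a b)
    assoc-re : ∀ a b c d e f → (a ℤ.* c ℤ.- b ℤ.* d) ℤ.* e ℤ.- (a ℤ.* d ℤ.+ b ℤ.* c ℤ.- b ℤ.* d) ℤ.* f
      ≡ a ℤ.* (c ℤ.* e ℤ.- d ℤ.* f) ℤ.- b ℤ.* (c ℤ.* f ℤ.+ d ℤ.* e ℤ.- d ℤ.* f)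
    assoc-re = ℤ-solve
    assoc-im : ∀ a b c d e f →
      (a ℤ.* c ℤ.- b ℤ.* d) ℤ.* f ℤ.+ (a ℤ.* d ℤ.+ b ℤ.* c ℤ.- b ℤ.* d) ℤ.* e ℤ.- (a ℤ.* d ℤ.+ b ℤ.* c ℤ.- b ℤ.* d) ℤ.* f
      ≡ a ℤ.* (c ℤ.* f ℤ.+ d ℤ.* e ℤ.- d ℤ.* f) ℤ.+ b ℤ.* (c ℤ.* e ℤ.- d ℤ.* f) ℤ.- b ℤ.* (c ℤ.* f ℤ.+ d ℤ.* e ℤ.- d ℤ.* f)
    assoc-im = ℤ-solve
    distrib-re : ∀ a b c d e f → a ℤ.* (c ℤ.+ e) ℤ.- b ℤ.* (d ℤ.+ f) ≡ (a ℤ.* c ℤ.- b ℤ.* d) ℤ.+ (a ℤ.* e ℤ.- b ℤ.* f)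
    distrib-re = ℤ-solve
    distrib-im : ∀ a b c d e f → a ℤ.* (d ℤ.+ f) ℤ.+ b ℤ.* (c ℤ.+ e) ℤ.- b ℤ.* (d ℤ.+ f)
      ≡ (a ℤ.* d ℤ.+ b ℤ.* c ℤ.- b ℤ.* d) ℤ.+ (a ℤ.* f ℤ.+ b ℤ.* e ℤ.- b ℤ.* f)
    distrib-im = ℤ-solve
    distribˡ : ∀ x y z → x * (y + z) ≡ x * y + x * z
    distribˡ (a +ω b) (c +ω d) (e +ω f) = ≡.cong₂ _+ω_ (distrib-re a b c d e f) (distrib-im a b c d e f)

  commutativeRing : CommutativeRing 0ℓ 0ℓ
  commutativeRing = record { isCommutativeRing = isCommutativeRing }

  conjugate-* : ∀ x y → conjugate (x * y) ≡ conjugate x * conjugate y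
  conjugate-* (a +ω b) (c +ω d) = ≡.cong₂ _+ω_ (re a b c d) (im a b c d)
    where
    re : ∀ a b c d → (a ℤ.* c ℤ.- b ℤ.* d) ℤ.- (a ℤ.* d ℤ.+ b ℤ.* c ℤ.- b ℤ.* d)
      ≡ (a ℤ.- b) ℤ.* (c ℤ.- d) ℤ.- (ℤ.- b) ℤ.* (ℤ.- d)
    re = ℤ-solve
    im : ∀ a b c d → ℤ.- (a ℤ.* d ℤ.+ b ℤ.* c ℤ.- b ℤ.* d)
      ≡ (a ℤ.- b) ℤ.* (ℤ.- d) ℤ.+ (ℤ.- b) ℤ.* (c ℤ.- d) ℤ.- (ℤ.- b) ℤ.* (ℤ.- d)
    im = ℤ-solve

  conjugate-+ : ∀ x y → conjugate (x + y) ≡ conjugate x + conjugate y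
  conjugate-+ (a +ω b) (c +ω d) = ≡.cong₂ _+ω_ (re a b c d) (ℤₚ.neg-distrib-+ b d)
    where
    re : ∀ a b c d → (a ℤ.+ c) ℤ.- (b ℤ.+ d) ≡ (a ℤ.- b) ℤ.+ (c ℤ.- d)
    re = ℤ-solve

  x*conjugate[x] : ∀ x → x * conjugate x ≡ fromℤ (norm x)
  x*conjugate[x] (a +ω b) = ≡.cong₂ _+ω_ (re a b) (im a b)
    where
    re : ∀ a b → a ℤ.* (a ℤ.- b) ℤ.- b ℤ.* (ℤ.- b) ≡ a ℤ.* a ℤ.- a ℤ.* b ℤ.+ b ℤ.* b
    re = ℤ-solve
    im : ∀ a b → a ℤ.* (ℤ.- b) ℤ.+ b ℤ.* (a ℤ.- b) ℤ.- b ℤ.* (ℤ.- b) ≡ 0ℤ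
    im = ℤ-solve

  x+conjugate[x] : ∀ x → x + conjugate x ≡ fromℤ (trace x)
  x+conjugate[x] (a +ω b) = ≡.cong₂ _+ω_ (re a b) (ℤₚ.+-inverseʳ b)
    where
    re : ∀ a b → a ℤ.+ (a ℤ.- b) ≡ a ℤ.+ a ℤ.- b
    re = ℤ-solve

  norm-* : ∀ x y → norm (x * y) ≡ norm x ℤ.* norm y
  norm-* (a +ω b) (c +ω d) = lemma a b c d
    where
    lemma : ∀ a b c d → (a ℤ.* c ℤ.- b ℤ.* d) ℤ.* (a ℤ.* c ℤ.- b ℤ.* d)
      ℤ.- (a ℤ.* c ℤ.- b ℤ.* d) ℤ.* (a ℤ.* d ℤ.+ b ℤ.* c ℤ.- b ℤ.* d)
      ℤ.+ (a ℤ.* d ℤ.+ b ℤ.* c ℤ.- b ℤ.* d) ℤ.* (a ℤ.* d ℤ.+ b ℤ.* c ℤ.- b ℤ.* d)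
      ≡ (a ℤ.* a ℤ.- a ℤ.* b ℤ.+ b ℤ.* b) ℤ.* (c ℤ.* c ℤ.- c ℤ.* d ℤ.+ d ℤ.* d)
    lemma = ℤ-solve

  trace-+ : ∀ x y → trace (x + y) ≡ trace x ℤ.+ trace y
  trace-+ (a +ω b) (c +ω d) = lemma a b c d
    where
    lemma : ∀ a b c d → (a ℤ.+ c) ℤ.+ (a ℤ.+ c) ℤ.- (b ℤ.+ d) ≡ (a ℤ.+ a ℤ.- b) ℤ.+ (c ℤ.+ c ℤ.- d)
    lemma = ℤ-solve

-- Finite fields

module _ {c ℓ} (M : CommutativeMonoid c ℓ) where

  open CommutativeMonoid M
  open MonoidSum M

  sum-single : ∀ {n} (t : Fin n → Carrier) i → (∀ j → j ≢ i → t j ≈ ε) → sum t ≈ t i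
  sum-single {suc n} t zero    h = trans
    (∙-congˡ (trans (sum-cong-≋ (λ j → h (suc j) λ ())) (sum-replicate-zero n))) (identityʳ _)
  sum-single {suc n} t (suc i) h = trans
    (∙-cong (h zero λ ()) (sum-single (t ∘ suc) i (λ j j≢i → h (suc j) (j≢i ∘ Finₚ.suc-injective)))) (identityˡ _)

module FieldSums {c ℓ q} (F : FiniteField c ℓ q) {c′ ℓ′} (M : CommutativeMonoid c′ ℓ′) where

  private
    module F = FiniteField F
    open CommutativeMonoid M
    open MonoidSum M

  -- The target monoid is left open: it will be the multiplicative monoid of the field (Fermat's
  -- little theorem), its additive group (power sums) and ℤ[ω] (character sums).
  ∑ : (F.Carrier → Carrier) → Carrier
  ∑ f = sum (λ i → f (F.from i))

  private
    variable
      f g : F.Carrier → Carrier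

  Congruent : (F.Carrier → Carrier) → Set _
  Congruent f = ∀ {x y} → x F.≈ y → f x ≈ f y

  ∑-cong : (∀ x → f x ≈ g x) → ∑ f ≈ ∑ g
  ∑-cong f≈g = sum-cong-≋ (λ i → f≈g (F.from i))

  ∑-∙ : ∀ f g → ∑ (λ x → f x ∙ g x) ≈ ∑ f ∙ ∑ g
  ∑-∙ f g = ∑-distrib-+ (f ∘ F.from) (g ∘ F.from)

  ∑-bijection : Congruent f → (φ ψ : F.Carrier → F.Carrier) →
    (∀ {x y} → x F.≈ y → φ x F.≈ φ y) → (∀ {x y} → x F.≈ y → ψ x F.≈ ψ y) →
    (∀ x → φ (ψ x) F.≈ x) → (∀ x → ψ (φ x) F.≈ x) → ∑ (f ∘ φ) ≈ ∑ f
  ∑-bijection {f} f-cong φ ψ φ-cong ψ-cong φψ ψφ = sym (trans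
    (∑-permute (f ∘ F.from) (permutation (index φ) (index ψ) (inverse φ ψ φ-cong φψ) (inverse ψ φ ψ-cong ψφ)))
    (sum-cong-≋ (λ i → f-cong (F.strictlyInverseʳ (φ (F.from i))))))
    where
    index : (F.Carrier → F.Carrier) → Fin q → Fin q
    index φ i = F.to (φ (F.from i))
    inverse : ∀ φ ψ → (∀ {x y} → x F.≈ y → φ x F.≈ φ y) → (∀ x → φ (ψ x) F.≈ x) →
      ∀ i → index φ (index ψ i) ≡ i
    inverse φ ψ φ-cong φψ i = ≡.trans
      (F.to-cong (F.trans (φ-cong (F.strictlyInverseʳ _)) (φψ _))) (F.strictlyInverseˡ i)

  ∑-single : Congruent f → ∀ a → (∀ x → ¬ x F.≈ a → f x ≈ ε) → ∑ f ≈ f a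
  ∑-single {f} f-cong a h = trans
    (sum-single M (f ∘ F.from) (F.to a) λ j j≢ → h (F.from j) λ e →
      j≢ (≡.trans (≡.sym (F.strictlyInverseˡ j)) (F.to-cong e)))
    (f-cong (F.strictlyInverseʳ a))

module FieldRingSums {c ℓ q} (F : FiniteField c ℓ q) {c′ ℓ′} (R : CommutativeRing c′ ℓ′) where

  private
    module F = FiniteField F
    open CommutativeRing R
    open MonoidSum +-commutativeMonoid
    open SemiringSum semiring using (*-distribˡ-sum)

  open FieldSums F +-commutativeMonoid public renaming (∑-∙ to ∑-+)

  *-distribˡ-∑ : ∀ a f → a * ∑ f ≈ ∑ (λ x → a * f x)
  *-distribˡ-∑ a f = *-distribˡ-sum {q} a (f ∘ F.from)

  ∑-swap : ∀ (f : F.Carrier → F.Carrier → Carrier) → ∑ (λ x → ∑ (f x)) ≈ ∑ (λ y → ∑ (λ x → f x y))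
  ∑-swap f = ∑-comm {q} {q} (λ i j → f (F.from i) (F.from j))

module FieldTheory {c ℓ q} (F : FiniteField c ℓ q) where

  open FiniteField F hiding (zero)
  open import Algebra.Properties.Group +-group public using () renaming (x≈y⇒x∙y⁻¹≈ε to x≈y⇒x-y≈0; x∙y⁻¹≈ε⇒x≈y to x-y≈0⇒x≈y)
  open Exp semiring public
  open import Algebra.Properties.CommutativeSemiring.Exp commutativeSemiring public using (^-distrib-*)
  open import Algebra.Properties.Monoid.Mult +-monoid public using (_×_; ×-congʳ)
  open import Algebra.Properties.Semiring.Mult semiring public using (×1-homo-*; ×-assoc-*)
  open IntegersIn commutativeRing public
  open import Relation.Binary.Reasoning.Setoid ≈-setoid

  x*y≈0⇒x≈0∨y≈0 : ∀ {x y} → x * y ≈ 0# → x ≈ 0# ⊎ y ≈ 0#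
  x*y≈0⇒x≈0∨y≈0 {x} {y} xy≈0 with x ≈? 0#
  ... | yes x≈0 = inj₁ x≈0
  ... | no x≉0  = let (z , xz≈1) = invertible x x≉0 in inj₂ (begin
    y            ≈⟨ *-identityˡ y ⟨
    1# * y       ≈⟨ *-congʳ xz≈1 ⟨
    x * z * y    ≈⟨ solve 3 (λ x y z → x :* z :* y := (x :* y) :* z) refl x y z ⟩
    (x * y) * z  ≈⟨ *-congʳ xy≈0 ⟩
    0# * z       ≈⟨ zeroˡ z ⟩
    0#           ∎)

  *-≉0 : ∀ {x y} → ¬ x ≈ 0# → ¬ y ≈ 0# → ¬ x * y ≈ 0#
  *-≉0 x≉0 y≉0 xy≈0 with x*y≈0⇒x≈0∨y≈0 xy≈0
  ... | inj₁ x≈0 = x≉0 x≈0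
  ... | inj₂ y≈0 = y≉0 y≈0

  *-cancelˡ : ∀ {x y z} → ¬ x ≈ 0# → x * y ≈ x * z → y ≈ z
  *-cancelˡ {x} {y} {z} x≉0 xy≈xz with x*y≈0⇒x≈0∨y≈0 {x} {y - z}
    (trans (solve 3 (λ x y z → x :* (y :- z) := x :* y :- x :* z) refl x y z) (x≈y⇒x-y≈0 xy≈xz))
  ... | inj₁ x≈0   = contradiction x≈0 x≉0
  ... | inj₂ y-z≈0 = x-y≈0⇒x≈y _ _ y-z≈0

  x*y≈1⇒x*[y*z]≈z : ∀ {x y} → x * y ≈ 1# → ∀ z → x * (y * z) ≈ z
  x*y≈1⇒x*[y*z]≈z xy≈1 z = trans (sym (*-assoc _ _ z)) (trans (*-congʳ xy≈1) (*-identityˡ z))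

  -x≈0⇒x≈0 : ∀ {x} → - x ≈ 0# → x ≈ 0#
  -x≈0⇒x≈0 {x} e = trans (solve 1 (λ x → x := :- (:- x)) refl x) (trans (-‿cong e) (solve 0 (:- con 0ℤ := con 0ℤ) refl))

  ^-≉0 : ∀ {x} n → ¬ x ≈ 0# → ¬ x ^ n ≈ 0#
  ^-≉0 zero    x≉0 = 1≉0
  ^-≉0 (suc n) x≉0 = *-≉0 x≉0 (^-≉0 n x≉0)

  1^n≈1 : ∀ n → 1# ^ n ≈ 1#
  1^n≈1 zero    = refl
  1^n≈1 (suc n) = trans (*-identityˡ _) (1^n≈1 n)

  infix 8 _⁻¹

  -- The value 0 at 0 makes inversion an involution of the whole field, so that a sum over the field
  -- can be reindexed by it; the term at 0 is corrected separately.
  _⁻¹ : Carrier → Carrier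
  x ⁻¹ with x ≈? 0#
  ... | yes _  = 0#
  ... | no x≉0 = proj₁ (invertible x x≉0)

  x≈0⇒x⁻¹≈0 : ∀ {x} → x ≈ 0# → x ⁻¹ ≈ 0#
  x≈0⇒x⁻¹≈0 {x} x≈0 with x ≈? 0#
  ... | yes _  = refl
  ... | no x≉0 = contradiction x≈0 x≉0

  x*x⁻¹≈1 : ∀ {x} → ¬ x ≈ 0# → x * x ⁻¹ ≈ 1#
  x*x⁻¹≈1 {x} x≉0 with x ≈? 0#
  ... | yes x≈0 = contradiction x≈0 x≉0
  ... | no x≉0′ = proj₂ (invertible x x≉0′)

  x⁻¹≉0 : ∀ {x} → ¬ x ≈ 0# → ¬ x ⁻¹ ≈ 0#
  x⁻¹≉0 x≉0 x⁻¹≈0 = 1≉0 (trans (sym (x*x⁻¹≈1 x≉0)) (trans (*-congˡ x⁻¹≈0) (zeroʳ _)))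

  ⁻¹-cong : ∀ {x y} → x ≈ y → x ⁻¹ ≈ y ⁻¹
  ⁻¹-cong {x} {y} x≈y = ⁻¹-cong′ (x ≈? 0#)
    where
    ⁻¹-cong′ : Dec (x ≈ 0#) → x ⁻¹ ≈ y ⁻¹
    ⁻¹-cong′ (yes x≈0) = trans (x≈0⇒x⁻¹≈0 x≈0) (sym (x≈0⇒x⁻¹≈0 (trans (sym x≈y) x≈0)))
    ⁻¹-cong′ (no x≉0)  = *-cancelˡ x≉0 (trans (x*x⁻¹≈1 x≉0)
      (trans (sym (x*x⁻¹≈1 (x≉0 ∘ trans x≈y))) (*-congʳ (sym x≈y))))

  ⁻¹-involutive : ∀ x → x ⁻¹ ⁻¹ ≈ x
  ⁻¹-involutive x = ⁻¹-involutive′ (x ≈? 0#)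
    where
    ⁻¹-involutive′ : Dec (x ≈ 0#) → x ⁻¹ ⁻¹ ≈ x
    ⁻¹-involutive′ (yes x≈0) = trans (x≈0⇒x⁻¹≈0 (x≈0⇒x⁻¹≈0 x≈0)) (sym x≈0)
    ⁻¹-involutive′ (no x≉0)  = *-cancelˡ (x⁻¹≉0 x≉0)
      (trans (x*x⁻¹≈1 (x⁻¹≉0 x≉0)) (trans (sym (x*x⁻¹≈1 x≉0)) (*-comm _ _)))

  if≈0 : ∀ {a} {A : Set a} → Carrier → A → A → A
  if≈0 x s t with x ≈? 0#
  ... | yes _ = s
  ... | no _  = t

  if-yes : ∀ {a} {A : Set a} {x} {s t : A} → x ≈ 0# → if≈0 x s t ≡ s
  if-yes {x = x} x≈0 with x ≈? 0#
  ... | yes _  = ≡.refl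
  ... | no x≉0 = contradiction x≈0 x≉0

  if-no : ∀ {a} {A : Set a} {x} {s t : A} → ¬ x ≈ 0# → if≈0 x s t ≡ t
  if-no {x = x} x≉0 with x ≈? 0#
  ... | yes x≈0 = contradiction x≈0 x≉0
  ... | no _    = ≡.refl

  if-cong : ∀ {a r} {A : Set a} (_~_ : Rel A r) {u v s s′ t t′} → u ≈ v → s ~ s′ → t ~ t′ → if≈0 u s t ~ if≈0 v s′ t′
  if-cong _~_ {u} {v} u≈v s~s′ t~t′ with u ≈? 0# | v ≈? 0#
  ... | yes _   | yes _   = s~s′
  ... | yes u≈0 | no v≉0  = contradiction (trans (sym u≈v) u≈0) v≉0
  ... | no u≉0  | yes v≈0 = contradiction (trans u≈v v≈0) u≉0
  ... | no _    | no _    = t~t′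

  private
    module ∏ = FieldSums F *-commutativeMonoid
    open MonoidSum *-commutativeMonoid using () renaming (sum to product; sum-replicate to product-replicate)

    product-≉0 : ∀ {n} (t : Fin n → Carrier) → (∀ i → ¬ t i ≈ 0#) → ¬ product t ≈ 0#
    product-≉0 {zero}  t t≉0 = 1≉0
    product-≉0 {suc n} t t≉0 = *-≉0 (t≉0 zero) (product-≉0 (t ∘ suc) (t≉0 ∘ suc))

  -- Multiplication by x permutes the nonzero elements, so the product of all x u / u over u ≉ 0 is 1.
  x^q≈x : ∀ {x} → ¬ x ≈ 0# → x ^ q ≈ x
  x^q≈x {x} x≉0 = begin
    x ^ q              ≈⟨ product-replicate q ⟨
    ∏.∑ (λ _ → x)      ≈⟨ ∏.∑-cong (λ u → kd u) ⟨
    ∏.∑ (λ u → k u * d u) ≈⟨ ∏.∑-∙ k d ⟩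
    ∏.∑ k * ∏.∑ d      ≈⟨ *-cong ∏k≈1 ∏d≈x ⟩
    1# * x             ≈⟨ *-identityˡ x ⟩
    x                  ∎
    where
    -- The element 0 stays in the range of the products with the factor 1 in `h` and `k`; the factor
    -- x that `k` thereby misses is supplied by `d`.
    h k d : Carrier → Carrier
    h u = if≈0 u 1# u
    k u = if≈0 u 1# x
    d u = if≈0 u x 1#

    kd : ∀ u → k u * d u ≈ x
    kd u with u ≈? 0#
    ... | yes _ = *-identityˡ x
    ... | no _  = *-identityʳ x

    ∏d≈x : ∏.∑ d ≈ x
    ∏d≈x = trans (∏.∑-single (λ e → if-cong _≈_ e refl refl) 0# (λ u u≉0 → reflexive (if-no u≉0))) (reflexive (if-yes refl))

    h≉0 : ∀ u → ¬ h u ≈ 0#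
    h≉0 u with u ≈? 0#
    ... | yes _  = 1≉0
    ... | no u≉0 = u≉0

    h[xu] : ∀ u → h (x * u) ≈ k u * h u
    h[xu] u with u ≈? 0#
    ... | yes u≈0 = trans (reflexive (if-yes (trans (*-congˡ u≈0) (zeroʳ x)))) (sym (*-identityˡ 1#))
    ... | no u≉0  = reflexive (if-no (*-≉0 x≉0 u≉0))

    ∏k≈1 : ∏.∑ k ≈ 1#
    ∏k≈1 = *-cancelˡ (product-≉0 (h ∘ from) (h≉0 ∘ from)) (begin
      ∏.∑ h * ∏.∑ k           ≈⟨ *-comm _ _ ⟩
      ∏.∑ k * ∏.∑ h           ≈⟨ ∏.∑-∙ k h ⟨
      ∏.∑ (λ u → k u * h u)   ≈⟨ ∏.∑-cong h[xu] ⟨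
      ∏.∑ (λ u → h (x * u))   ≈⟨ ∏.∑-bijection (λ e → if-cong _≈_ e refl e) (x *_) (x ⁻¹ *_) *-congˡ *-congˡ
                                   (x*y≈1⇒x*[y*z]≈z (x*x⁻¹≈1 x≉0))
                                   (x*y≈1⇒x*[y*z]≈z (trans (*-comm _ _) (x*x⁻¹≈1 x≉0))) ⟩
      ∏.∑ h                   ≈⟨ *-identityʳ _ ⟨
      ∏.∑ h * 1#              ∎)

  x^[q-1]≈1 : ∀ {r x} → q ≡ suc r → ¬ x ≈ 0# → x ^ r ≈ 1#
  x^[q-1]≈1 {r} {x} ≡.refl x≉0 = *-cancelˡ x≉0 (trans (x^q≈x x≉0) (sym (*-identityʳ x)))

  module ∑F = FieldRingSums F commutativeRing

  -- Translation by 1 permutes the field, so the sum of all x equals the sum of all x + 1.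
  q×1≈0 : q × 1# ≈ 0#
  q×1≈0 = begin
    q × 1#                            ≈⟨ MonoidSum.sum-replicate +-commutativeMonoid q ⟨
    ∑F.∑ (λ _ → 1#)                   ≈⟨ solve 2 (λ s t → t := :- s :+ (s :+ t)) refl (∑F.∑ id) _ ⟩
    - ∑F.∑ id + (∑F.∑ id + ∑F.∑ (λ _ → 1#)) ≈⟨ +-congˡ (∑F.∑-+ id (λ _ → 1#)) ⟨
    - ∑F.∑ id + ∑F.∑ (λ x → x + 1#)   ≈⟨ +-congˡ (∑F.∑-bijection (λ e → e) (_+ 1#) (_- 1#) +-congʳ +-congʳ
                                          (λ x → solve 2 (λ x o → x :- o :+ o := x) refl x 1#)
                                          (λ x → solve 2 (λ x o → x :+ o :- o := x) refl x 1#)) ⟩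
    - ∑F.∑ id + ∑F.∑ id               ≈⟨ -‿inverseˡ _ ⟩
    0#                                ∎

  -- The vector holds the coefficients below the leading 1, constant first, so its length is the
  -- degree.
  monic : ∀ {d} → Vec Carrier d → Carrier → Carrier
  monic []       x = 1#
  monic (a ∷ as) x = a + x * monic as x

  private
    -- Synthetic division by X - r: the coefficients of the quotient are the values at r of the
    -- successive Horner tails, and the remainder is the value at r of the whole polynomial.
    quotient : ∀ {d} → Vec Carrier (suc d) → Carrier → Vec Carrier d
    quotient (a ∷ [])     r = []
    quotient (a ∷ b ∷ as) r = monic (b ∷ as) r ∷ quotient (b ∷ as) r

    factor : ∀ {d} (as : Vec Carrier (suc d)) r x →
      monic as x ≈ monic as r + (x - r) * monic (quotient as r) x
    factor (a ∷ [])     r x = solve 4 (λ a r x o → a :+ x :* o := (a :+ r :* o) :+ (x :- r) :* o) refl a r x 1#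
    factor (a ∷ b ∷ as) r x = begin
      a + x * monic (b ∷ as) x              ≈⟨ +-congˡ (*-congˡ (factor (b ∷ as) r x)) ⟩
      a + x * (g + (x - r) * h)             ≈⟨ solve 5 (λ a r x g h → a :+ x :* (g :+ (x :- r) :* h)
                                                 := (a :+ r :* g) :+ (x :- r) :* (g :+ x :* h)) refl a r x g h ⟩
      (a + r * g) + (x - r) * (g + x * h)   ∎
      where
      g = monic (b ∷ as) r
      h = monic (quotient (b ∷ as) r) x

  -- Dividing by X - r for the first point r leaves the other points as roots of a monic polynomial
  -- of one degree less; in degree 0 it is the constant 1.
  monic-roots-bounded : ∀ {d} (as : Vec Carrier d) (points : Fin (suc d) → Carrier) →
    (∀ i j → points i ≈ points j → i ≡ j) → ¬ (∀ i → monic as (points i) ≈ 0#)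
  monic-roots-bounded []         points inj roots = 1≉0 (roots zero)
  monic-roots-bounded as@(_ ∷ _) points inj roots =
    monic-roots-bounded (quotient as r) (points ∘ suc) (λ i j e → Finₚ.suc-injective (inj _ _ e)) root
    where
    r = points zero
    root : ∀ i → monic (quotient as r) (points (suc i)) ≈ 0#
    root i with x*y≈0⇒x≈0∨y≈0 {points (suc i) - r} {monic (quotient as r) (points (suc i))} (begin
      (points (suc i) - r) * monic (quotient as r) (points (suc i))  ≈⟨ +-identityˡ _ ⟨
      0# + _                        ≈⟨ +-congʳ (roots zero) ⟨
      monic as r + _                ≈⟨ factor as r (points (suc i)) ⟨
      monic as (points (suc i))     ≈⟨ roots (suc i) ⟩
      0#                            ∎)
    ... | inj₁ x-r≈0 = contradiction (inj _ _ (x-y≈0⇒x≈y _ _ x-r≈0)) λ ()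
    ... | inj₂ root  = root

  -- The polynomial x (x^m - 1) has degree m + 1 < q, so some element is not a root.
  ∃-x^m≉1 : ∀ m → .{{NonZero m}} → suc m ℕ.< q → ∃ λ x → ¬ x ≈ 0# ∧ ¬ x ^ m ≈ 1#
  ∃-x^m≉1 (suc m) 2+m<q = from i , x≉0 , x^m≉1
    where
    zeros : ∀ m → Vec Carrier m
    zeros zero    = []
    zeros (suc m) = 0# ∷ zeros m
    monic-zeros : ∀ m x → monic (zeros m) x ≈ x ^ m
    monic-zeros zero    x = refl
    monic-zeros (suc m) x = trans (+-identityˡ _) (*-congˡ (monic-zeros m x))
    as : Vec Carrier (suc (suc m))
    as = 0# ∷ - 1# ∷ zeros m
    eval-as : ∀ x → monic as x ≈ x * (- 1# + x ^ suc m)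
    eval-as x = trans (+-identityˡ _) (*-congˡ (+-congˡ (*-congˡ (monic-zeros m x))))
    points : Fin (suc (suc (suc m))) → Carrier
    points i = from (Fin.inject≤ i 2+m<q)
    inj : ∀ i j → points i ≈ points j → i ≡ j
    inj i j e = Finₚ.inject≤-injective 2+m<q 2+m<q i j
      (≡.trans (≡.sym (strictlyInverseˡ _)) (≡.trans (to-cong e) (strictlyInverseˡ _)))
    nonroot : ∃ λ i → ¬ monic as (from i) ≈ 0#
    nonroot = Finₚ.¬∀⟶∃¬ q (λ i → monic as (from i) ≈ 0#) (λ i → monic as (from i) ≈? 0#)
      (λ roots → monic-roots-bounded as points inj (λ i → roots (Fin.inject≤ i 2+m<q)))
    i = proj₁ nonroot
    x≉0 : ¬ from i ≈ 0#
    x≉0 x≈0 = proj₂ nonroot (trans (eval-as _) (trans (*-congʳ x≈0) (zeroˡ _)))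
    x^m≉1 : ¬ from i ^ suc m ≈ 1#
    x^m≉1 e = proj₂ nonroot (trans (eval-as _)
      (trans (*-congˡ (trans (+-congˡ e) (-‿inverseˡ 1#))) (zeroʳ _)))

-- Characteristic and power sums

p∣d∧d<p⇒d≡0 : ∀ {p d} → p ℕ∣.∣ d → d ℕ.< p → d ≡ 0
p∣d∧d<p⇒d≡0 {d = zero}  _   _   = ≡.refl
p∣d∧d<p⇒d≡0 {d = suc d} p∣d d<p = contradiction p∣d (ℕ∣.>⇒∤ d<p)

prime∤⇒coprime : ∀ {p m} → Prime p → ¬ p ℕ∣.∣ m → Coprime p m
prime∤⇒coprime p-prime p∤m (d∣p , d∣m) with prime⇒irreducible p-prime d∣p
... | inj₁ d≡1    = d≡1
... | inj₂ ≡.refl = contradiction d∣m p∤m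

module Characteristic {c ℓ q} (F : FiniteField c ℓ q) where

  open FiniteField F hiding (zero)
  open FieldTheory F
  open import Relation.Binary.Reasoning.Setoid ≈-setoid

  private
    multiple≈0 : ∀ m x → m × 1# ≈ 0# → (x ℕ.* m) × 1# ≈ 0#
    multiple≈0 m x m≈0 = trans (×1-homo-* x m) (trans (*-congˡ m≈0) (zeroʳ _))

    no-Bézout : ∀ {a b} → a × 1# ≈ 0# → b × 1# ≈ 0# → 1 ℕ.+ a ≡ b → 1# ≈ 0#
    no-Bézout {a} {b} a≈0 b≈0 1+a≡b = begin
      1#           ≈⟨ +-identityʳ 1# ⟨
      1# + 0#      ≈⟨ +-congˡ a≈0 ⟨
      1# + a × 1#  ≡⟨ ≡.cong (_× 1#) 1+a≡b ⟩
      b × 1#       ≈⟨ b≈0 ⟩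
      0#           ∎

  -- If p did not divide m, Bézout's identity would express 1 through p and m, both of which vanish
  -- in the field.
  m×1≈0⇒p∣m : ∀ {p m} → Prime p → p × 1# ≈ 0# → m × 1# ≈ 0# → p ℕ∣.∣ m
  m×1≈0⇒p∣m {p} {m} p-prime p≈0 m≈0 with p ℕ∣.∣? m
  ... | yes p∣m = p∣m
  ... | no p∤m with coprime-Bézout (prime∤⇒coprime p-prime p∤m)
  ...   | Bézout.+- x y eq = contradiction (no-Bézout (multiple≈0 m y m≈0) (multiple≈0 p x p≈0) eq) 1≉0
  ...   | Bézout.-+ x y eq = contradiction (no-Bézout (multiple≈0 p x p≈0) (multiple≈0 m y m≈0) eq) 1≉0

  -- The image of p^k is the k-th power of the image of p, and it is zero by `q×1≈0`; a field has no
  -- zero divisors.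
  q≡p^k⇒p×1≈0 : ∀ p k → q ≡ p ℕ.^ k → p × 1# ≈ 0#
  q≡p^k⇒p×1≈0 p k q≡p^k = root k (trans (reflexive (≡.cong (_× 1#) (≡.sym q≡p^k))) q×1≈0)
    where
    root : ∀ k → (p ℕ.^ k) × 1# ≈ 0# → p × 1# ≈ 0#
    root zero    1≈0 = contradiction (trans (sym (+-identityʳ 1#)) 1≈0) 1≉0
    root (suc k) e   with x*y≈0⇒x≈0∨y≈0 (trans (sym (×1-homo-* p (p ℕ.^ k))) e)
    ... | inj₁ p≈0 = p≈0
    ... | inj₂ e′  = root k e′

module PowerSums {c ℓ q} (F : FiniteField c ℓ q) where

  open FiniteField F hiding (zero)
  open FieldTheory F
  open ∑F
  open MonoidSum +-commutativeMonoid using (sum; sum-cong-≋; ∑-comm)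
  open SemiringSum semiring using (*-distribˡ-sum)
  open import Relation.Binary.Reasoning.Setoid ≈-setoid

  S : ℕ → Carrier
  S m = ∑ (_^ m)

  S[0]≈0 : S 0 ≈ 0#
  S[0]≈0 = trans (MonoidSum.sum-replicate +-commutativeMonoid q) q×1≈0

  -- Scaling by g permutes the field and multiplies the sum by g^m, which differs from 1 for a
  -- suitable g.
  S[m]≈0 : ∀ m → .{{NonZero m}} → suc m ℕ.< q → S m ≈ 0#
  S[m]≈0 m 1+m<q with ∃-x^m≉1 m 1+m<q
  ... | g , g≉0 , g^m≉1 with x*y≈0⇒x≈0∨y≈0 {g ^ m - 1#} {S m} (begin
    (g ^ m - 1#) * S m              ≈⟨ solve 3 (λ g o s → (g :- o) :* s := g :* s :- o :* s) refl (g ^ m) 1# (S m) ⟩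
    g ^ m * S m - 1# * S m          ≈⟨ +-congˡ (-‿cong (*-identityˡ (S m))) ⟩
    g ^ m * S m - S m               ≈⟨ +-congʳ (*-distribˡ-∑ (g ^ m) (_^ m)) ⟩
    ∑ (λ x → g ^ m * x ^ m) - S m   ≈⟨ +-congʳ (∑-cong (λ x → ^-distrib-* g x m)) ⟨
    ∑ (λ x → (g * x) ^ m) - S m     ≈⟨ +-congʳ (∑-bijection (^-congˡ m) (g *_) (g ⁻¹ *_) *-congˡ *-congˡ
                                        (x*y≈1⇒x*[y*z]≈z (x*x⁻¹≈1 g≉0)) (x*y≈1⇒x*[y*z]≈z (trans (*-comm _ _) (x*x⁻¹≈1 g≉0)))) ⟩
    S m - S m                       ≈⟨ -‿inverseʳ (S m) ⟩
    0#                              ∎)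
  ... | inj₁ g^m-1≈0 = contradiction (x-y≈0⇒x≈y _ _ g^m-1≈0) g^m≉1
  ... | inj₂ S≈0     = S≈0

  module _ {r : ℕ} (q≡1+r : q ≡ suc r) where

    0^[1+m]≈0 : ∀ {x} m → .{{NonZero m}} → x ≈ 0# → x ^ m ≈ 0#
    0^[1+m]≈0 (suc m) x≈0 = trans (*-congʳ x≈0) (zeroˡ _)

    -- The power x^(q - 1) is 1 except at 0, so adding the indicator of 0 turns the sum into q
    -- copies of 1.
    S[q-1]+1≈0 : .{{NonZero r}} → S r + 1# ≈ 0#
    S[q-1]+1≈0 = begin
      S r + 1#                       ≡⟨ ≡.cong (λ d → S r + d) (if-yes refl) ⟨
      S r + δ 0#                     ≈⟨ +-congˡ (∑-single (λ e → if-cong _≈_ e refl refl) 0# (λ x x≉0 → reflexive (if-no x≉0))) ⟨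
      S r + ∑ δ                      ≈⟨ ∑-+ (_^ r) δ ⟨
      ∑ (λ x → x ^ r + δ x)          ≈⟨ ∑-cong one ⟩
      ∑ (λ x → x ^ 0)                ≈⟨ S[0]≈0 ⟩
      0#                             ∎
      where
      δ : Carrier → Carrier
      δ x = if≈0 x 1# 0#
      one : ∀ x → x ^ r + δ x ≈ 1#
      one x with x ≈? 0#
      ... | yes x≈0 = trans (+-congʳ (0^[1+m]≈0 r x≈0)) (+-identityˡ 1#)
      ... | no x≉0  = trans (+-identityʳ _) (x^[q-1]≈1 q≡1+r x≉0)

    -- Multiplying by x^(q - 1) changes nothing for x ≠ 0; at 0 both powers vanish because m is
    -- positive.
    S[q-1+m] : ∀ m → .{{NonZero m}} → S (r ℕ.+ m) ≈ S m
    S[q-1+m] m = ∑-cong λ x → trans (^-homo-* x r m) (reduce x)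
      where
      reduce : ∀ x → x ^ r * x ^ m ≈ x ^ m
      reduce x with x ≈? 0#
      ... | yes x≈0 = trans (*-congˡ (0^[1+m]≈0 m x≈0)) (trans (zeroʳ _) (sym (0^[1+m]≈0 m x≈0)))
      ... | no x≉0  = trans (*-congʳ (x^[q-1]≈1 q≡1+r x≉0)) (*-identityˡ _)

  ∑-binomial : ∀ e d → ∑ (λ x → x ^ e * (x + 1#) ^ d) ≈ sum (λ (k : Fin (suc d)) → (d C toℕ k) × S (e ℕ.+ toℕ k))
  ∑-binomial e d = begin
    ∑ (λ x → x ^ e * (x + 1#) ^ d)                 ≈⟨ ∑-cong expand ⟩
    ∑ (λ x → sum (λ k → coeff k * x ^ (e ℕ.+ toℕ k)))   ≈⟨ ∑-comm {q} {suc d} (λ i k → coeff k * from i ^ (e ℕ.+ toℕ k)) ⟩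
    sum (λ k → ∑ (λ x → coeff k * x ^ (e ℕ.+ toℕ k)))   ≈⟨ sum-cong-≋ {suc d} (λ k → *-distribˡ-∑ (coeff k) (_^ (e ℕ.+ toℕ k))) ⟨
    sum (λ k → coeff k * S (e ℕ.+ toℕ k))               ≈⟨ sum-cong-≋ {suc d} (λ k → scale (d C toℕ k) (S (e ℕ.+ toℕ k))) ⟨
    sum {suc d} (λ k → (d C toℕ k) × S (e ℕ.+ toℕ k))  ∎
    where
    open import Algebra.Properties.CommutativeSemiring.Binomial commutativeSemiring using (theorem; binomialTerm)
    coeff : Fin (suc d) → Carrier
    coeff k = (d C toℕ k) × 1#
    scale : ∀ m x → m × x ≈ (m × 1#) * x
    scale m x = sym (trans (×-assoc-* m 1# x) (×-congʳ m (*-identityˡ x)))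
    expand : ∀ x → x ^ e * (x + 1#) ^ d ≈ sum (λ (k : Fin (suc d)) → coeff k * x ^ (e ℕ.+ toℕ k))
    expand x = trans (*-congˡ (theorem d x 1#)) (trans (*-distribˡ-sum {suc d} (x ^ e) (binomialTerm x 1# d)) (sum-cong-≋ {suc d} λ k → begin
      x ^ e * ((d C toℕ k) × (x ^ toℕ k * 1# ^ (d ℕ.∸ toℕ k)))  ≈⟨ *-congˡ (scale (d C toℕ k) _) ⟩
      x ^ e * (coeff k * (x ^ toℕ k * 1# ^ (d ℕ.∸ toℕ k)))          ≈⟨ *-congˡ (*-congˡ (trans (*-congˡ (1^n≈1 (d ℕ.∸ toℕ k))) (*-identityʳ _))) ⟩
      x ^ e * (coeff k * x ^ toℕ k)        ≈⟨ solve 3 (λ a b c → a :* (b :* c) := b :* (a :* c)) refl _ _ _ ⟩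
      coeff k * (x ^ e * x ^ toℕ k)        ≈⟨ *-congˡ (^-homo-* x e (toℕ k)) ⟨
      coeff k * x ^ (e ℕ.+ toℕ k)          ∎))

  module _ (s : ℕ) .{{_ : NonZero s}} (q≡1+3s : q ≡ suc (3 ℕ.* s)) where

    private
      ×0≈0 : ∀ n {x} → x ≈ 0# → n × x ≈ 0#
      ×0≈0 zero    x≈0 = refl
      ×0≈0 (suc n) x≈0 = trans (+-cong x≈0 (×0≈0 n x≈0)) (+-identityˡ 0#)

      S≈0 : ∀ m → 0 ℕ.< m → m ℕ.< 3 ℕ.* s → S m ≈ 0#
      S≈0 m 0<m m<3s = S[m]≈0 m {{ℕ.>-nonZero 0<m}} (≡.subst (suc m ℕ.<_) (≡.sym q≡1+3s) (ℕ.s<s m<3s))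

      0<s : 0 ℕ.< s
      0<s = ℕ.>-nonZero⁻¹ s

    -- The exponents in the expansion lie between s and 2s, hence strictly between 0 and q - 1 = 3s.
    ∑-x^s*[x+1]^s≈0 : ∑ (λ x → x ^ s * (x + 1#) ^ s) ≈ 0#
    ∑-x^s*[x+1]^s≈0 = trans (∑-binomial s s) (trans
      (sum-cong-≋ {suc s} (λ k → ×0≈0 (s C toℕ k) (S≈0 (s ℕ.+ toℕ k) (ℕₚ.<-≤-trans 0<s (ℕₚ.m≤m+n s _)) (bound k))))
      (MonoidSum.sum-replicate-zero +-commutativeMonoid (suc s)))
      where
      bound : (k : Fin (suc s)) → s ℕ.+ toℕ k ℕ.< 3 ℕ.* s
      bound k = ℕₚ.+-monoʳ-< s (ℕₚ.≤-<-trans (Finₚ.toℕ≤pred[n] k)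
        (ℕₚ.m<m+n s (≡.subst (0 ℕ.<_) (≡.sym (ℕₚ.+-identityʳ s)) 0<s)))

    -- The exponents in the expansion lie between 2s and 4s, and only 3s = q - 1 contributes.
    ∑-x^2s*[x+1]^2s : ∑ (λ x → x ^ (2 ℕ.* s) * (x + 1#) ^ (2 ℕ.* s)) + ((2 ℕ.* s) C s) × 1# ≈ 0#
    ∑-x^2s*[x+1]^2s = begin
      ∑ (λ x → x ^ 2s * (x + 1#) ^ 2s) + C₂ₛ   ≈⟨ +-congʳ (∑-binomial 2s 2s) ⟩
      sum term + C₂ₛ                            ≈⟨ +-congʳ (sum-single +-commutativeMonoid term middle others) ⟩
      term middle + C₂ₛ                         ≡⟨ ≡.cong (λ k → (2s C k) × S (2s ℕ.+ k) + C₂ₛ) toℕ-middle ⟩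
      (2s C s) × S (2s ℕ.+ s) + C₂ₛ             ≡⟨ ≡.cong (λ k → (2s C s) × S k + C₂ₛ) (2s+s≡3s) ⟩
      (2s C s) × S (3 ℕ.* s) + (2s C s) × 1#  ≈⟨ ×-distrib-+ (S (3 ℕ.* s)) 1# (2s C s) ⟨
      (2s C s) × (S (3 ℕ.* s) + 1#)           ≈⟨ ×0≈0 (2s C s) (S[q-1]+1≈0 q≡1+3s {{ℕₚ.m*n≢0 3 s}}) ⟩
      0#                                      ∎
      where
      open import Algebra.Properties.CommutativeMonoid.Mult +-commutativeMonoid using (×-distrib-+)
      2s = 2 ℕ.* s
      C₂ₛ = (2s C s) × 1#
      term : Fin (suc 2s) → Carrier
      term k = (2s C toℕ k) × S (2s ℕ.+ toℕ k)
      s<1+2s : s ℕ.< suc 2s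
      s<1+2s = ℕ.s≤s (ℕₚ.m≤m+n s _)
      middle : Fin (suc 2s)
      middle = Fin.fromℕ< s<1+2s
      toℕ-middle : toℕ middle ≡ s
      toℕ-middle = Finₚ.toℕ-fromℕ< s<1+2s
      2s+s≡3s : 2s ℕ.+ s ≡ 3 ℕ.* s
      2s+s≡3s = ℕₚ.+-comm 2s s
      S[2s+k]≈0 : ∀ k → k ℕ.≤ 2s → k ≢ s → S (2s ℕ.+ k) ≈ 0#
      S[2s+k]≈0 k k≤2s k≢s with ℕₚ.<-cmp k s
      ... | tri< k<s _ _ = S≈0 (2s ℕ.+ k) (ℕₚ.<-≤-trans 0<s (ℕₚ.≤-trans (ℕₚ.m≤m+n s _) (ℕₚ.m≤m+n 2s k)))
        (≡.subst (2s ℕ.+ k ℕ.<_) 2s+s≡3s (ℕₚ.+-monoʳ-< 2s k<s))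
      ... | tri≈ _ k≡s _ = contradiction k≡s k≢s
      -- With k = s + j the exponent is q - 1 + j for some 0 < j ≤ s, so it reduces to j.
      ... | tri> _ _ s<k = begin
        S (2s ℕ.+ k)                    ≡⟨ ≡.cong (λ k → S (2s ℕ.+ k)) s+j≡k ⟨
        S (2s ℕ.+ (s ℕ.+ j))            ≡⟨ ≡.cong S (≡.trans (≡.sym (ℕₚ.+-assoc 2s s j)) (≡.cong (ℕ._+ j) 2s+s≡3s)) ⟩
        S (3 ℕ.* s ℕ.+ j)               ≈⟨ S[q-1+m] q≡1+3s j {{ℕ.>-nonZero 0<j}} ⟩
        S j                             ≈⟨ S≈0 j 0<j (ℕₚ.≤-<-trans j≤s s<3s) ⟩
        0#                              ∎
        where
        j = k ℕ.∸ s
        s+j≡k : s ℕ.+ j ≡ k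
        s+j≡k = ℕₚ.m+[n∸m]≡n (ℕₚ.<⇒≤ s<k)
        0<j : 0 ℕ.< j
        0<j = ℕₚ.m<n⇒0<n∸m s<k
        j≤s : j ℕ.≤ s
        j≤s = ℕₚ.≤-trans (ℕₚ.∸-monoˡ-≤ s k≤2s) (ℕₚ.≤-reflexive (≡.trans (ℕₚ.m+n∸m≡n s _) (ℕₚ.+-identityʳ s)))
        s<3s : s ℕ.< 3 ℕ.* s
        s<3s = ℕₚ.m<m+n s (ℕₚ.<-≤-trans 0<s (ℕₚ.m≤m+n s _))
      others : ∀ k → k ≢ middle → term k ≈ 0#
      others k k≢middle = ×0≈0 (2s C toℕ k) (S[2s+k]≈0 (toℕ k) (Finₚ.toℕ≤pred[n] k)
        (λ e → k≢middle (Finₚ.toℕ-injective (≡.trans e (≡.sym toℕ-middle)))))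

-- The cubic residue character

-- The monoid μ₃ ∪ {0}, the common set of values of the cubic characters into F and into ℤ[ω].
data Class : Set where
  c0 c1 cω cω² : Class

infixl 7 _⊗_
infixr 8 _⊗^_

_⊗_ : Class → Class → Class
c0  ⊗ _   = c0
c1  ⊗ b   = b
cω  ⊗ c0  = c0
cω  ⊗ c1  = cω
cω  ⊗ cω  = cω²
cω  ⊗ cω² = c1
cω² ⊗ c0  = c0
cω² ⊗ c1  = cω²
cω² ⊗ cω  = c1
cω² ⊗ cω² = cω

_⊗^_ : Class → ℕ → Class
a ⊗^ zero  = c1
a ⊗^ suc n = a ⊗ a ⊗^ n

⟦_⟧ : Class → ℤ[ω]
⟦ c0 ⟧  = Eisenstein.0#
⟦ c1 ⟧  = Eisenstein.1#
⟦ cω ⟧  = Eisenstein.ω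
⟦ cω² ⟧ = Eisenstein.ω²

⟦⟧-⊗ : ∀ a b → ⟦ a ⊗ b ⟧ ≡ ⟦ a ⟧ Eisenstein.* ⟦ b ⟧
⟦⟧-⊗ c0  c0  = ≡.refl
⟦⟧-⊗ c0  c1  = ≡.refl
⟦⟧-⊗ c0  cω  = ≡.refl
⟦⟧-⊗ c0  cω² = ≡.refl
⟦⟧-⊗ c1  c0  = ≡.refl
⟦⟧-⊗ c1  c1  = ≡.refl
⟦⟧-⊗ c1  cω  = ≡.refl
⟦⟧-⊗ c1  cω² = ≡.refl
⟦⟧-⊗ cω  c0  = ≡.refl
⟦⟧-⊗ cω  c1  = ≡.refl
⟦⟧-⊗ cω  cω  = ≡.refl
⟦⟧-⊗ cω  cω² = ≡.refl
⟦⟧-⊗ cω² c0  = ≡.refl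
⟦⟧-⊗ cω² c1  = ≡.refl
⟦⟧-⊗ cω² cω  = ≡.refl
⟦⟧-⊗ cω² cω² = ≡.refl

-- The square of a cube root of unity is its inverse, hence its complex conjugate. Conjugates of
-- characters can therefore be written inside `Class`.
⟦a⊗a⟧≡conjugate : ∀ a → ⟦ a ⊗ a ⟧ ≡ Eisenstein.conjugate ⟦ a ⟧
⟦a⊗a⟧≡conjugate c0  = ≡.refl
⟦a⊗a⟧≡conjugate c1  = ≡.refl
⟦a⊗a⟧≡conjugate cω  = ≡.refl
⟦a⊗a⟧≡conjugate cω² = ≡.refl

-- Together with `⟦⟧-⊗` this embeds `Class` in ℤ[ω], so that commutativity and associativity of
-- `_⊗_` are inherited from the ring instead of being checked on all triples.
⟦⟧-injective : ∀ {a b} → ⟦ a ⟧ ≡ ⟦ b ⟧ → a ≡ b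
⟦⟧-injective {c0}  {c0}  _ = ≡.refl
⟦⟧-injective {c1}  {c1}  _ = ≡.refl
⟦⟧-injective {cω}  {cω}  _ = ≡.refl
⟦⟧-injective {cω²} {cω²} _ = ≡.refl

⊗-comm : ∀ a b → a ⊗ b ≡ b ⊗ a
⊗-comm a b = ⟦⟧-injective (≡.trans (⟦⟧-⊗ a b) (≡.trans (*-comm ⟦ a ⟧ ⟦ b ⟧) (≡.sym (⟦⟧-⊗ b a))))
  where open CommutativeRing Eisenstein.commutativeRing using (*-comm)

⊗-assoc : ∀ a b c → a ⊗ b ⊗ c ≡ a ⊗ (b ⊗ c)
⊗-assoc a b c = ⟦⟧-injective (begin
  ⟦ a ⊗ b ⊗ c ⟧              ≡⟨ ⟦⟧-⊗ (a ⊗ b) c ⟩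
  ⟦ a ⊗ b ⟧ * ⟦ c ⟧          ≡⟨ ≡.cong (_* ⟦ c ⟧) (⟦⟧-⊗ a b) ⟩
  ⟦ a ⟧ * ⟦ b ⟧ * ⟦ c ⟧      ≡⟨ *-assoc ⟦ a ⟧ ⟦ b ⟧ ⟦ c ⟧ ⟩
  ⟦ a ⟧ * (⟦ b ⟧ * ⟦ c ⟧)    ≡⟨ ≡.cong (⟦ a ⟧ *_) (⟦⟧-⊗ b c) ⟨
  ⟦ a ⟧ * ⟦ b ⊗ c ⟧          ≡⟨ ⟦⟧-⊗ a (b ⊗ c) ⟨
  ⟦ a ⊗ (b ⊗ c) ⟧            ∎)
  where
  open CommutativeRing Eisenstein.commutativeRing using (_*_; *-assoc)
  open ≡.≡-Reasoning

⊗-identityʳ : ∀ a → a ⊗ c1 ≡ a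
⊗-identityʳ a = ⊗-comm a c1

⊗-zeroʳ : ∀ a → a ⊗ c0 ≡ c0
⊗-zeroʳ a = ⊗-comm a c0

a⊗a⊗a≡1 : ∀ {a} → a ≢ c0 → a ⊗ a ⊗ a ≡ c1
a⊗a⊗a≡1 {c0}  a≢0 = contradiction ≡.refl a≢0
a⊗a⊗a≡1 {c1}  a≢0 = ≡.refl
a⊗a⊗a≡1 {cω}  a≢0 = ≡.refl
a⊗a⊗a≡1 {cω²} a≢0 = ≡.refl

⊗-≢0 : ∀ {a b} → a ≢ c0 → b ≢ c0 → a ⊗ b ≢ c0
⊗-≢0 {c0}        a≢0 b≢0 _ = a≢0 ≡.refl
⊗-≢0 {c1}        a≢0 b≢0 e = b≢0 e
⊗-≢0 {cω}  {c0}  a≢0 b≢0 _ = b≢0 ≡.refl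
⊗-≢0 {cω²} {c0}  a≢0 b≢0 _ = b≢0 ≡.refl

⊗^-homo-⊗ : ∀ a m n → a ⊗^ (m ℕ.+ n) ≡ a ⊗^ m ⊗ a ⊗^ n
⊗^-homo-⊗ a zero    n = ≡.refl
⊗^-homo-⊗ a (suc m) n = ≡.trans (≡.cong (a ⊗_) (⊗^-homo-⊗ a m n)) (≡.sym (⊗-assoc a (a ⊗^ m) (a ⊗^ n)))

⊗^-distrib-⊗ : ∀ a b n → (a ⊗ b) ⊗^ n ≡ a ⊗^ n ⊗ b ⊗^ n
⊗^-distrib-⊗ a b zero    = ≡.refl
⊗^-distrib-⊗ a b (suc n) = begin
  (a ⊗ b) ⊗ (a ⊗ b) ⊗^ n   ≡⟨ ≡.cong (a ⊗ b ⊗_) (⊗^-distrib-⊗ a b n) ⟩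
  (a ⊗ b) ⊗ (aⁿ ⊗ bⁿ)       ≡⟨ ⊗-assoc a b (aⁿ ⊗ bⁿ) ⟩
  a ⊗ (b ⊗ (aⁿ ⊗ bⁿ))       ≡⟨ ≡.cong (a ⊗_) (⊗-assoc b aⁿ bⁿ) ⟨
  a ⊗ (b ⊗ aⁿ ⊗ bⁿ)         ≡⟨ ≡.cong (λ c → a ⊗ (c ⊗ bⁿ)) (⊗-comm b aⁿ) ⟩
  a ⊗ (aⁿ ⊗ b ⊗ bⁿ)         ≡⟨ ≡.cong (a ⊗_) (⊗-assoc aⁿ b bⁿ) ⟩
  a ⊗ (aⁿ ⊗ (b ⊗ bⁿ))       ≡⟨ ⊗-assoc a aⁿ (b ⊗ bⁿ) ⟨
  a ⊗ aⁿ ⊗ (b ⊗ bⁿ)         ∎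
  where
  open ≡.≡-Reasoning
  aⁿ = a ⊗^ n
  bⁿ = b ⊗^ n

⊗^-≢0 : ∀ {a} n → a ≢ c0 → a ⊗^ n ≢ c0
⊗^-≢0 zero    a≢0 ()
⊗^-≢0 (suc n) a≢0 = ⊗-≢0 a≢0 (⊗^-≢0 n a≢0)

module CubicCharacter {c ℓ q} (F : FiniteField c ℓ q) (s : ℕ) .{{_ : NonZero s}} (q≡1+3s : q ≡ suc (3 ℕ.* s)) where

  open FiniteField F hiding (zero)
  open FieldTheory F
  open PowerSums F using (0^[1+m]≈0)
  open import Relation.Binary.Reasoning.Setoid ≈-setoid

  private
    nonresidue : ∃ λ g → ¬ g ≈ 0# ∧ ¬ g ^ s ≈ 1#
    nonresidue = ∃-x^m≉1 s (≡.subst (suc s ℕ.<_) (≡.sym q≡1+3s)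
      (ℕ.s≤s (ℕₚ.m<m+n s (ℕₚ.<-≤-trans (ℕ.>-nonZero⁻¹ s) (ℕₚ.m≤m+n s _)))))

    g = proj₁ nonresidue

  x^[3s]≈1 : ∀ {x} → ¬ x ≈ 0# → x ^ s * x ^ s * x ^ s ≈ 1#
  x^[3s]≈1 {x} x≉0 = begin
    x ^ s * x ^ s * x ^ s             ≈⟨ solve 1 (λ a → a :* a :* a := a :* (a :* (a :* con 1ℤ))) refl (x ^ s) ⟩
    x ^ s * (x ^ s * (x ^ s * 1#))    ≈⟨ *-congˡ (*-congˡ (^-homo-* x s 0)) ⟨
    x ^ s * (x ^ s * x ^ (s ℕ.+ 0))   ≈⟨ *-congˡ (^-homo-* x s (s ℕ.+ 0)) ⟨
    x ^ s * x ^ (s ℕ.+ (s ℕ.+ 0))     ≈⟨ ^-homo-* x s _ ⟨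
    x ^ (3 ℕ.* s)                     ≈⟨ x^[q-1]≈1 q≡1+3s x≉0 ⟩
    1#                                ∎

  w : Carrier
  w = g ^ s

  w≉0 : ¬ w ≈ 0#
  w≉0 = ^-≉0 s (proj₁ (proj₂ nonresidue))

  w≉1 : ¬ w ≈ 1#
  w≉1 = proj₂ (proj₂ nonresidue)

  w³≈1 : w * w * w ≈ 1#
  w³≈1 = x^[3s]≈1 (proj₁ (proj₂ nonresidue))

  1+w+w²≈0 : 1# + w + w * w ≈ 0#
  1+w+w²≈0 = resolve (x*y≈0⇒x≈0∨y≈0 (trans (geometric w) (x≈y⇒x-y≈0 w³≈1)))
    where
    geometric : ∀ w → (w - 1#) * (1# + w + w * w) ≈ w * w * w - 1#
    geometric = solve 1 (λ w → (w :- con 1ℤ) :* (con 1ℤ :+ w :+ w :* w) := w :* w :* w :- con 1ℤ) refl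
    resolve : w - 1# ≈ 0# ⊎ 1# + w + w * w ≈ 0# → 1# + w + w * w ≈ 0#
    resolve (inj₁ w-1≈0) = contradiction (x-y≈0⇒x≈y _ _ w-1≈0) w≉1
    resolve (inj₂ e)     = e

  -- The solver treats w as an indeterminate. An identity that depends on 1 + w + w² = 0 is
  -- therefore proved as a polynomial identity with an explicit multiple of 1 + w + w², which is
  -- dropped here.
  modulo-1+w+w² : ∀ {x y} z → x ≈ y + (1# + w + w * w) * z → x ≈ y
  modulo-1+w+w² z e = trans e (trans (+-congˡ (trans (*-congʳ 1+w+w²≈0) (zeroˡ z))) (+-identityʳ _))

  φ : Class → Carrier
  φ c0  = 0#
  φ c1  = 1#
  φ cω  = w
  φ cω² = w * w

  φ-⊗ : ∀ a b → φ (a ⊗ b) ≈ φ a * φ b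
  φ-⊗ c0  b   = sym (zeroˡ _)
  φ-⊗ c1  b   = sym (*-identityˡ _)
  φ-⊗ cω  c0  = sym (zeroʳ _)
  φ-⊗ cω  c1  = sym (*-identityʳ _)
  φ-⊗ cω  cω  = refl
  φ-⊗ cω  cω² = sym (trans (sym (*-assoc w w w)) w³≈1)
  φ-⊗ cω² c0  = sym (zeroʳ _)
  φ-⊗ cω² c1  = sym (*-identityʳ _)
  φ-⊗ cω² cω  = sym w³≈1
  φ-⊗ cω² cω² = sym (trans (sym (*-assoc (w * w) w w)) (trans (*-congʳ w³≈1) (*-identityˡ w)))

  φ-^ : ∀ a n → φ (a ⊗^ n) ≈ φ a ^ n
  φ-^ a zero    = refl
  φ-^ a (suc n) = trans (φ-⊗ a (a ⊗^ n)) (*-congˡ (φ-^ a n))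

  φ≈0 : ∀ {a} → φ a ≈ 0# → a ≡ c0
  φ≈0 {c0}  _ = ≡.refl
  φ≈0 {c1}  e = contradiction e 1≉0
  φ≈0 {cω}  e = contradiction e w≉0
  φ≈0 {cω²} e = contradiction e (*-≉0 w≉0 w≉0)

  private
    w²≉1 : ¬ w * w ≈ 1#
    w²≉1 w²≈1 = w≉1 (trans (sym (*-identityˡ w)) (trans (*-congʳ (sym w²≈1)) w³≈1))

    w≉w² : ¬ w ≈ w * w
    w≉w² w≈w² = w≉1 (*-cancelˡ w≉0 (trans (sym w≈w²) (sym (*-identityʳ w))))

  φ-injective : ∀ {a b} → φ a ≈ φ b → a ≡ b
  φ-injective {c0}  {b}   e = ≡.sym (φ≈0 (sym e))
  φ-injective {c1}  {c0}  e = φ≈0 e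
  φ-injective {cω}  {c0}  e = φ≈0 e
  φ-injective {cω²} {c0}  e = φ≈0 e
  φ-injective {c1}  {c1}  e = ≡.refl
  φ-injective {cω}  {cω}  e = ≡.refl
  φ-injective {cω²} {cω²} e = ≡.refl
  φ-injective {c1}  {cω}  e = contradiction (sym e) w≉1
  φ-injective {cω}  {c1}  e = contradiction e w≉1
  φ-injective {c1}  {cω²} e = contradiction (sym e) w²≉1
  φ-injective {cω²} {c1}  e = contradiction e w²≉1
  φ-injective {cω}  {cω²} e = contradiction e w≉w²
  φ-injective {cω²} {cω}  e = contradiction (sym e) w≉w²

  private
    cubic : ∀ y w → (y - 1#) * ((y - w) * (y - w * w)) ≈
      (y * y * y - 1#) + (1# + w + w * w) * (- (y * y) + w * y - (w - 1#))
    cubic = solve 2 (λ y w → (y :- con 1ℤ) :* ((y :- w) :* (y :- w :* w)) :=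
      (y :* y :* y :- con 1ℤ) :+ (con 1ℤ :+ w :+ w :* w) :* (:- (y :* y) :+ w :* y :- (w :- con 1ℤ))) refl

    cube-root-of-unity : ∀ y → y * y * y ≈ 1# → ∃ λ a → φ a ≈ y
    cube-root-of-unity y y³≈1 =
      resolve (x*y≈0⇒x≈0∨y≈0 (trans (modulo-1+w+w² _ (cubic y w)) (x≈y⇒x-y≈0 y³≈1)))
      where
      resolve₂ : y - w ≈ 0# ⊎ y - w * w ≈ 0# → ∃ λ a → φ a ≈ y
      resolve₂ (inj₁ e) = cω , sym (x-y≈0⇒x≈y _ _ e)
      resolve₂ (inj₂ e) = cω² , sym (x-y≈0⇒x≈y _ _ e)
      resolve : y - 1# ≈ 0# ⊎ (y - w) * (y - w * w) ≈ 0# → ∃ λ a → φ a ≈ y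
      resolve (inj₁ e) = c1 , sym (x-y≈0⇒x≈y _ _ e)
      resolve (inj₂ e) = resolve₂ (x*y≈0⇒x≈0∨y≈0 e)

    character : ∀ x → Dec (x ≈ 0#) → ∃ λ a → φ a ≈ x ^ s
    character x (yes x≈0) = c0 , sym (0^[1+m]≈0 q≡1+3s s x≈0)
    character x (no x≉0)  = cube-root-of-unity (x ^ s) (x^[3s]≈1 x≉0)

  abstract
    -- Only `φ-χ` is used about this function; as `φ` is injective, it determines the value, and the
    -- multiplicative properties follow from those of x^s.
    χ : Carrier → Class
    χ x = proj₁ (character x (x ≈? 0#))

    φ-χ : ∀ x → φ (χ x) ≈ x ^ s
    φ-χ x = proj₂ (character x (x ≈? 0#))

  χ-unique : ∀ {x a} → φ a ≈ x ^ s → χ x ≡ a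
  χ-unique {x} e = φ-injective (trans (φ-χ x) (sym e))

  χ-cong : ∀ {x y} → x ≈ y → χ x ≡ χ y
  χ-cong {x} {y} x≈y = χ-unique (trans (φ-χ y) (^-congˡ s (sym x≈y)))

  χ-* : ∀ x y → χ (x * y) ≡ χ x ⊗ χ y
  χ-* x y = χ-unique (trans (φ-⊗ (χ x) (χ y)) (trans (*-cong (φ-χ x) (φ-χ y)) (sym (^-distrib-* x y s))))

  χ-^ : ∀ x n → χ (x ^ n) ≡ χ x ⊗^ n
  χ-^ x zero    = χ-unique (sym (1^n≈1 s))
  χ-^ x (suc n) = ≡.trans (χ-* x (x ^ n)) (≡.cong (χ x ⊗_) (χ-^ x n))

  χ[1] : χ 1# ≡ c1
  χ[1] = χ-unique (sym (1^n≈1 s))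

  χ[0] : ∀ {x} → x ≈ 0# → χ x ≡ c0
  χ[0] x≈0 = χ-unique (sym (0^[1+m]≈0 q≡1+3s s x≈0))

  χ-≢0 : ∀ {x} → ¬ x ≈ 0# → χ x ≢ c0
  χ-≢0 {x} x≉0 χx≡0 = ^-≉0 s x≉0 (trans (sym (φ-χ x)) (reflexive (≡.cong φ χx≡0)))

  -- As w is `φ cω`, its s-th power is the image of `cω ⊗^ s`. This is how s modulo 3, and so q
  -- modulo 9, enters ε₁.
  χ[w] : χ w ≡ cω ⊗^ s
  χ[w] = χ-unique (φ-^ cω s)

  χ-surjective : ∀ a → ∃ λ x → χ x ≡ a
  χ-surjective c0  = 0# , χ[0] refl
  χ-surjective c1  = 1# , χ[1]
  χ-surjective cω  = g , χ-unique {g} {cω} refl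
  χ-surjective cω² = g * g , ≡.trans (χ-* g g) (≡.cong (λ a → a ⊗ a) (χ-unique {g} {cω} refl))

  χ-cube : ∀ {x} → ¬ x ≈ 0# → χ (x * x * x) ≡ c1
  χ-cube {x} x≉0 = ≡.trans (χ-* (x * x) x) (≡.trans (≡.cong (_⊗ χ x) (χ-* x x)) (a⊗a⊗a≡1 (χ-≢0 x≉0)))

  χ-*-cube : ∀ {x y z} → ¬ y ≈ 0# → z ≈ x * (y * y * y) → χ z ≡ χ x
  χ-*-cube {x} {y} y≉0 z≈xy³ = ≡.trans (χ-cong z≈xy³) (≡.trans (χ-* x (y * y * y))
    (≡.trans (≡.cong (χ x ⊗_) (χ-cube y≉0)) (⊗-identityʳ (χ x))))

-- The Jacobi sum

⊗-c1-commutativeMonoid : CommutativeMonoid 0ℓ 0ℓ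
⊗-c1-commutativeMonoid = record
  { isCommutativeMonoid = record
    { isMonoid = record
      { isSemigroup = record
        { isMagma = record { isEquivalence = ≡.isEquivalence ; ∙-cong = ≡.cong₂ _⊗_ }
        ; assoc = ⊗-assoc }
      ; identity = (λ _ → ≡.refl) , ⊗-identityʳ }
    ; comm = ⊗-comm } }

module JacobiSum {c ℓ q} (F : FiniteField c ℓ q) (s : ℕ) .{{_ : NonZero s}} (q≡1+3s : q ≡ suc (3 ℕ.* s)) where

  open FiniteField F hiding (zero)
  open FieldTheory F
  open CubicCharacter F s q≡1+3s
  open FieldRingSums F Eisenstein.commutativeRing public
  private
    module E = CommutativeRing Eisenstein.commutativeRing
    module ⊗-Solver = CommutativeMonoidSolver ⊗-c1-commutativeMonoid
  open Eisenstein using (conjugate; fromℤ)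
  open ≡.≡-Reasoning

  X : Carrier → ℤ[ω]
  X x = ⟦ χ x ⟧

  X-cong : Congruent X
  X-cong x≈y = ≡.cong ⟦_⟧ (χ-cong x≈y)

  ∑-shift : ∀ {f} → Congruent f → ∀ b → ∑ (λ x → f (x + b)) ≡ ∑ f
  ∑-shift f-cong b = ∑-bijection f-cong (_+ b) (_- b) +-congʳ +-congʳ
    (solve 2 (λ b x → x :- b :+ b := x) refl b) (solve 2 (λ b x → x :+ b :- b := x) refl b)

  ∑-scale : ∀ {f} → Congruent f → ∀ {a} → ¬ a ≈ 0# → ∑ (λ x → f (x * a)) ≡ ∑ f
  ∑-scale f-cong {a} a≉0 = ∑-bijection f-cong (_* a) (_* a ⁻¹) *-congʳ *-congʳ
    (cancel (trans (*-comm _ _) (x*x⁻¹≈1 a≉0))) (cancel (x*x⁻¹≈1 a≉0))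
    where
    cancel : ∀ {y z} → y * z ≈ 1# → ∀ x → x * y * z ≈ x
    cancel yz≈1 x = trans (*-assoc x _ _) (trans (*-congˡ yz≈1) (*-identityʳ x))

  private
    δ-cong : ∀ {v} → Congruent (λ x → if≈0 x v E.0#)
    δ-cong e = if-cong _≡_ e ≡.refl ≡.refl

  -- A correction at one point is written as a sum over the whole field, so that it can be merged
  -- termwise with another sum.
  ∑-δ : ∀ v → ∑ (λ x → if≈0 x v E.0#) ≡ v
  ∑-δ v = ≡.trans (∑-single δ-cong 0# (λ x x≉0 → if-no x≉0)) (if-yes refl)

  ∑-δ-shift : ∀ b v → ∑ (λ x → if≈0 (x + b) v E.0#) ≡ v
  ∑-δ-shift b v = ≡.trans (∑-shift δ-cong b) (∑-δ v)

  ∑-conjugate : ∀ f → conjugate (∑ f) ≡ ∑ (conjugate ∘ f)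
  ∑-conjugate f = sum-conjugate (f ∘ from)
    where
    open MonoidSum E.+-commutativeMonoid using (sum)
    sum-conjugate : ∀ {n} (t : Fin n → ℤ[ω]) → conjugate (sum t) ≡ sum (conjugate ∘ t)
    sum-conjugate {zero}  t = ≡.refl
    sum-conjugate {suc n} t = ≡.trans (Eisenstein.conjugate-+ (t zero) _)
      (≡.cong (conjugate (t zero) E.+_) (sum-conjugate (t ∘ suc)))

  ∑-1 : ∑ (λ _ → E.1#) ≡ fromℤ (+ q)
  ∑-1 = sum-1 q
    where
    open MonoidSum E.+-commutativeMonoid using (sum)
    sum-1 : ∀ n → sum {n} (λ _ → E.1#) ≡ fromℤ (+ n)
    sum-1 zero    = ≡.refl
    sum-1 (suc n) = ≡.cong (E.1# E.+_) (sum-1 n)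

  private
    -- 1 - ω is not a zero divisor; in coordinates the equation gives a = -b and b = a - b, hence 3b
    -- = 0.
    x≡ωx⇒x≡0 : ∀ x → x ≡ Eisenstein.ω E.* x → x ≡ E.0#
    x≡ωx⇒x≡0 (a +ω b) e = ≡.cong₂ _+ω_ a≡0 b≡0
      where
      ω*-re : ∀ a b → 0ℤ ℤ.* a ℤ.- 1ℤ ℤ.* b ≡ ℤ.- b
      ω*-re = ℤ-solve
      ω*-im : ∀ a b → 0ℤ ℤ.* b ℤ.+ 1ℤ ℤ.* a ℤ.- 1ℤ ℤ.* b ≡ a ℤ.- b
      ω*-im = ℤ-solve
      a≡-b : a ≡ ℤ.- b
      a≡-b = ≡.trans (≡.cong ℤ[ω].constant e) (ω*-re a b)
      b≡a-b : b ≡ a ℤ.- b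
      b≡a-b = ≡.trans (≡.cong ℤ[ω].ω-coefficient e) (ω*-im a b)
      triple : ∀ b → + 3 ℤ.* b ≡ b ℤ.- (ℤ.- b ℤ.- b)
      triple = ℤ-solve
      3b≡0 : + 3 ℤ.* b ≡ 0ℤ
      3b≡0 = ≡.trans (triple b) (ℤₚ.i≡j⇒i-j≡0 (≡.trans b≡a-b (≡.cong (ℤ._- b) a≡-b)))
      b≡0 : b ≡ 0ℤ
      b≡0 with ℤₚ.i*j≡0⇒i≡0∨j≡0 (+ 3) 3b≡0
      ... | inj₂ b≡0 = b≡0
      a≡0 : a ≡ 0ℤ
      a≡0 = ≡.trans a≡-b (≡.cong ℤ.-_ b≡0)

  -- Scaling the variable by an element of class `cω` multiplies the sum by ω without changing it.
  ∑-X : ∑ X ≡ E.0#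
  ∑-X = x≡ωx⇒x≡0 (∑ X) (begin
    ∑ X                             ≡⟨ ∑-scale X-cong g≉0 ⟨
    ∑ (λ x → X (x * g))             ≡⟨ ∑-cong (λ x → ≡.trans (≡.cong ⟦_⟧ (χ-*g x)) (⟦⟧-⊗ cω (χ x))) ⟩
    ∑ (λ x → Eisenstein.ω E.* X x)  ≡⟨ *-distribˡ-∑ Eisenstein.ω X ⟨
    Eisenstein.ω E.* ∑ X            ∎)
    where
    g = proj₁ (χ-surjective cω)
    χ[g] : χ g ≡ cω
    χ[g] = proj₂ (χ-surjective cω)
    g≉0 : ¬ g ≈ 0#
    g≉0 g≈0 = contradiction (≡.trans (≡.sym χ[g]) (χ[0] g≈0)) λ ()
    χ-*g : ∀ x → χ (x * g) ≡ cω ⊗ χ x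
    χ-*g x = ≡.trans (χ-* x g) (≡.trans (⊗-comm (χ x) (χ g)) (≡.cong (_⊗ χ x) χ[g]))

  ∑-X-affine : ∀ {a} → ¬ a ≈ 0# → ∀ b → ∑ (λ t → X (a * t + b)) ≡ E.0#
  ∑-X-affine {a} a≉0 b = begin
    ∑ (λ t → X (a * t + b))   ≡⟨ ∑-cong (λ t → X-cong (+-congʳ (*-comm a t))) ⟩
    ∑ (λ t → X (t * a + b))   ≡⟨ ∑-scale (λ e → X-cong (+-congʳ e)) a≉0 ⟩
    ∑ (λ t → X (t + b))       ≡⟨ ∑-shift X-cong b ⟩
    ∑ X                       ≡⟨ ∑-X ⟩
    E.0#                      ∎

  X̄ : Carrier → ℤ[ω]
  X̄ x = ⟦ χ x ⊗ χ x ⟧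

  ∑-X̄ : ∑ X̄ ≡ E.0#
  ∑-X̄ = ≡.trans (∑-cong (λ x → ⟦a⊗a⟧≡conjugate (χ x))) (≡.trans (≡.sym (∑-conjugate X)) (≡.cong conjugate ∑-X))

  -- For z = 1/t the summand on the left is the character of (e/t + d) t = d t + e.
  ∑-X-ratio : ∀ e d → ∑ (λ z → ⟦ χ (e * z + d) ⊗ (χ z ⊗ χ z) ⟧) E.+ X e ≡ ∑ (λ t → X (d * t + e))
  ∑-X-ratio e d = begin
    ∑ f E.+ X e                                      ≡⟨ ≡.cong₂ E._+_ (∑-bijection f-cong _⁻¹ _⁻¹ ⁻¹-cong ⁻¹-cong ⁻¹-involutive ⁻¹-involutive) (∑-δ (X e)) ⟨
    ∑ (λ t → f (t ⁻¹)) E.+ ∑ (λ t → if≈0 t (X e) E.0#)   ≡⟨ ∑-+ (λ t → f (t ⁻¹)) (λ t → if≈0 t (X e) E.0#) ⟨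
    ∑ (λ t → f (t ⁻¹) E.+ if≈0 t (X e) E.0#)             ≡⟨ ∑-cong (λ t → pointwise t (t ≈? 0#)) ⟩
    ∑ (λ t → X (d * t + e))                          ∎
    where
    f : Carrier → ℤ[ω]
    f z = ⟦ χ (e * z + d) ⊗ (χ z ⊗ χ z) ⟧
    f-cong : Congruent f
    f-cong x≈y = ≡.cong ⟦_⟧ (≡.cong₂ (λ a b → a ⊗ (b ⊗ b)) (χ-cong (+-congʳ (*-congˡ x≈y))) (χ-cong x≈y))
    pointwise : ∀ t → Dec (t ≈ 0#) → f (t ⁻¹) E.+ if≈0 t (X e) E.0# ≡ X (d * t + e)
    pointwise t (yes t≈0) = begin
      f (t ⁻¹) E.+ if≈0 t (X e) E.0#   ≡⟨ ≡.cong₂ E._+_ f≡0 (if-yes t≈0) ⟩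
      E.0# E.+ X e                     ≡⟨ E.+-identityˡ (X e) ⟩
      X e                              ≡⟨ X-cong (trans (+-congʳ (trans (*-congˡ t≈0) (zeroʳ d))) (+-identityˡ e)) ⟨
      X (d * t + e)                    ∎
      where
      f≡0 : f (t ⁻¹) ≡ E.0#
      f≡0 = ≡.cong ⟦_⟧ (≡.trans (≡.cong (λ b → χ (e * t ⁻¹ + d) ⊗ (b ⊗ b)) (χ[0] (x≈0⇒x⁻¹≈0 t≈0))) (⊗-zeroʳ (χ (e * t ⁻¹ + d))))
    pointwise t (no t≉0) = begin
      f (t ⁻¹) E.+ if≈0 t (X e) E.0#   ≡⟨ ≡.cong (f (t ⁻¹) E.+_) (if-no t≉0) ⟩
      f (t ⁻¹) E.+ E.0#                ≡⟨ E.+-identityʳ (f (t ⁻¹)) ⟩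
      f (t ⁻¹)                         ≡⟨ ≡.cong (λ b → ⟦ χ (e * t ⁻¹ + d) ⊗ b ⟧) χ[t⁻¹]² ⟩
      ⟦ χ (e * t ⁻¹ + d) ⊗ χ t ⟧       ≡⟨ ≡.cong ⟦_⟧ (χ-* (e * t ⁻¹ + d) t) ⟨
      X ((e * t ⁻¹ + d) * t)           ≡⟨ X-cong (trans (expand e (t ⁻¹) d t) (+-congˡ (trans (*-congˡ (x*x⁻¹≈1 t≉0)) (*-identityʳ e)))) ⟩
      X (d * t + e)                    ∎
      where
      expand : ∀ e u d t → (e * u + d) * t ≈ d * t + e * (t * u)
      expand = solve 4 (λ e u d t → (e :* u :+ d) :* t := d :* t :+ e :* (t :* u)) refl
      open ⊗-Solver using (_⊕_; _⊜_)
      χ[t⁻¹]² : χ (t ⁻¹) ⊗ χ (t ⁻¹) ≡ χ t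
      χ[t⁻¹]² = begin
        b ⊗ b                ≡⟨ ⊗-identityʳ (b ⊗ b) ⟨
        b ⊗ b ⊗ c1           ≡⟨ ≡.cong (b ⊗ b ⊗_) (≡.trans (≡.sym (χ-* t (t ⁻¹))) (≡.trans (χ-cong (x*x⁻¹≈1 t≉0)) χ[1])) ⟨
        b ⊗ b ⊗ (χ t ⊗ b)    ≡⟨ ⊗-Solver.solve 2 (λ a b → (b ⊕ b) ⊕ (a ⊕ b) ⊜ ((b ⊕ b) ⊕ b) ⊕ a) ≡.refl (χ t) b ⟩
        b ⊗ b ⊗ b ⊗ χ t      ≡⟨ ≡.cong (_⊗ χ t) (a⊗a⊗a≡1 (χ-≢0 (x⁻¹≉0 t≉0))) ⟩
        χ t                  ∎
        where b = χ (t ⁻¹)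

-- The norm of the Jacobi sum and its residue modulo 3

module JacobiSumNorm {c ℓ q} (F : FiniteField c ℓ q) (s : ℕ) .{{_ : NonZero s}} (q≡1+3s : q ≡ suc (3 ℕ.* s)) where

  open FiniteField F hiding (zero)
  open FieldTheory F
  open CubicCharacter F s q≡1+3s
  open JacobiSum F s q≡1+3s
  private
    module E = CommutativeRing Eisenstein.commutativeRing
    module Eℤ = IntegersIn Eisenstein.commutativeRing
    module ⊗-Solver = CommutativeMonoidSolver ⊗-c1-commutativeMonoid
  open Eisenstein using (conjugate; fromℤ; norm)
  open ≡.≡-Reasoning
  open ⊗-Solver using (_⊕_; _⊜_)

  h : Carrier → Class
  h u = χ u ⊗ χ (u + 1#)

  J : ℤ[ω]
  J = ∑ (λ u → ⟦ h u ⟧)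

  h-cong : ∀ {u v} → u ≈ v → h u ≡ h v
  h-cong u≈v = ≡.cong₂ _⊗_ (χ-cong u≈v) (χ-cong (+-congʳ u≈v))

  h[0] : ∀ {u} → u ≈ 0# → h u ≡ c0
  h[0] {u} u≈0 = ≡.cong (_⊗ χ (u + 1#)) (χ[0] u≈0)

  private
    -- The sum over y that remains in `J * conjugate J` once the variable of the first factor is
    -- replaced by u y, the order of summation exchanged and χ(u) taken out.
    K : Carrier → ℤ[ω]
    K u = ∑ (λ y → ⟦ χ (u * y + 1#) ⊗ (χ (y + 1#) ⊗ χ (y + 1#)) ⟧)

    -- In the variable z = y + 1 the first factor is u z + (1 - u), and `∑-X-ratio` applies.
    K+X : ∀ u → K u E.+ X u ≡ ∑ (λ t → X ((1# - u) * t + u))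
    K+X u = begin
      K u E.+ X u        ≡⟨ ≡.cong (E._+ X u) (∑-cong (λ y → ≡.cong (λ a → ⟦ a ⊗ (χ (y + 1#) ⊗ χ (y + 1#)) ⟧) (χ-cong (shift u y)))) ⟩
      ∑ (λ y → f (y + 1#)) E.+ X u   ≡⟨ ≡.cong (E._+ X u) (∑-shift f-cong 1#) ⟩
      ∑ f E.+ X u        ≡⟨ ∑-X-ratio u (1# - u) ⟩
      ∑ (λ t → X ((1# - u) * t + u)) ∎
      where
      f : Carrier → ℤ[ω]
      f z = ⟦ χ (u * z + (1# - u)) ⊗ (χ z ⊗ χ z) ⟧
      f-cong : Congruent f
      f-cong x≈y = ≡.cong ⟦_⟧ (≡.cong₂ (λ a b → a ⊗ (b ⊗ b)) (χ-cong (+-congʳ (*-congˡ x≈y))) (χ-cong x≈y))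
      shift : ∀ u y → u * y + 1# ≈ u * (y + 1#) + (1# - u)
      shift = solve 2 (λ u y → u :* y :+ con 1ℤ := u :* (y :+ con 1ℤ) :+ (con 1ℤ :- u)) refl

    -- The affine sum has slope 1 - u. It vanishes unless u = 1, when all its q terms are χ(1) = 1.
    X*[K+X] : ∀ u → X u E.* (K u E.+ X u) ≡ if≈0 (u - 1#) (fromℤ (+ q)) E.0#
    X*[K+X] u = ≡.trans (≡.cong (X u E.*_) (K+X u)) (cases ((u - 1#) ≈? 0#))
      where
      cases : Dec (u - 1# ≈ 0#) → X u E.* ∑ (λ t → X ((1# - u) * t + u)) ≡ if≈0 (u - 1#) (fromℤ (+ q)) E.0#
      cases (no u-1≉0) = begin
        X u E.* ∑ (λ t → X ((1# - u) * t + u))   ≡⟨ ≡.cong (X u E.*_) (∑-X-affine 1-u≉0 u) ⟩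
        X u E.* E.0#                             ≡⟨ E.zeroʳ (X u) ⟩
        E.0#                                     ≡⟨ if-no u-1≉0 ⟨
        if≈0 (u - 1#) (fromℤ (+ q)) E.0#      ∎
        where
        1-u≉0 : ¬ 1# - u ≈ 0#
        1-u≉0 e = u-1≉0 (x≈y⇒x-y≈0 (sym (x-y≈0⇒x≈y 1# u e)))
      cases (yes u-1≈0) = begin
        X u E.* ∑ (λ t → X ((1# - u) * t + u))   ≡⟨ ≡.cong₂ E._*_ X[u]≡1 (∑-cong (λ t → ≡.trans (X-cong (constant t)) X[u]≡1)) ⟩
        E.1# E.* ∑ (λ _ → E.1#)                  ≡⟨ E.*-identityˡ (∑ (λ _ → E.1#)) ⟩
        ∑ (λ _ → E.1#)                           ≡⟨ ∑-1 ⟩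
        fromℤ (+ q)                           ≡⟨ if-yes u-1≈0 ⟨
        if≈0 (u - 1#) (fromℤ (+ q)) E.0#      ∎
        where
        u≈1 : u ≈ 1#
        u≈1 = x-y≈0⇒x≈y u 1# u-1≈0
        X[u]≡1 : X u ≡ E.1#
        X[u]≡1 = ≡.trans (X-cong u≈1) (≡.cong ⟦_⟧ χ[1])
        constant : ∀ t → (1# - u) * t + u ≈ u
        constant t = trans (+-congʳ (trans (*-congʳ (x≈y⇒x-y≈0 (sym u≈1))) (zeroˡ t))) (+-identityˡ u)

    -- Adding the vanishing sum of χ(u)² completes `K u` to `K u + X u`, which leaves only the term
    -- u = 1.
    ∑-X*K : ∑ (λ u → X u E.* K u) ≡ fromℤ (+ q)
    ∑-X*K = begin
      ∑ (λ u → X u E.* K u)                                   ≡⟨ E.+-identityʳ _ ⟨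
      ∑ (λ u → X u E.* K u) E.+ E.0#                          ≡⟨ ≡.cong (∑ (λ u → X u E.* K u) E.+_) ∑-X̄ ⟨
      ∑ (λ u → X u E.* K u) E.+ ∑ X̄                           ≡⟨ ∑-+ (λ u → X u E.* K u) X̄ ⟨
      ∑ (λ u → X u E.* K u E.+ X̄ u)                           ≡⟨ ∑-cong (λ u → ≡.cong (X u E.* K u E.+_) (⟦⟧-⊗ (χ u) (χ u))) ⟩
      ∑ (λ u → X u E.* K u E.+ X u E.* X u)                   ≡⟨ ∑-cong (λ u → E.distribˡ (X u) (K u) (X u)) ⟨
      ∑ (λ u → X u E.* (K u E.+ X u))                         ≡⟨ ∑-cong X*[K+X] ⟩
      ∑ (λ u → if≈0 (u - 1#) (fromℤ (+ q)) E.0#)           ≡⟨ ∑-δ-shift (- 1#) (fromℤ (+ q)) ⟩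
      fromℤ (+ q)                                          ∎

    k : Carrier → Carrier → Class
    k u y = χ u ⊗ (χ (u * y + 1#) ⊗ (χ (y + 1#) ⊗ χ (y + 1#)))

    -- The second term on the left corrects for y = 0, where u ↦ u y is not a bijection.
    pointwise : ∀ y u → ⟦ h y ⊗ h y ⊗ h (u * y) ⟧ E.+ if≈0 y (X u) E.0# ≡ ⟦ k u y ⟧
    pointwise y u = cases (y ≈? 0#)
      where
      cases : Dec (y ≈ 0#) → ⟦ h y ⊗ h y ⊗ h (u * y) ⟧ E.+ if≈0 y (X u) E.0# ≡ ⟦ k u y ⟧
      cases (yes y≈0) = begin
        ⟦ h y ⊗ h y ⊗ h (u * y) ⟧ E.+ if≈0 y (X u) E.0#  ≡⟨ ≡.cong₂ E._+_ (≡.cong (λ a → ⟦ a ⊗ a ⊗ h (u * y) ⟧) (h[0] y≈0)) (if-yes y≈0) ⟩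
        E.0# E.+ X u      ≡⟨ E.+-identityˡ (X u) ⟩
        X u               ≡⟨ ≡.cong ⟦_⟧ (⊗-identityʳ (χ u)) ⟨
        ⟦ χ u ⊗ c1 ⟧      ≡⟨ ≡.cong₂ (λ a b → ⟦ χ u ⊗ (a ⊗ (b ⊗ b)) ⟧) (one (trans (*-congˡ y≈0) (zeroʳ u))) (one y≈0) ⟨
        ⟦ k u y ⟧         ∎
        where
        one : ∀ {x} → x ≈ 0# → χ (x + 1#) ≡ c1
        one x≈0 = ≡.trans (χ-cong (trans (+-congʳ x≈0) (+-identityˡ 1#))) χ[1]
      cases (no y≉0) = begin
        ⟦ h y ⊗ h y ⊗ h (u * y) ⟧ E.+ if≈0 y (X u) E.0#  ≡⟨ ≡.cong (⟦ h y ⊗ h y ⊗ h (u * y) ⟧ E.+_) (if-no y≉0) ⟩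
        ⟦ h y ⊗ h y ⊗ h (u * y) ⟧ E.+ E.0#               ≡⟨ E.+-identityʳ ⟦ h y ⊗ h y ⊗ h (u * y) ⟧ ⟩
        ⟦ h y ⊗ h y ⊗ h (u * y) ⟧                        ≡⟨ ≡.cong (λ e → ⟦ h y ⊗ h y ⊗ (e ⊗ d) ⟧) (χ-* u y) ⟩
        ⟦ (b ⊗ b₁) ⊗ (b ⊗ b₁) ⊗ (a ⊗ b ⊗ d) ⟧              ≡⟨ ≡.cong ⟦_⟧ (⊗-Solver.solve 4 (λ a b c d →
             ((b ⊕ c) ⊕ (b ⊕ c)) ⊕ ((a ⊕ b) ⊕ d) ⊜ ((b ⊕ b) ⊕ b) ⊕ (a ⊕ (d ⊕ (c ⊕ c)))) ≡.refl a b b₁ d) ⟩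
        ⟦ b ⊗ b ⊗ b ⊗ k u y ⟧                            ≡⟨ ≡.cong (λ e → ⟦ e ⊗ k u y ⟧) (a⊗a⊗a≡1 (χ-≢0 y≉0)) ⟩
        ⟦ k u y ⟧                                        ∎
        where
        a = χ u
        b = χ y
        b₁ = χ (y + 1#)
        d = χ (u * y + 1#)

    -- For y ≠ 0 the variable of J is scaled by y; for y = 0 both sides carry the factor h(0) = 0.
    substitute : ∀ y → J E.* conjugate ⟦ h y ⟧ ≡ ∑ (λ u → ⟦ h y ⊗ h y ⊗ h (u * y) ⟧)
    substitute y = begin
      J E.* conjugate ⟦ h y ⟧                        ≡⟨ ≡.cong (J E.*_) (⟦a⊗a⟧≡conjugate (h y)) ⟨
      J E.* ⟦ h y ⊗ h y ⟧                            ≡⟨ E.*-comm J ⟦ h y ⊗ h y ⟧ ⟩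
      ⟦ h y ⊗ h y ⟧ E.* J                            ≡⟨ cases (y ≈? 0#) ⟩
      ⟦ h y ⊗ h y ⟧ E.* ∑ (λ u → ⟦ h (u * y) ⟧)      ≡⟨ *-distribˡ-∑ ⟦ h y ⊗ h y ⟧ (λ u → ⟦ h (u * y) ⟧) ⟩
      ∑ (λ u → ⟦ h y ⊗ h y ⟧ E.* ⟦ h (u * y) ⟧)      ≡⟨ ∑-cong (λ u → ⟦⟧-⊗ (h y ⊗ h y) (h (u * y))) ⟨
      ∑ (λ u → ⟦ h y ⊗ h y ⊗ h (u * y) ⟧)            ∎
      where
      cases : Dec (y ≈ 0#) → ⟦ h y ⊗ h y ⟧ E.* J ≡ ⟦ h y ⊗ h y ⟧ E.* ∑ (λ u → ⟦ h (u * y) ⟧)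
      cases (yes y≈0) = ≡.trans (vanish J) (≡.sym (vanish (∑ (λ u → ⟦ h (u * y) ⟧))))
        where
        vanish : ∀ z → ⟦ h y ⊗ h y ⟧ E.* z ≡ E.0#
        vanish z = ≡.trans (≡.cong (λ a → ⟦ a ⊗ a ⟧ E.* z) (h[0] y≈0)) (E.zeroˡ z)
      cases (no y≉0) = ≡.cong (⟦ h y ⊗ h y ⟧ E.*_) (≡.sym (∑-scale (λ e → ≡.cong ⟦_⟧ (h-cong e)) y≉0))

    J*conjugate[J] : J E.* conjugate J ≡ fromℤ (+ q)
    J*conjugate[J] = begin
      J E.* conjugate J
        ≡⟨ ≡.cong (J E.*_) (∑-conjugate (λ y → ⟦ h y ⟧)) ⟩
      J E.* ∑ (λ y → conjugate ⟦ h y ⟧)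
        ≡⟨ *-distribˡ-∑ J (λ y → conjugate ⟦ h y ⟧) ⟩
      ∑ (λ y → J E.* conjugate ⟦ h y ⟧)
        ≡⟨ ∑-cong substitute ⟩
      ∑ A
        ≡⟨ E.+-identityʳ (∑ A) ⟨
      ∑ A E.+ E.0#
        -- Summed over y first, the corrections at y = 0 add up to the sum of χ(u), which is 0, so
        -- they may be inserted freely.
        ≡⟨ ≡.cong (∑ A E.+_) (≡.trans (∑-swap (λ y u → if≈0 y (X u) E.0#)) (≡.trans (∑-cong (λ u → ∑-δ (X u))) ∑-X)) ⟨
      ∑ A E.+ ∑ B
        ≡⟨ ∑-+ A B ⟨
      ∑ (λ y → A y E.+ B y)
        ≡⟨ ∑-cong (λ y → ≡.trans (≡.sym (∑-+ (λ u → ⟦ h y ⊗ h y ⊗ h (u * y) ⟧) (λ u → if≈0 y (X u) E.0#))) (∑-cong (pointwise y))) ⟩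
      ∑ (λ y → ∑ (λ u → ⟦ k u y ⟧))
        ≡⟨ ∑-swap (λ y u → ⟦ k u y ⟧) ⟩
      ∑ (λ u → ∑ (λ y → ⟦ k u y ⟧))
        ≡⟨ ∑-cong (λ u → ≡.trans (∑-cong (λ y → ⟦⟧-⊗ (χ u) (χ (u * y + 1#) ⊗ (χ (y + 1#) ⊗ χ (y + 1#)))))
             (≡.sym (*-distribˡ-∑ (X u) (λ y → ⟦ χ (u * y + 1#) ⊗ (χ (y + 1#) ⊗ χ (y + 1#)) ⟧)))) ⟩
      ∑ (λ u → X u E.* K u)
        ≡⟨ ∑-X*K ⟩
      fromℤ (+ q) ∎
      where
      A B : Carrier → ℤ[ω]
      A y = ∑ (λ u → ⟦ h y ⊗ h y ⊗ h (u * y) ⟧)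
      B y = ∑ (λ u → if≈0 y (X u) E.0#)

  norm[J]≡q : norm J ≡ + q
  norm[J]≡q = ≡.cong ℤ[ω].constant (≡.trans (≡.sym (Eisenstein.x*conjugate[x] J)) J*conjugate[J])

  -- The sum over u of χ(u + 1) (1 + χ(u) + χ(u)²) is J - 1, and only u = 0 contributes a nonmultiple of 3.
  J≡2[mod3] : ∃ λ M → J ≡ fromℤ (+ 2) E.+ fromℤ (+ 3) E.* M
  J≡2[mod3] = ∑ m , (begin
    J                                              ≡⟨ Eℤ.solve 1 (λ j → j Eℤ.:= Eℤ.con 1ℤ Eℤ.:+ (Eℤ.con 0ℤ Eℤ.:+ (j Eℤ.:+ Eℤ.con ℤ.-1ℤ))) ≡.refl J ⟩
    E.1# E.+ (E.0# E.+ (J E.+ (E.- E.1#)))          ≡⟨ ≡.cong (E.1# E.+_) (≡.cong₂ E._+_ (≡.trans (∑-shift X-cong 1#) ∑-X) (≡.cong (J E.+_) ratio)) ⟨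
    E.1# E.+ (∑ (λ u → X (u + 1#)) E.+ (J E.+ ∑ r))
      ≡⟨ ≡.cong (E.1# E.+_) (≡.trans (∑-+ (λ u → X (u + 1#)) (λ u → ⟦ h u ⟧ E.+ r u)) (≡.cong (∑ (λ u → X (u + 1#)) E.+_) (∑-+ (λ u → ⟦ h u ⟧) r))) ⟨
    E.1# E.+ ∑ (λ u → X (u + 1#) E.+ (⟦ h u ⟧ E.+ r u))   ≡⟨ ≡.cong (E.1# E.+_) (∑-cong three) ⟩
    E.1# E.+ ∑ (λ u → if≈0 u E.1# E.0# E.+ fromℤ (+ 3) E.* m u)
      ≡⟨ ≡.cong (E.1# E.+_) (∑-+ (λ u → if≈0 u E.1# E.0#) (λ u → fromℤ (+ 3) E.* m u)) ⟩
    E.1# E.+ (∑ (λ u → if≈0 u E.1# E.0#) E.+ ∑ (λ u → fromℤ (+ 3) E.* m u))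
      ≡⟨ ≡.cong (E.1# E.+_) (≡.cong₂ E._+_ (∑-δ E.1#) (≡.sym (*-distribˡ-∑ (fromℤ (+ 3)) m))) ⟩
    E.1# E.+ (E.1# E.+ fromℤ (+ 3) E.* ∑ m)      ≡⟨ E.+-assoc E.1# E.1# (fromℤ (+ 3) E.* ∑ m) ⟨
    fromℤ (+ 2) E.+ fromℤ (+ 3) E.* ∑ m       ∎)
    where
    r m : Carrier → ℤ[ω]
    r u = ⟦ χ (1# * u + 1#) ⊗ (χ u ⊗ χ u) ⟧
    -- For a cube root of unity a, the factor 1 + a + a² is 3 if a = 1 and 0 otherwise, so `m₀ a b`
    -- is a third of b (1 + a + a²).
    m₀ : Class → Class → Class
    m₀ c1 b = b
    m₀ _  b = c0
    m u = ⟦ m₀ (χ u) (χ (u + 1#)) ⟧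
    ratio : ∑ r ≡ E.- E.1#
    ratio = begin
      ∑ r                              ≡⟨ Eℤ.solve 1 (λ s → s Eℤ.:= (s Eℤ.:+ Eℤ.con 1ℤ) Eℤ.:+ Eℤ.con ℤ.-1ℤ) ≡.refl (∑ r) ⟩
      (∑ r E.+ E.1#) E.+ (E.- E.1#)    ≡⟨ ≡.cong (λ x → (∑ r E.+ x) E.+ (E.- E.1#)) (≡.cong ⟦_⟧ χ[1]) ⟨
      (∑ r E.+ X 1#) E.+ (E.- E.1#)    ≡⟨ ≡.cong (E._+ (E.- E.1#)) (≡.trans (∑-X-ratio 1# 1#) (∑-X-affine 1≉0 1#)) ⟩
      E.0# E.+ (E.- E.1#)              ≡⟨ E.+-identityˡ (E.- E.1#) ⟩
      E.- E.1#                         ∎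
    table : ∀ a b → a ≢ c0 → ⟦ b ⟧ E.+ (⟦ a ⊗ b ⟧ E.+ ⟦ b ⊗ (a ⊗ a) ⟧) ≡ E.0# E.+ fromℤ (+ 3) E.* ⟦ m₀ a b ⟧
    table c0  b   a≢0 = contradiction ≡.refl a≢0
    table c1  c0  a≢0 = ≡.refl
    table c1  c1  a≢0 = ≡.refl
    table c1  cω  a≢0 = ≡.refl
    table c1  cω² a≢0 = ≡.refl
    table cω  c0  a≢0 = ≡.refl
    table cω  c1  a≢0 = ≡.refl
    table cω  cω  a≢0 = ≡.refl
    table cω  cω² a≢0 = ≡.refl
    table cω² c0  a≢0 = ≡.refl
    table cω² c1  a≢0 = ≡.refl
    table cω² cω  a≢0 = ≡.refl
    table cω² cω² a≢0 = ≡.refl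
    three : ∀ u → X (u + 1#) E.+ (⟦ h u ⟧ E.+ r u) ≡ if≈0 u E.1# E.0# E.+ fromℤ (+ 3) E.* m u
    three u = ≡.trans (≡.cong (λ a → X (u + 1#) E.+ (⟦ h u ⟧ E.+ ⟦ a ⊗ (χ u ⊗ χ u) ⟧)) (χ-cong (+-congʳ (*-identityˡ u)))) (cases (u ≈? 0#))
      where
      cases : Dec (u ≈ 0#) → ⟦ χ (u + 1#) ⟧ E.+ (⟦ χ u ⊗ χ (u + 1#) ⟧ E.+ ⟦ χ (u + 1#) ⊗ (χ u ⊗ χ u) ⟧) ≡ if≈0 u E.1# E.0# E.+ fromℤ (+ 3) E.* m u
      cases (yes u≈0) rewrite χ[0] u≈0 | if-yes {s = E.1#} {t = E.0#} u≈0 | ≡.trans (χ-cong (trans (+-congʳ u≈0) (+-identityˡ 1#))) χ[1] = ≡.refl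
      cases (no u≉0)  = ≡.trans (table (χ u) (χ (u + 1#)) (χ-≢0 u≉0)) (≡.cong (E._+ fromℤ (+ 3) E.* m u) (≡.sym (if-no u≉0)))

-- The sum of χ(a³ + 1), and the trace of the Jacobi sum modulo p

module JacobiSumEvaluations {c ℓ q} (F : FiniteField c ℓ q) (s : ℕ) .{{_ : NonZero s}} (q≡1+3s : q ≡ suc (3 ℕ.* s)) where

  open FiniteField F hiding (zero)
  open FieldTheory F
  open CubicCharacter F s q≡1+3s
  open JacobiSum F s q≡1+3s
  open JacobiSumNorm F s q≡1+3s
  open PowerSums F using (∑-x^s*[x+1]^s≈0; ∑-x^2s*[x+1]^2s)
  open Characteristic F
  private
    module E = CommutativeRing Eisenstein.commutativeRing
  open Eisenstein using (trace)

  -1-cube : ∀ {x} → x ≈ - 1# → χ x ≡ c1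
  -1-cube x≈-1 = ≡.trans (χ-*-cube (1≉0 ∘ -x≈0⇒x≈0) (trans x≈-1 (solve 0 (:- con 1ℤ := con 1ℤ :* (:- con 1ℤ :* :- con 1ℤ :* :- con 1ℤ)) refl))) χ[1]

  -- The points of y³ = a³ + 1 are carried to those of y³ = v (v + 1) by a Möbius transformation v of a,
  -- namely v = (w² - 1) t + w² with t = 1 / (a + w).
  ∑-X[a³+1] : ∑ (λ a → X (a * a * a + 1#)) E.+ E.1# ≡ J
  ∑-X[a³+1] = begin
    ∑ f E.+ E.1#
      ≡⟨ ≡.cong₂ E._+_ (≡.trans (∑-bijection f[-w]-cong _⁻¹ _⁻¹ ⁻¹-cong ⁻¹-cong ⁻¹-involutive ⁻¹-involutive) (∑-shift f-cong (- w))) (∑-δ E.1#) ⟨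
    ∑ (λ t → f (t ⁻¹ - w)) E.+ ∑ (λ t → if≈0 t E.1# E.0#)
      ≡⟨ ∑-+ (λ t → f (t ⁻¹ - w)) (λ t → if≈0 t E.1# E.0#) ⟨
    ∑ (λ t → f (t ⁻¹ - w) E.+ if≈0 t E.1# E.0#)
      ≡⟨ ∑-cong (λ t → pointwise t (t ≈? 0#)) ⟩
    ∑ (λ t → ⟦ h (t * (w * w - 1#) + w * w) ⟧)
      ≡⟨ ∑-scale (λ e → ≡.cong ⟦_⟧ (h-cong (+-congʳ e))) w²-1≉0 ⟩
    ∑ (λ t → ⟦ h (t + w * w) ⟧)
      ≡⟨ ∑-shift (λ e → ≡.cong ⟦_⟧ (h-cong e)) (w * w) ⟩
    J ∎
    where
    open ≡.≡-Reasoning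
    f : Carrier → ℤ[ω]
    f a = X (a * a * a + 1#)
    f-cong : Congruent f
    f-cong e = X-cong (+-congʳ (*-cong (*-cong e e) e))
    f[-w]-cong : Congruent (λ b → f (b - w))
    f[-w]-cong e = f-cong (+-congʳ e)
    w²-1≉0 : ¬ w * w - 1# ≈ 0#
    w²-1≉0 e = contradiction (φ-injective {cω²} {c1} (x-y≈0⇒x≈y (w * w) 1# e)) λ ()
    1-w³ : ∀ w → (- w) * (- w) * (- w) + 1# ≈ 1# - w * w * w
    1-w³ = solve 1 (λ w → (:- w) :* (:- w) :* (:- w) :+ con 1ℤ := con 1ℤ :- w :* w :* w) refl
    w²[w²+1] : ∀ w → w * w * (w * w + 1#) ≈ - 1# + (1# + w + w * w) * (w * w - w + 1#)
    w²[w²+1] = solve 1 (λ w → w :* w :* (w :* w :+ con 1ℤ) :=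
      :- con 1ℤ :+ (con 1ℤ :+ w :+ w :* w) :* (w :* w :- w :+ con 1ℤ)) refl
    -- Since a t = 1 - w t, the main term on the right is (a³ + 1)(-t)³, and the cube does not
    -- affect the character.
    v[v+1] : ∀ w t → (t * (w * w - 1#) + w * w) * ((t * (w * w - 1#) + w * w) + 1#) ≈
      - ((1# - w * t) * (1# - w * t) * (1# - w * t) + t * t * t) + (1# + w + w * w) *
        ((w * w - w + 1#) + ι (+ 2) * w * w * t - (ι (+ 2) * w + 1#) * t + (w * w - w + 1#) * (t * t) - (w - 1#) * (t * t * t))
    v[v+1] = solve 2 (λ w t → (t :* (w :* w :- con 1ℤ) :+ w :* w) :* ((t :* (w :* w :- con 1ℤ) :+ w :* w) :+ con 1ℤ) :=
      :- ((con 1ℤ :- w :* t) :* (con 1ℤ :- w :* t) :* (con 1ℤ :- w :* t) :+ t :* t :* t) :+ (con 1ℤ :+ w :+ w :* w) :*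
        ((w :* w :- w :+ con 1ℤ) :+ con (+ 2) :* w :* w :* t :- (con (+ 2) :* w :+ con 1ℤ) :* t :+ (w :* w :- w :+ con 1ℤ) :* (t :* t) :- (w :- con 1ℤ) :* (t :* t :* t))) refl
    clear : ∀ w u t → ((u - w) * (u - w) * (u - w) + 1#) * ((- t) * (- t) * (- t)) ≈
      - ((t * u - w * t) * (t * u - w * t) * (t * u - w * t) + t * t * t)
    clear = solve 3 (λ w u t → ((u :- w) :* (u :- w) :* (u :- w) :+ con 1ℤ) :* ((:- t) :* (:- t) :* (:- t)) :=
      :- ((t :* u :- w :* t) :* (t :* u :- w :* t) :* (t :* u :- w :* t) :+ t :* t :* t)) refl
    pointwise : ∀ t → Dec (t ≈ 0#) → f (t ⁻¹ - w) E.+ if≈0 t E.1# E.0# ≡ ⟦ h (t * (w * w - 1#) + w * w) ⟧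
    -- The value 0 of the inverse at 0 pairs t = 0 with a = -w, a root of a³ + 1. Under the Möbius
    -- transformation t = 0 is the point a = ∞, where v (v + 1) = -1 has character 1: this is the
    -- summand 1 added to the sum.
    pointwise t (yes t≈0) = begin
      f (t ⁻¹ - w) E.+ if≈0 t E.1# E.0#      ≡⟨ ≡.cong₂ E._+_ (≡.cong ⟦_⟧ (χ[0] a³+1≈0)) (if-yes t≈0) ⟩
      E.1#                                   ≡⟨ ≡.cong ⟦_⟧ (-1-cube (modulo-1+w+w² (w * w - w + 1#) (w²[w²+1] w))) ⟨
      X (w * w * (w * w + 1#))               ≡⟨ ≡.cong ⟦_⟧ (χ-* (w * w) (w * w + 1#)) ⟩
      ⟦ h (w * w) ⟧                          ≡⟨ ≡.cong ⟦_⟧ (h-cong (trans (+-congʳ (trans (*-congʳ t≈0) (zeroˡ _))) (+-identityˡ (w * w)))) ⟨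
      ⟦ h (t * (w * w - 1#) + w * w) ⟧       ∎
      where
      a≈-w : t ⁻¹ - w ≈ - w
      a≈-w = trans (+-congʳ (x≈0⇒x⁻¹≈0 t≈0)) (+-identityˡ (- w))
      a³+1≈0 : (t ⁻¹ - w) * (t ⁻¹ - w) * (t ⁻¹ - w) + 1# ≈ 0#
      a³+1≈0 = trans (+-congʳ (*-cong (*-cong a≈-w a≈-w) a≈-w)) (trans (1-w³ w) (x≈y⇒x-y≈0 (sym w³≈1)))
    pointwise t (no t≉0) = begin
      f a E.+ if≈0 t E.1# E.0#         ≡⟨ ≡.cong (f a E.+_) (if-no t≉0) ⟩
      f a E.+ E.0#                     ≡⟨ E.+-identityʳ (f a) ⟩
      X (a * a * a + 1#)               ≡⟨ ≡.cong ⟦_⟧ (χ-*-cube (t≉0 ∘ -x≈0⇒x≈0) v[v+1]≈) ⟨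
      X (v * (v + 1#))                 ≡⟨ ≡.cong ⟦_⟧ (χ-* v (v + 1#)) ⟩
      ⟦ h v ⟧                          ∎
      where
      a = t ⁻¹ - w
      v = t * (w * w - 1#) + w * w
      v[v+1]≈ : v * (v + 1#) ≈ (a * a * a + 1#) * ((- t) * (- t) * (- t))
      v[v+1]≈ = trans (modulo-1+w+w² _ (v[v+1] w t)) (sym (trans (clear w (t ⁻¹) t) (-‿cong (+-congʳ (*-cong (*-cong at≈ at≈) at≈)))))
        where
        at≈ : t * t ⁻¹ - w * t ≈ 1# - w * t
        at≈ = +-congʳ (x*x⁻¹≈1 t≉0)

  private
    open import Relation.Binary.Reasoning.Setoid ≈-setoid

    -- Sending ω to w reduces ℤ[ω] to F; the conjugate of a class is its square, so the trace
    -- becomes the sum of the images of both.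
    φ-trace : ∀ a → φ a + φ (a ⊗ a) ≈ ι (trace ⟦ a ⟧)
    φ-trace c0  = +-identityˡ 0#
    φ-trace c1  = refl
    φ-trace cω  = trans (solve 1 (λ w → w :+ w :* w := (con 1ℤ :+ w :+ w :* w) :+ con ℤ.-1ℤ) refl w) (trans (+-congʳ 1+w+w²≈0) (+-identityˡ _))
    φ-trace cω² = trans (solve 1 (λ w → w :* w :+ w := (con 1ℤ :+ w :+ w :* w) :+ con ℤ.-1ℤ) refl w) (trans (+-congʳ 1+w+w²≈0) (+-identityˡ _))

    ι-trace-∑ : ∀ f → ι (trace (∑ f)) ≈ ∑F.∑ (λ x → ι (trace (f x)))
    ι-trace-∑ f = ι-trace-sum (f ∘ from)
      where
      open MonoidSum E.+-commutativeMonoid using (sum)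
      open MonoidSum +-commutativeMonoid using () renaming (sum to sumF)
      ι-trace-sum : ∀ {n} (t : Fin n → ℤ[ω]) → ι (trace (sum t)) ≈ sumF (λ i → ι (trace (t i)))
      ι-trace-sum {zero}  t = refl
      ι-trace-sum {suc n} t = trans (reflexive (≡.cong ι (Eisenstein.trace-+ (t zero) (sum (t ∘ suc)))))
        (trans (ι-+ (trace (t zero)) (trace (sum (t ∘ suc)))) (+-congˡ (ι-trace-sum (t ∘ suc))))

    φ-h : ∀ u → φ (h u) ≈ u ^ s * (u + 1#) ^ s
    φ-h u = trans (φ-⊗ (χ u) (χ (u + 1#))) (*-cong (φ-χ u) (φ-χ (u + 1#)))

    φ-h² : ∀ u → φ (h u ⊗ h u) ≈ u ^ (2 ℕ.* s) * (u + 1#) ^ (2 ℕ.* s)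
    φ-h² u = trans (φ-⊗ (h u) (h u)) (trans (*-cong (φ-h u) (φ-h u)) (trans (interchange (u ^ s) ((u + 1#) ^ s))
      (sym (*-cong (double u) (double (u + 1#))))))
      where
      interchange : ∀ a b → a * b * (a * b) ≈ a * a * (b * b)
      interchange = solve 2 (λ a b → a :* b :* (a :* b) := a :* a :* (b :* b)) refl
      double : ∀ x → x ^ (2 ℕ.* s) ≈ x ^ s * x ^ s
      double x = trans (^-homo-* x s (s ℕ.+ 0)) (*-congˡ (reflexive (≡.cong (x ^_) (ℕₚ.+-identityʳ s))))

    -- In F the character is the s-th power and its conjugate the 2s-th power, so the trace becomes
    -- the sum of two power sums, namely 0 and - C(2s, s).
    ι-trace[J] : ι (trace J ℤ.+ + ((2 ℕ.* s) C s)) ≈ 0#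
    ι-trace[J] = begin
      ι (trace J ℤ.+ + C₂ₛ)                                        ≈⟨ ι-+ (trace J) (+ C₂ₛ) ⟩
      ι (trace J) + ι (+ C₂ₛ)                                      ≈⟨ +-cong (ι-trace-∑ (λ u → ⟦ h u ⟧)) (ι-pos C₂ₛ) ⟩
      ∑F.∑ (λ u → ι (trace ⟦ h u ⟧)) + C₂ₛ × 1#                    ≈⟨ +-congʳ (∑F.∑-cong (λ u → trans (sym (φ-trace (h u))) (+-cong (φ-h u) (φ-h² u)))) ⟩
      ∑F.∑ (λ u → A s u + A (2 ℕ.* s) u) + C₂ₛ × 1#                ≈⟨ +-congʳ (∑F.∑-+ (A s) (A (2 ℕ.* s))) ⟩
      (∑F.∑ (A s) + ∑F.∑ (A (2 ℕ.* s))) + C₂ₛ × 1#                 ≈⟨ +-assoc _ _ _ ⟩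
      ∑F.∑ (A s) + (∑F.∑ (A (2 ℕ.* s)) + C₂ₛ × 1#)                 ≈⟨ +-cong (∑-x^s*[x+1]^s≈0 s q≡1+3s) (∑-x^2s*[x+1]^2s s q≡1+3s) ⟩
      0# + 0#                                                      ≈⟨ +-identityˡ 0# ⟩
      0#                                                           ∎
      where
      C₂ₛ = (2 ℕ.* s) C s
      A : ℕ → Carrier → Carrier
      A e u = u ^ e * (u + 1#) ^ e

  p∣trace[J]+C[2s,s] : ∀ {p} → Prime p → p × 1# ≈ 0# → + p ℤ∣.∣ trace J ℤ.+ + ((2 ℕ.* s) C s)
  p∣trace[J]+C[2s,s] {p} p-prime p×1≈0 = divides-of (trace J ℤ.+ + ((2 ℕ.* s) C s)) ι-trace[J]
    where
    divides-of : ∀ z → ι z ≈ 0# → + p ℤ∣.∣ z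
    divides-of (+ n)      e = ℤ∣.∣ᵤ⇒∣ (m×1≈0⇒p∣m p-prime p×1≈0 (trans (sym (ι-pos n)) e))
    divides-of (-[1+ n ]) e = ℤ∣.∣ᵤ⇒∣ (m×1≈0⇒p∣m p-prime p×1≈0 (trans (sym (ι-pos (suc n))) (-x≈0⇒x≈0 e)))

-- Counting the permutation polynomials

module _ {c ℓ} (R : CommutativeRing c ℓ) where

  open CommutativeRing R hiding (zero)
  open Polynomials R
  open IntegersIn R using (solve; _:+_; _:*_; _:=_)
  open Exp semiring using (_^_)
  open import Data.List.Base using ([]; _∷_; map)

  eval-X^ : ∀ n x → eval (X^ n) x ≈ x ^ n
  eval-X^ zero    x = trans (+-congˡ (zeroʳ x)) (+-identityʳ 1#)
  eval-X^ (suc n) x = trans (+-identityˡ _) (*-congˡ (eval-X^ n x))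

  eval-+ₚ : ∀ f g x → eval (f +ₚ g) x ≈ eval f x + eval g x
  eval-+ₚ []      g       x = sym (+-identityˡ _)
  eval-+ₚ (a ∷ f) []      x = sym (+-identityʳ _)
  eval-+ₚ (a ∷ f) (b ∷ g) x = trans (+-congˡ (*-congˡ (eval-+ₚ f g x)))
    (solve 5 (λ a b x f g → a :+ b :+ x :* (f :+ g) := (a :+ x :* f) :+ (b :+ x :* g)) refl a b x (eval f x) (eval g x))

  eval-map-* : ∀ a g x → eval (map (a *_) g) x ≈ a * eval g x
  eval-map-* a []      x = sym (zeroʳ a)
  eval-map-* a (b ∷ g) x = trans (+-congˡ (*-congˡ (eval-map-* a g x)))
    (solve 4 (λ a b x g → a :* b :+ x :* (a :* g) := a :* (b :+ x :* g)) refl a b x (eval g x))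

  eval-*ₚ : ∀ f g x → eval (f *ₚ g) x ≈ eval f x * eval g x
  eval-*ₚ []      g x = sym (zeroˡ _)
  eval-*ₚ (a ∷ f) g x = trans (eval-+ₚ (map (a *_) g) (0# ∷ (f *ₚ g)) x)
    (trans (+-cong (eval-map-* a g x) (trans (+-identityˡ _) (*-congˡ (eval-*ₚ f g x))))
      (solve 4 (λ a x f g → a :* g :+ x :* (f :* g) := (a :+ x :* f) :* g) refl a x (eval f x) (eval g x)))

injective⇒surjective : ∀ {n} {f : Fin n → Fin n} → (∀ {i j} → f i ≡ f j → i ≡ j) → ∀ j → ∃ λ i → f i ≡ j
injective⇒surjective {suc n} {f} f-inj j with Finₚ.any? (λ i → f i Finₚ.≟ j)
... | yes hit = hit
... | no miss = contradiction
  (λ {i} {i′} e → f-inj (Finₚ.punchOut-injective (j≢f i) (j≢f i′) e))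
  (Finₚ.<⇒notInjective {f = λ i → Fin.punchOut (j≢f i)} (ℕₚ.n<1+n n))
  where
  j≢f : ∀ i → j ≢ f i
  j≢f i j≡fi = miss (i , ≡.sym j≡fi)

infix 4 _≟ᶜ_

_≟ᶜ_ : DecidableEquality Class
a ≟ᶜ b = map′ (code-injective a b) (≡.cong code) (code a ℕₚ.≟ code b)
  where
  code : Class → ℕ
  code c0  = 0
  code c1  = 1
  code cω  = 2
  code cω² = 3
  code-injective : ∀ a b → code a ≡ code b → a ≡ b
  code-injective c0  c0  _ = ≡.refl
  code-injective c1  c1  _ = ≡.refl
  code-injective cω  cω  _ = ≡.refl
  code-injective cω² cω² _ = ≡.refl

-- A statement about finitely many classes is decided by enumeration, so the identities behind the
-- counting are verified by evaluation.
∀-class? : ∀ {p} {P : Pred Class p} → Decidable P → Dec (∀ a → P a)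
∀-class? {P = P} P? = map′ every (λ h → h c0 , h c1 , h cω , h cω²) (P? c0 ×-dec P? c1 ×-dec P? cω ×-dec P? cω²)
  where
  every : P c0 ∧ P c1 ∧ P cω ∧ P cω² → ∀ a → P a
  every (p , _ , _ , _) c0  = p
  every (_ , p , _ , _) c1  = p
  every (_ , _ , p , _) cω  = p
  every (_ , _ , _ , p) cω² = p

_≟ᴱ_ : DecidableEquality ℤ[ω]
(a +ω b) ≟ᴱ (c +ω d) = map′ (λ (e , f) → ≡.cong₂ _+ω_ e f) (λ e → ≡.cong ℤ[ω].constant e , ≡.cong ℤ[ω].ω-coefficient e)
  ((a ℤₚ.≟ c) ×-dec (b ℤₚ.≟ d))

-- Three classes with this property exhaust the cube roots of unity.
Distinct : Class → Class → Class → Set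
Distinct x y z = (x ≢ c0 ∧ y ≢ c0 ∧ z ≢ c0) ∧ (x ≢ y ∧ y ≢ z ∧ x ≢ z)

distinct? : ∀ x y z → Dec (Distinct x y z)
distinct? x y z = (¬? (x ≟ᶜ c0) ×-dec ¬? (y ≟ᶜ c0) ×-dec ¬? (z ≟ᶜ c0)) ×-dec (¬? (x ≟ᶜ y) ×-dec ¬? (y ≟ᶜ z) ×-dec ¬? (x ≟ᶜ z))

Covers : Class → Class → Class → Class → Set
Covers x y z c = x ≡ c ⊎ y ≡ c ⊎ z ≡ c

abstract
  covers⇒distinct : ∀ x y z → Covers x y z c1 ∧ Covers x y z cω ∧ Covers x y z cω² → Distinct x y z
  covers⇒distinct = from-yes (∀-class? λ x → ∀-class? λ y → ∀-class? λ z →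
    (covers? x y z c1 ×-dec covers? x y z cω ×-dec covers? x y z cω²) →-dec distinct? x y z)
    where
    covers? : ∀ x y z c → Dec (Covers x y z c)
    covers? x y z c = (x ≟ᶜ c) ⊎-dec (y ≟ᶜ c) ⊎-dec (z ≟ᶜ c)

module DistinctnessIndicator where

  open Eisenstein using (conjugate; fromℤ)
  private
    module E = CommutativeRing Eisenstein.commutativeRing

  -- The factor 9 clears the denominators of the character expansion of the indicator.
  nine : Class → Class → Class → ℤ[ω]
  nine x y z = if does (distinct? x y z) then fromℤ (+ 9) else E.0#

  double-trace : ℤ[ω] → ℤ[ω]
  double-trace x = x E.+ conjugate x

  cyclic : Class → Class → Class → ℤ[ω]
  cyclic x y z = ⟦ x ⊗ (y ⊗ y) ⟧ E.+ (⟦ y ⊗ (z ⊗ z) ⟧ E.+ ⟦ z ⊗ (x ⊗ x) ⟧)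

  -- For cube roots of unity, 3 (1 + m + m²) with m = x y z is 9 if x, y, z are distinct or all equal and
  -- 0 otherwise, and the product of 1 + u + u² over u = x y², y z² is 9 if they are all equal and 0 otherwise.
  -- The polynomial is the difference of the two.
  polynomial : Class → Class → Class → ℤ[ω]
  polynomial x y z = fromℤ (+ 2) E.+ (double-trace ⟦ x ⊗ y ⊗ z ⟧ E.+ double-trace ⟦ x ⊗ y ⊗ z ⟧) E.- double-trace (cyclic x y z)

  -- The value of `polynomial` when one argument is 0: the product and two of the three cyclic terms
  -- vanish, and t is the remaining one.
  vertex : Class → ℤ[ω]
  vertex t = fromℤ (+ 2) E.- double-trace ⟦ t ⟧

  abstract
    nine≡polynomial : ∀ x y z → x ≢ c0 ∧ y ≢ c0 ∧ z ≢ c0 → nine x y z ≡ polynomial x y z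
    nine≡polynomial = from-yes (∀-class? λ x → ∀-class? λ y → ∀-class? λ z →
      (¬? (x ≟ᶜ c0) ×-dec ¬? (y ≟ᶜ c0) ×-dec ¬? (z ≟ᶜ c0)) →-dec (nine x y z ≟ᴱ polynomial x y z))

    nine₁≡0 : ∀ y z → nine c0 y z ≡ E.0#
    nine₁≡0 y z = ≡.refl

    nine₂≡0 : ∀ x z → nine x c0 z ≡ E.0#
    nine₂≡0 = from-yes (∀-class? λ x → ∀-class? λ z → nine x c0 z ≟ᴱ E.0#)

    nine₃≡0 : ∀ x y → nine x y c0 ≡ E.0#
    nine₃≡0 = from-yes (∀-class? λ x → ∀-class? λ y → nine x y c0 ≟ᴱ E.0#)

    polynomial₁ : ∀ y z → polynomial c0 y z ≡ vertex (y ⊗ (z ⊗ z))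
    polynomial₁ = from-yes (∀-class? λ y → ∀-class? λ z → polynomial c0 y z ≟ᴱ vertex (y ⊗ (z ⊗ z)))

    polynomial₂ : ∀ x z → polynomial x c0 z ≡ vertex (z ⊗ (x ⊗ x))
    polynomial₂ = from-yes (∀-class? λ x → ∀-class? λ z → polynomial x c0 z ≟ᴱ vertex (z ⊗ (x ⊗ x)))

    polynomial₃ : ∀ x y → polynomial x y c0 ≡ vertex (x ⊗ (y ⊗ y))
    polynomial₃ = from-yes (∀-class? λ x → ∀-class? λ y → polynomial x y c0 ≟ᴱ vertex (x ⊗ (y ⊗ y)))

-- Permutations of the field and of the cube roots of unity

module PermutationCriterion {c ℓ q} (F : FiniteField c ℓ q) (s n : ℕ) .{{_ : NonZero s}} .{{_ : NonZero n}}
  (q≡1+3s : q ≡ suc (3 ℕ.* s)) (gcd≡1 : gcd n s ≡ 1) where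

  open FiniteField F hiding (zero)
  open FieldTheory F
  open CubicCharacter F s q≡1+3s
  open PowerSums F using (0^[1+m]≈0)
  open Polynomials commutativeRing
  open import Relation.Binary.Reasoning.Setoid ≈-setoid

  binomialPolynomial : Carrier → Poly
  binomialPolynomial a = X^ n *ₚ (X^ s +ₚ C a)

  value : Carrier → Class → Class
  value a b = b ⊗^ n ⊗ χ (φ b + a)

  private
    power : ∀ {x y} i m → x ^ m ≈ y ^ m → x ^ (i ℕ.* m) ≈ y ^ (i ℕ.* m)
    power {x} {y} i m e = begin
      x ^ (i ℕ.* m)   ≡⟨ ≡.cong (x ^_) (ℕₚ.*-comm i m) ⟩
      x ^ (m ℕ.* i)   ≈⟨ ^-assocʳ x m i ⟨
      (x ^ m) ^ i     ≈⟨ ^-congˡ i e ⟩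
      (y ^ m) ^ i     ≈⟨ ^-assocʳ y m i ⟩
      y ^ (m ℕ.* i)   ≡⟨ ≡.cong (y ^_) (ℕₚ.*-comm m i) ⟩
      y ^ (i ℕ.* m)   ∎

    -- With Bézout's identity in the form 1 + j l = i m all exponents are natural numbers; x is
    -- recovered after cancelling the nonzero factor x^(j l).
    from-Bézout : ∀ {x y} m l i j → 1 ℕ.+ j ℕ.* l ≡ i ℕ.* m → ¬ x ≈ 0# → x ^ m ≈ y ^ m → x ^ l ≈ y ^ l → x ≈ y
    from-Bézout {x} {y} m l i j eq x≉0 e e′ = *-cancelˡ (^-≉0 (j ℕ.* l) x≉0) (begin
      x ^ (j ℕ.* l) * x     ≈⟨ *-comm _ _ ⟩
      x ^ (1 ℕ.+ j ℕ.* l)   ≡⟨ ≡.cong (x ^_) eq ⟩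
      x ^ (i ℕ.* m)         ≈⟨ power i m e ⟩
      y ^ (i ℕ.* m)         ≡⟨ ≡.cong (y ^_) eq ⟨
      y * y ^ (j ℕ.* l)     ≈⟨ *-congˡ (power j l e′) ⟨
      y * x ^ (j ℕ.* l)     ≈⟨ *-comm _ _ ⟩
      x ^ (j ℕ.* l) * y     ∎)

    equal-powers : ∀ {x y} m l → Coprime m l → ¬ x ≈ 0# → x ^ m ≈ y ^ m → x ^ l ≈ y ^ l → x ≈ y
    equal-powers m l coprime x≉0 e e′ with coprime-Bézout coprime
    ... | Bézout.+- i j eq = from-Bézout m l i j eq x≉0 e e′
    ... | Bézout.-+ i j eq = from-Bézout l m j i eq x≉0 e′ e

  module _ (a : Carrier) where

    private
      f : Carrier → Carrier
      f = eval (binomialPolynomial a)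

      f≈ : ∀ x → f x ≈ x ^ n * (x ^ s + a)
      f≈ x = trans (eval-*ₚ commutativeRing (X^ n) (X^ s +ₚ C a) x) (*-cong (eval-X^ commutativeRing n x)
        (trans (eval-+ₚ commutativeRing (X^ s) (C a) x) (+-cong (eval-X^ commutativeRing s x) (trans (+-congˡ (zeroʳ x)) (+-identityʳ a)))))

      f[0] : ∀ {x} → x ≈ 0# → f x ≈ 0#
      f[0] {x} x≈0 = trans (f≈ x) (trans (*-congʳ (0^[1+m]≈0 q≡1+3s n x≈0)) (zeroˡ _))

      x^s≈φ : ∀ x → x ^ s + a ≈ φ (χ x) + a
      x^s≈φ x = +-congʳ (sym (φ-χ x))

      χ-f : ∀ x → χ (f x) ≡ value a (χ x)
      χ-f x = ≡.trans (χ-cong (trans (f≈ x) (*-congˡ (x^s≈φ x))))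
        (≡.trans (χ-* (x ^ n) (φ (χ x) + a)) (≡.cong (_⊗ χ (φ (χ x) + a)) (χ-^ x n)))

      DistinctValues : Set
      DistinctValues = Distinct (value a c1) (value a cω) (value a cω²)

    -- A preimage of an element of nonzero class is itself nonzero, because f fixes 0. So each cube
    -- root of unity is a value at a cube root of unity, and three values covering three classes are
    -- distinct.
    surjective⇒distinct : Surjective _≈_ _≈_ f → DistinctValues
    surjective⇒distinct surj = covers⇒distinct _ _ _ (cover c1 (λ ()) , cover cω (λ ()) , cover cω² (λ ()))
      where
      attained : ∀ b → b ≢ c0 → ∃ λ d → d ≢ c0 ∧ value a d ≡ b
      attained b b≢0 = χ x , χ-≢0 x≉0 , ≡.trans (≡.sym (χ-f x)) χ[fx]≡b
        where
        y = proj₁ (χ-surjective b)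
        x = proj₁ (surj y)
        χ[fx]≡b : χ (f x) ≡ b
        χ[fx]≡b = ≡.trans (χ-cong (proj₂ (surj y) refl)) (proj₂ (χ-surjective b))
        x≉0 : ¬ x ≈ 0#
        x≉0 x≈0 = b≢0 (≡.trans (≡.sym χ[fx]≡b) (χ[0] (f[0] x≈0)))
      cover : ∀ b → b ≢ c0 → Covers (value a c1) (value a cω) (value a cω²) b
      cover b b≢0 with attained b b≢0
      ... | c0  , d≢0 , _ = contradiction ≡.refl d≢0
      ... | c1  , _   , e = inj₁ e
      ... | cω  , _   , e = inj₂ (inj₁ e)
      ... | cω² , _   , e = inj₂ (inj₂ e)

    -- The class of f x determines the class of x, hence x^s; dividing f x by the nonzero x^s + a
    -- gives x^n; and coprimality of n and s recovers x from both powers.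
    distinct⇒injective : DistinctValues → Injective _≈_ _≈_ f
    distinct⇒injective ((v₁≢0 , v₂≢0 , v₃≢0) , (v₁≢v₂ , v₂≢v₃ , v₁≢v₃)) {x} {y} fx≈fy = cases (x ≈? 0#) (y ≈? 0#)
      where
      value-≢0 : ∀ b → b ≢ c0 → value a b ≢ c0
      value-≢0 c0  b≢0 = contradiction ≡.refl b≢0
      value-≢0 c1  _   = v₁≢0
      value-≢0 cω  _   = v₂≢0
      value-≢0 cω² _   = v₃≢0
      value-injective : ∀ b d → b ≢ c0 → d ≢ c0 → value a b ≡ value a d → b ≡ d
      value-injective c0  _   b≢0 _   _ = contradiction ≡.refl b≢0
      value-injective c1  c0  _   d≢0 _ = contradiction ≡.refl d≢0
      value-injective cω  c0  _   d≢0 _ = contradiction ≡.refl d≢0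
      value-injective cω² c0  _   d≢0 _ = contradiction ≡.refl d≢0
      value-injective c1  c1  _   _   _ = ≡.refl
      value-injective cω  cω  _   _   _ = ≡.refl
      value-injective cω² cω² _   _   _ = ≡.refl
      value-injective c1  cω  _   _   e = contradiction e v₁≢v₂
      value-injective cω  c1  _   _   e = contradiction (≡.sym e) v₁≢v₂
      value-injective cω  cω² _   _   e = contradiction e v₂≢v₃
      value-injective cω² cω  _   _   e = contradiction (≡.sym e) v₂≢v₃
      value-injective c1  cω² _   _   e = contradiction e v₁≢v₃
      value-injective cω² c1  _   _   e = contradiction (≡.sym e) v₁≢v₃
      f≉0 : ∀ {x} → ¬ x ≈ 0# → ¬ f x ≈ 0#
      f≉0 {x} x≉0 fx≈0 = value-≢0 (χ x) (χ-≢0 x≉0) (≡.trans (≡.sym (χ-f x)) (χ[0] fx≈0))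
      cases : Dec (x ≈ 0#) → Dec (y ≈ 0#) → x ≈ y
      cases (yes x≈0) (yes y≈0) = trans x≈0 (sym y≈0)
      cases (yes x≈0) (no y≉0)  = contradiction (trans (sym fx≈fy) (f[0] x≈0)) (f≉0 y≉0)
      cases (no x≉0)  (yes y≈0) = contradiction (trans fx≈fy (f[0] y≈0)) (f≉0 x≉0)
      cases (no x≉0)  (no y≉0)  = equal-powers n s (gcd≡1⇒coprime gcd≡1) x≉0 x^n≈y^n x^s≈y^s
        where
        x^s≈y^s : x ^ s ≈ y ^ s
        x^s≈y^s = trans (sym (φ-χ x)) (trans (reflexive (≡.cong φ (value-injective (χ x) (χ y) (χ-≢0 x≉0) (χ-≢0 y≉0)
          (≡.trans (≡.sym (χ-f x)) (≡.trans (χ-cong fx≈fy) (χ-f y)))))) (φ-χ y))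
        x^s+a≉0 : ¬ x ^ s + a ≈ 0#
        x^s+a≉0 e = f≉0 x≉0 (trans (f≈ x) (trans (*-congˡ e) (zeroʳ _)))
        x^n≈y^n : x ^ n ≈ y ^ n
        x^n≈y^n = *-cancelˡ x^s+a≉0 (begin
          (x ^ s + a) * x ^ n   ≈⟨ *-comm _ _ ⟩
          x ^ n * (x ^ s + a)   ≈⟨ f≈ x ⟨
          f x                   ≈⟨ fx≈fy ⟩
          f y                   ≈⟨ f≈ y ⟩
          y ^ n * (y ^ s + a)   ≈⟨ *-comm _ _ ⟩
          (y ^ s + a) * y ^ n   ≈⟨ *-congʳ (+-congʳ x^s≈y^s) ⟨
          (x ^ s + a) * y ^ n   ∎)

    injective⇒surjective-eval : Injective _≈_ _≈_ f → Surjective _≈_ _≈_ f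
    injective⇒surjective-eval f-inj y = from i , λ z≈ → trans (eval-cong (binomialPolynomial a) z≈)
      (trans (sym (strictlyInverseʳ _)) (trans (reflexive (≡.cong from gi≡)) (strictlyInverseʳ y)))
      where
      from-injective : ∀ {i j} → from i ≈ from j → i ≡ j
      from-injective {i} {j} e = ≡.trans (≡.sym (strictlyInverseˡ i)) (≡.trans (to-cong e) (strictlyInverseˡ j))
      g : Fin q → Fin q
      g i = to (f (from i))
      g-inj : ∀ {i j} → g i ≡ g j → i ≡ j
      g-inj e = from-injective (f-inj (trans (sym (strictlyInverseʳ _)) (trans (reflexive (≡.cong from e)) (strictlyInverseʳ _))))
      i = proj₁ (injective⇒surjective g-inj (to y))
      gi≡ = proj₂ (injective⇒surjective g-inj (to y))

    isPermutation≡distinct :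
      does (isPermutationPolynomial? F (binomialPolynomial a)) ≡ does (distinct? (value a c1) (value a cω) (value a cω²))
    isPermutation≡distinct = does-⇔ (mk⇔ (λ (_ , surj) → surjective⇒distinct surj)
      (λ d → (λ {x} {y} → distinct⇒injective d {x} {y}) , injective⇒surjective-eval (distinct⇒injective d)))
      (isPermutationPolynomial? F (binomialPolynomial a)) (distinct? (value a c1) (value a cω) (value a cω²))

-- Evaluation of the count as a character sum

module PermutationCount {c ℓ q} (F : FiniteField c ℓ q) (s n : ℕ) .{{_ : NonZero s}} .{{_ : NonZero n}}
  (q≡1+3s : q ≡ suc (3 ℕ.* s)) (gcd≡1 : gcd n s ≡ 1) where

  open FiniteField F hiding (zero)
  open FieldTheory F
  open CubicCharacter F s q≡1+3s
  open JacobiSum F s q≡1+3s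
  open JacobiSumNorm F s q≡1+3s using (J)
  open JacobiSumEvaluations F s q≡1+3s using (∑-X[a³+1])
  open PermutationCriterion F s n q≡1+3s gcd≡1
  open DistinctnessIndicator
  open Eisenstein using (conjugate; fromℤ; trace)
  private
    module E = CommutativeRing Eisenstein.commutativeRing
    module Eℤ = IntegersIn Eisenstein.commutativeRing
    module ⊗-Solver = CommutativeMonoidSolver ⊗-c1-commutativeMonoid
  open ⊗-Solver using (_⊕_; _⊜_)
  open ≡.≡-Reasoning

  permutationCount : ℕ
  permutationCount = Vec.count (λ a → isPermutationPolynomial? F (binomialPolynomial a)) elements

  -- `ν` is the factor ζ^n at ζ = ω. `τ` is the one surviving cyclic ratio at each of the three a
  -- where a value vanishes. The traces of `ν ⊗ ν` and `τ` will be - ε₂ and - ε₁.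
  ν τ : Class
  ν = cω ⊗^ n
  τ = ν ⊗ ν ⊗ χ w

  private
    -- The values at the three cube roots of unity with the twists ζ^n pulled out; the twist at ω²
    -- is ν².
    x y z : Carrier → Class
    x a = χ (a + 1#)
    y a = ν ⊗ χ (a + w)
    z a = ν ⊗ ν ⊗ χ (a + w * w)

    c1^n : ∀ n → c1 ⊗^ n ≡ c1
    c1^n zero    = ≡.refl
    c1^n (suc n) = c1^n n

    ν≢0 : ν ≢ c0
    ν≢0 = ⊗^-≢0 n λ ()

    nineₐ : Carrier → ℤ[ω]
    nineₐ a = nine (x a) (y a) (z a)

    count-∑ : fromℤ (+ 9 ℤ.* + permutationCount) ≡ ∑ nineₐ
    count-∑ = ≡.trans (count-sum from) (∑-cong λ a → ≡.cong (if_then fromℤ (+ 9) else E.0#)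
      (≡.trans (isPermutation≡distinct a) (≡.cong₂ (λ x (y , z) → does (distinct? x y z)) (x≡ a) (≡.cong₂ _,_ (y≡ a) (z≡ a)))))
      where
      open MonoidSum E.+-commutativeMonoid using (sum)
      P? = λ a → isPermutationPolynomial? F (binomialPolynomial a)
      count-sum : ∀ {m} (t : Fin m → Carrier) → fromℤ (+ 9 ℤ.* + Vec.count P? (Vec.tabulate t)) ≡
        sum (λ i → if does (P? (t i)) then fromℤ (+ 9) else E.0#)
      count-sum {zero}  t = ≡.refl
      count-sum {suc m} t with does (P? (t zero)) | count-sum (t ∘ suc)
      ... | true  | ih = ≡.trans (≡.cong fromℤ (ℤₚ.*-distribˡ-+ (+ 9) 1ℤ (+ Vec.count P? (Vec.tabulate (t ∘ suc))))) (≡.cong (fromℤ (+ 9) E.+_) ih)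
      ... | false | ih = ≡.trans ih (≡.sym (E.+-identityˡ _))
      x≡ : ∀ a → value a c1 ≡ x a
      x≡ a = ≡.cong₂ _⊗_ (c1^n n) (χ-cong (+-comm 1# a))
      y≡ : ∀ a → value a cω ≡ y a
      y≡ a = ≡.cong (ν ⊗_) (χ-cong (+-comm w a))
      z≡ : ∀ a → value a cω² ≡ z a
      z≡ a = ≡.cong₂ _⊗_ (⊗^-distrib-⊗ cω cω n) (χ-cong (+-comm (w * w) a))

    δ : Carrier → Carrier → ℤ[ω]
    δ b a = if≈0 (a + b) (vertex τ) E.0#

    -- Because ν³ = 1, each of the three cyclic terms is the same twist ν² times a ratio of two
    -- linear factors.
    rearrange₁ : ∀ a → x a ⊗ (y a ⊗ y a) ≡ ν ⊗ ν ⊗ (χ (a + 1#) ⊗ (χ (a + w) ⊗ χ (a + w)))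
    rearrange₁ a = ⊗-Solver.solve 3 (λ ν A B → A ⊕ ((ν ⊕ B) ⊕ (ν ⊕ B)) ⊜ (ν ⊕ ν) ⊕ (A ⊕ (B ⊕ B))) ≡.refl ν (χ (a + 1#)) (χ (a + w))

    rearrange₂ : ∀ a → y a ⊗ (z a ⊗ z a) ≡ ν ⊗ ν ⊗ (χ (a + w) ⊗ (χ (a + w * w) ⊗ χ (a + w * w)))
    rearrange₂ a = ≡.trans
      (⊗-Solver.solve 3 (λ ν B C → (ν ⊕ B) ⊕ (((ν ⊕ ν) ⊕ C) ⊕ ((ν ⊕ ν) ⊕ C)) ⊜ ((ν ⊕ ν) ⊕ ν) ⊕ ((ν ⊕ ν) ⊕ (B ⊕ (C ⊕ C)))) ≡.refl
        ν (χ (a + w)) (χ (a + w * w)))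
      (≡.cong (_⊗ (ν ⊗ ν ⊗ (χ (a + w) ⊗ (χ (a + w * w) ⊗ χ (a + w * w))))) (a⊗a⊗a≡1 ν≢0))

    rearrange₃ : ∀ a → z a ⊗ (x a ⊗ x a) ≡ ν ⊗ ν ⊗ (χ (a + w * w) ⊗ (χ (a + 1#) ⊗ χ (a + 1#)))
    rearrange₃ a = ⊗-Solver.solve 3 (λ ν A C → ((ν ⊕ ν) ⊕ C) ⊕ (A ⊕ A) ⊜ (ν ⊕ ν) ⊕ (C ⊕ (A ⊕ A))) ≡.refl ν (χ (a + 1#)) (χ (a + w * w))

    -- The twists multiply to ν³ = 1 and the linear factors to a³ + 1.
    product : ∀ a → x a ⊗ y a ⊗ z a ≡ χ (a * a * a + 1#)
    product a = begin
      x a ⊗ y a ⊗ z a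
        ≡⟨ ⊗-Solver.solve 4 (λ ν A B C → (A ⊕ (ν ⊕ B)) ⊕ ((ν ⊕ ν) ⊕ C) ⊜ ((ν ⊕ ν) ⊕ ν) ⊕ ((A ⊕ B) ⊕ C)) ≡.refl
             ν (χ (a + 1#)) (χ (a + w)) (χ (a + w * w)) ⟩
      ν ⊗ ν ⊗ ν ⊗ (χ (a + 1#) ⊗ χ (a + w) ⊗ χ (a + w * w))
        ≡⟨ ≡.cong (_⊗ (χ (a + 1#) ⊗ χ (a + w) ⊗ χ (a + w * w))) (a⊗a⊗a≡1 ν≢0) ⟩
      χ (a + 1#) ⊗ χ (a + w) ⊗ χ (a + w * w)
        ≡⟨ ≡.trans (χ-* ((a + 1#) * (a + w)) (a + w * w)) (≡.cong (_⊗ χ (a + w * w)) (χ-* (a + 1#) (a + w))) ⟨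
      χ ((a + 1#) * (a + w) * (a + w * w))
        ≡⟨ χ-cong (modulo-1+w+w² _ (factorization a w)) ⟩
      χ (a * a * a + 1#) ∎
      where
      factorization : ∀ a w → (a + 1#) * (a + w) * (a + w * w) ≈ a * a * a + 1# + (1# + w + w * w) * (a * a + w * a + (w - 1#))
      factorization = solve 2 (λ a w → (a :+ con 1ℤ) :* (a :+ w) :* (a :+ w :* w) :=
        a :* a :* a :+ con 1ℤ :+ (con 1ℤ :+ w :+ w :* w) :* (a :* a :+ w :* a :+ (w :- con 1ℤ))) refl

    w-1≉0 : ¬ w - 1# ≈ 0#
    w-1≉0 e = w≉1 (x-y≈0⇒x≈y w 1# e)

    difference≈ : ∀ {a b d} → a + b ≈ 0# → a + d ≈ d - b
    difference≈ {a} {b} {d} e = trans (regroup a b d) (trans (+-congʳ e) (+-identityˡ (d - b)))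
      where
      regroup : ∀ a b d → a + d ≈ (a + b) + (d - b)
      regroup = solve 3 (λ a b d → a :+ d := (a :+ b) :+ (d :- b)) refl

    distinct-roots : ∀ {a} b d → b ≢ d → a + φ b ≈ 0# → χ (a + φ d) ≢ c0
    distinct-roots {a} b d b≢d e = χ-≢0 λ e′ → b≢d (≡.sym (φ-injective (x-y≈0⇒x≈y (φ d) (φ b) (trans (sym (difference≈ e)) e′))))

    -- Where one of the three linear factors vanishes, the ratio below of the other two is w up to cubes.
    vertex-value : ∀ {u v} Y → ¬ Y ≈ 0# → u * (v * v) ≈ w * (Y * Y * Y) → ν ⊗ ν ⊗ (χ u ⊗ (χ v ⊗ χ v)) ≡ τ
    vertex-value {u} {v} Y Y≉0 e = ≡.cong (ν ⊗ ν ⊗_) (≡.trans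
      (≡.sym (≡.trans (χ-* u (v * v)) (≡.cong (χ u ⊗_) (χ-* v v)))) (χ-*-cube Y≉0 e))

    vertex₁ : ∀ a → a + 1# ≈ 0# → y a ⊗ (z a ⊗ z a) ≡ τ
    vertex₁ a e = ≡.trans (rearrange₂ a) (vertex-value (w - 1#) w-1≉0
      (trans (*-cong (difference≈ e) (*-cong (difference≈ e) (difference≈ e))) (modulo-1+w+w² _ (identity w))))
      where
      identity : ∀ w → (w - 1#) * ((w * w - 1#) * (w * w - 1#)) ≈
        w * ((w - 1#) * (w - 1#) * (w - 1#)) + (1# + w + w * w) * ((w - 1#) * (w - 1#) * (w - 1#))
      identity = solve 1 (λ w → (w :- con 1ℤ) :* ((w :* w :- con 1ℤ) :* (w :* w :- con 1ℤ)) :=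
        w :* ((w :- con 1ℤ) :* (w :- con 1ℤ) :* (w :- con 1ℤ)) :+ (con 1ℤ :+ w :+ w :* w) :* ((w :- con 1ℤ) :* (w :- con 1ℤ) :* (w :- con 1ℤ))) refl

    vertex₂ : ∀ a → a + w ≈ 0# → z a ⊗ (x a ⊗ x a) ≡ τ
    vertex₂ a e = ≡.trans (rearrange₃ a) (vertex-value (w - 1#) w-1≉0
      (trans (*-cong (difference≈ e) (*-cong (difference≈ e) (difference≈ e))) (identity w)))
      where
      identity : ∀ w → (w * w - w) * ((1# - w) * (1# - w)) ≈ w * ((w - 1#) * (w - 1#) * (w - 1#))
      identity = solve 1 (λ w → (w :* w :- w) :* ((con 1ℤ :- w) :* (con 1ℤ :- w)) := w :* ((w :- con 1ℤ) :* (w :- con 1ℤ) :* (w :- con 1ℤ))) refl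

    vertex₃ : ∀ a → a + w * w ≈ 0# → x a ⊗ (y a ⊗ y a) ≡ τ
    vertex₃ a e = ≡.trans (rearrange₁ a) (vertex-value (w * (w - 1#)) (*-≉0 w≉0 w-1≉0)
      (trans (*-cong (difference≈ e) (*-cong (difference≈ e) (difference≈ e))) (modulo-1+w+w² _ (identity w))))
      where
      identity : ∀ w → (1# - w * w) * ((w - w * w) * (w - w * w)) ≈
        w * (w * (w - 1#) * (w * (w - 1#)) * (w * (w - 1#))) + (1# + w + w * w) * (- (w * w * ((w - 1#) * (w - 1#) * (w - 1#))))
      identity = solve 1 (λ w → (con 1ℤ :- w :* w) :* ((w :- w :* w) :* (w :- w :* w)) :=
        w :* (w :* (w :- con 1ℤ) :* (w :* (w :- con 1ℤ)) :* (w :* (w :- con 1ℤ))) :+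
        (con 1ℤ :+ w :+ w :* w) :* (:- (w :* w :* ((w :- con 1ℤ) :* (w :- con 1ℤ) :* (w :- con 1ℤ))))) refl

    polynomialₐ : Carrier → ℤ[ω]
    polynomialₐ a = polynomial (x a) (y a) (z a)

    -- The polynomial agrees with the indicator where no value vanishes. At each root of a linear
    -- factor the other two values are nonzero, the indicator is 0, and the polynomial exceeds it by
    -- `vertex τ`.
    pointwise : ∀ a → nineₐ a E.+ (δ 1# a E.+ (δ w a E.+ δ (w * w) a)) ≡ polynomialₐ a
    pointwise a = cases ((a + 1#) ≈? 0#) ((a + w) ≈? 0#) ((a + w * w) ≈? 0#)
      where
      Goal = nineₐ a E.+ (δ 1# a E.+ (δ w a E.+ δ (w * w) a)) ≡ polynomialₐ a
      assemble : ∀ {n δ₁ δ₂ δ₃ p} → nineₐ a ≡ n → δ 1# a ≡ δ₁ → δ w a ≡ δ₂ → δ (w * w) a ≡ δ₃ →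
        n E.+ (δ₁ E.+ (δ₂ E.+ δ₃)) ≡ p → nineₐ a E.+ (δ 1# a E.+ (δ w a E.+ δ (w * w) a)) ≡ p
      assemble e e₁ e₂ e₃ h = ≡.trans (≡.cong₂ E._+_ e (≡.cong₂ E._+_ e₁ (≡.cong₂ E._+_ e₂ e₃))) h
      vanishes : ∀ {b} → a + φ b ≈ 0# → ∀ d → b ≢ d → ¬ a + φ d ≈ 0#
      vanishes {b} e d b≢d e′ = distinct-roots b d b≢d e (χ[0] e′)
      cases : Dec (a + 1# ≈ 0#) → Dec (a + w ≈ 0#) → Dec (a + w * w ≈ 0#) → Goal
      cases (yes e) _ _ = assemble
        (≡.trans (≡.cong (λ b → nine b (y a) (z a)) x≡0) (nine₁≡0 (y a) (z a)))
        (if-yes e) (if-no (vanishes {c1} e cω λ ())) (if-no (vanishes {c1} e cω² λ ()))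
        (≡.trans (Eℤ.solve 1 (λ v → Eℤ.con 0ℤ Eℤ.:+ (v Eℤ.:+ (Eℤ.con 0ℤ Eℤ.:+ Eℤ.con 0ℤ)) Eℤ.:= v) ≡.refl (vertex τ))
          (≡.sym (≡.trans (≡.cong (λ b → polynomial b (y a) (z a)) x≡0) (≡.trans (polynomial₁ (y a) (z a)) (≡.cong vertex (vertex₁ a e))))))
        where
        x≡0 : x a ≡ c0
        x≡0 = χ[0] e
      cases (no _) (yes e) _ = assemble
        (≡.trans (≡.cong (λ b → nine (x a) b (z a)) y≡0) (nine₂≡0 (x a) (z a)))
        (if-no (vanishes {cω} e c1 λ ())) (if-yes e) (if-no (vanishes {cω} e cω² λ ()))
        (≡.trans (Eℤ.solve 1 (λ v → Eℤ.con 0ℤ Eℤ.:+ (Eℤ.con 0ℤ Eℤ.:+ (v Eℤ.:+ Eℤ.con 0ℤ)) Eℤ.:= v) ≡.refl (vertex τ))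
          (≡.sym (≡.trans (≡.cong (λ b → polynomial (x a) b (z a)) y≡0) (≡.trans (polynomial₂ (x a) (z a)) (≡.cong vertex (vertex₂ a e))))))
        where
        y≡0 : y a ≡ c0
        y≡0 = ≡.trans (≡.cong (ν ⊗_) (χ[0] e)) (⊗-zeroʳ ν)
      cases (no _) (no _) (yes e) = assemble
        (≡.trans (≡.cong (nine (x a) (y a)) z≡0) (nine₃≡0 (x a) (y a)))
        (if-no (vanishes {cω²} e c1 λ ())) (if-no (vanishes {cω²} e cω λ ())) (if-yes e)
        (≡.trans (Eℤ.solve 1 (λ v → Eℤ.con 0ℤ Eℤ.:+ (Eℤ.con 0ℤ Eℤ.:+ (Eℤ.con 0ℤ Eℤ.:+ v)) Eℤ.:= v) ≡.refl (vertex τ))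
          (≡.sym (≡.trans (≡.cong (polynomial (x a) (y a)) z≡0) (≡.trans (polynomial₃ (x a) (y a)) (≡.cong vertex (vertex₃ a e))))))
        where
        z≡0 : z a ≡ c0
        z≡0 = ≡.trans (≡.cong (ν ⊗ ν ⊗_) (χ[0] e)) (⊗-zeroʳ (ν ⊗ ν))
      cases (no e₁) (no e₂) (no e₃) = assemble
        (nine≡polynomial (x a) (y a) (z a) (χ-≢0 e₁ , ⊗-≢0 ν≢0 (χ-≢0 e₂) , ⊗-≢0 (⊗-≢0 ν≢0 ν≢0) (χ-≢0 e₃)))
        (if-no e₁) (if-no e₂) (if-no e₃)
        (E.+-identityʳ (polynomialₐ a))

    -- As a runs over the field without -t, the ratio (a + r) / (a + t) = 1 + (r - t) / (a + t)
    -- takes every value except 1, so the sum is 0 - χ(1).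
    ∑-ratio : ∀ {r t} → ¬ r - t ≈ 0# → ∑ (λ a → ⟦ χ (a + r) ⊗ (χ (a + t) ⊗ χ (a + t)) ⟧) ≡ E.- E.1#
    ∑-ratio {r} {t} r-t≉0 = begin
      ∑ (λ a → ⟦ χ (a + r) ⊗ (χ (a + t) ⊗ χ (a + t)) ⟧)
        ≡⟨ ∑-cong (λ a → ≡.cong (λ b → ⟦ b ⊗ (χ (a + t) ⊗ χ (a + t)) ⟧) (χ-cong (recenter a r t))) ⟩
      ∑ (λ a → f (a + t))                    ≡⟨ ∑-shift f-cong t ⟩
      ∑ f                                    ≡⟨ Eℤ.solve 1 (λ s → s Eℤ.:= (s Eℤ.:+ Eℤ.con 1ℤ) Eℤ.:+ Eℤ.con ℤ.-1ℤ) ≡.refl (∑ f) ⟩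
      (∑ f E.+ E.1#) E.+ (E.- E.1#)          ≡⟨ ≡.cong (λ b → (∑ f E.+ ⟦ b ⟧) E.+ (E.- E.1#)) χ[1] ⟨
      (∑ f E.+ X 1#) E.+ (E.- E.1#)          ≡⟨ ≡.cong (E._+ (E.- E.1#)) (≡.trans (∑-X-ratio 1# (r - t)) (∑-X-affine r-t≉0 1#)) ⟩
      E.0# E.+ (E.- E.1#)                    ≡⟨ E.+-identityˡ (E.- E.1#) ⟩
      E.- E.1#                               ∎
      where
      f : Carrier → ℤ[ω]
      f z = ⟦ χ (1# * z + (r - t)) ⊗ (χ z ⊗ χ z) ⟧
      f-cong : Congruent f
      f-cong e = ≡.cong ⟦_⟧ (≡.cong₂ (λ a b → a ⊗ (b ⊗ b)) (χ-cong (+-congʳ (*-congˡ e))) (χ-cong e))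
      recenter : ∀ a r t → a + r ≈ 1# * (a + t) + (r - t)
      recenter = solve 3 (λ a r t → a :+ r := con 1ℤ :* (a :+ t) :+ (r :- t)) refl

    ∑-twisted-ratio : ∀ b d → b ≢ d → ∑ (λ a → ⟦ ν ⊗ ν ⊗ (χ (a + φ b) ⊗ (χ (a + φ d) ⊗ χ (a + φ d))) ⟧) ≡ ⟦ ν ⊗ ν ⟧ E.* (E.- E.1#)
    ∑-twisted-ratio b d b≢d = ≡.trans (∑-cong (λ a → ⟦⟧-⊗ (ν ⊗ ν) (χ (a + φ b) ⊗ (χ (a + φ d) ⊗ χ (a + φ d)))))
      (≡.trans (≡.sym (*-distribˡ-∑ ⟦ ν ⊗ ν ⟧ (λ a → ⟦ χ (a + φ b) ⊗ (χ (a + φ d) ⊗ χ (a + φ d)) ⟧)))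
        (≡.cong (⟦ ν ⊗ ν ⟧ E.*_) (∑-ratio (λ e → b≢d (φ-injective (x-y≈0⇒x≈y (φ b) (φ d) e))))))

    N₂ U V : ℤ[ω]
    N₂ = ⟦ ν ⊗ ν ⟧ E.* (E.- E.1#)
    U = ∑ (λ a → X (a * a * a + 1#))
    V = ∑ (λ a → cyclic (x a) (y a) (z a))

    V≡ : V ≡ N₂ E.+ (N₂ E.+ N₂)
    V≡ = begin
      V                                     ≡⟨ ∑-+ v₁ (λ a → v₂ a E.+ v₃ a) ⟩
      ∑ v₁ E.+ ∑ (λ a → v₂ a E.+ v₃ a)      ≡⟨ ≡.cong (∑ v₁ E.+_) (∑-+ v₂ v₃) ⟩
      ∑ v₁ E.+ (∑ v₂ E.+ ∑ v₃)              ≡⟨ ≡.cong₂ E._+_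
        (≡.trans (∑-cong (λ a → ≡.cong ⟦_⟧ (rearrange₁ a))) (∑-twisted-ratio c1 cω λ ())) (≡.cong₂ E._+_
        (≡.trans (∑-cong (λ a → ≡.cong ⟦_⟧ (rearrange₂ a))) (∑-twisted-ratio cω cω² λ ()))
        (≡.trans (∑-cong (λ a → ≡.cong ⟦_⟧ (rearrange₃ a))) (∑-twisted-ratio cω² c1 λ ()))) ⟩
      N₂ E.+ (N₂ E.+ N₂)                    ∎
      where
      v₁ v₂ v₃ : Carrier → ℤ[ω]
      v₁ a = ⟦ x a ⊗ (y a ⊗ y a) ⟧
      v₂ a = ⟦ y a ⊗ (z a ⊗ z a) ⟧
      v₃ a = ⟦ z a ⊗ (x a ⊗ x a) ⟧

    ∑-double-trace : ∀ f → ∑ (λ a → double-trace (f a)) ≡ fromℤ (trace (∑ f))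
    ∑-double-trace f = ≡.trans (∑-+ f (conjugate ∘ f)) (≡.trans (≡.cong (∑ f E.+_) (≡.sym (∑-conjugate f))) (Eisenstein.x+conjugate[x] (∑ f)))

    ∑-2 : ∑ (λ _ → fromℤ (+ 2)) ≡ fromℤ (+ q) E.+ fromℤ (+ q)
    ∑-2 = ≡.trans (∑-+ (λ _ → E.1#) (λ _ → E.1#)) (≡.cong₂ E._+_ ∑-1 ∑-1)

    ∑-polynomial : ∑ polynomialₐ ≡ fromℤ (+ q ℤ.+ + q ℤ.+ (trace U ℤ.+ trace U) ℤ.- trace V)
    ∑-polynomial = begin
      ∑ (λ a → p a E.+ (E.- d a))     ≡⟨ ∑-+ p (λ a → E.- d a) ⟩
      ∑ p E.+ ∑ (λ a → E.- d a)       ≡⟨ ≡.cong₂ E._+_ (∑-+ (λ _ → fromℤ (+ 2)) (λ a → t a E.+ t a)) ∑-neg ⟩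
      (∑ (λ _ → fromℤ (+ 2)) E.+ ∑ (λ a → t a E.+ t a)) E.+ (E.- fromℤ (trace V))
        ≡⟨ ≡.cong₂ (λ a b → (a E.+ b) E.+ (E.- fromℤ (trace V))) ∑-2 (≡.trans (∑-+ t t) (≡.cong₂ E._+_ ∑-t ∑-t)) ⟩
      fromℤ (+ q ℤ.+ + q ℤ.+ (trace U ℤ.+ trace U) ℤ.- trace V) ∎
      where
      p d t : Carrier → ℤ[ω]
      t a = double-trace ⟦ x a ⊗ y a ⊗ z a ⟧
      p a = fromℤ (+ 2) E.+ (t a E.+ t a)
      d a = double-trace (cyclic (x a) (y a) (z a))
      ∑-t : ∑ t ≡ fromℤ (trace U)
      ∑-t = ≡.trans (∑-double-trace (λ a → ⟦ x a ⊗ y a ⊗ z a ⟧)) (≡.cong (fromℤ ∘ trace) (∑-cong (λ a → ≡.cong ⟦_⟧ (product a))))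
      neg : ∀ v → E.- v ≡ fromℤ ℤ.-1ℤ E.* v
      neg = Eℤ.solve 1 (λ v → Eℤ.:- v Eℤ.:= Eℤ.con ℤ.-1ℤ Eℤ.:* v) ≡.refl
      ∑-neg : ∑ (λ a → E.- d a) ≡ E.- fromℤ (trace V)
      ∑-neg = ≡.trans (∑-cong (λ a → neg (d a))) (≡.trans (≡.sym (*-distribˡ-∑ (fromℤ ℤ.-1ℤ) d))
        (≡.trans (≡.sym (neg (∑ d))) (≡.cong E.-_ (∑-double-trace (λ a → cyclic (x a) (y a) (z a))))))

    total : ∑ nineₐ E.+ (vertex τ E.+ (vertex τ E.+ vertex τ)) ≡ ∑ polynomialₐ
    total = begin
      ∑ nineₐ E.+ (vertex τ E.+ (vertex τ E.+ vertex τ))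
        ≡⟨ ≡.cong (∑ nineₐ E.+_) (≡.cong₂ E._+_ (∑-δ-shift 1# (vertex τ)) (≡.cong₂ E._+_ (∑-δ-shift w (vertex τ)) (∑-δ-shift (w * w) (vertex τ)))) ⟨
      ∑ nineₐ E.+ (∑ (δ 1#) E.+ (∑ (δ w) E.+ ∑ (δ (w * w))))
        ≡⟨ ≡.cong (λ b → ∑ nineₐ E.+ (∑ (δ 1#) E.+ b)) (∑-+ (δ w) (δ (w * w))) ⟨
      ∑ nineₐ E.+ (∑ (δ 1#) E.+ ∑ (λ a → δ w a E.+ δ (w * w) a))
        ≡⟨ ≡.cong (∑ nineₐ E.+_) (∑-+ (δ 1#) (λ a → δ w a E.+ δ (w * w) a)) ⟨
      ∑ nineₐ E.+ ∑ (λ a → δ 1# a E.+ (δ w a E.+ δ (w * w) a))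
        ≡⟨ ∑-+ nineₐ (λ a → δ 1# a E.+ (δ w a E.+ δ (w * w) a)) ⟨
      ∑ (λ a → nineₐ a E.+ (δ 1# a E.+ (δ w a E.+ δ (w * w) a)))
        ≡⟨ ∑-cong pointwise ⟩
      ∑ polynomialₐ ∎

    trace[U]+2 : trace U ℤ.+ + 2 ≡ trace J
    trace[U]+2 = ≡.trans (≡.sym (Eisenstein.trace-+ U E.1#)) (≡.cong trace ∑-X[a³+1])

    trace-neg : ∀ x → trace (x E.* (E.- E.1#)) ≡ ℤ.- trace x
    trace-neg (a +ω b) = lemma a b
      where
      lemma : ∀ a b → let a′ = a ℤ.* ℤ.-1ℤ ℤ.- b ℤ.* 0ℤ in
        a′ ℤ.+ a′ ℤ.- (a ℤ.* 0ℤ ℤ.+ b ℤ.* ℤ.-1ℤ ℤ.- b ℤ.* 0ℤ) ≡ ℤ.- (a ℤ.+ a ℤ.- b)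
      lemma = ℤ-solve

    trace[V] : trace V ≡ ℤ.- trace ⟦ ν ⊗ ν ⟧ ℤ.+ (ℤ.- trace ⟦ ν ⊗ ν ⟧ ℤ.+ ℤ.- trace ⟦ ν ⊗ ν ⟧)
    trace[V] = ≡.trans (≡.cong trace V≡) (≡.trans (Eisenstein.trace-+ N₂ (N₂ E.+ N₂)) (≡.cong₂ ℤ._+_ t≡
      (≡.trans (Eisenstein.trace-+ N₂ N₂) (≡.cong₂ ℤ._+_ t≡ t≡))))
      where
      t≡ : trace N₂ ≡ ℤ.- trace ⟦ ν ⊗ ν ⟧
      t≡ = trace-neg ⟦ ν ⊗ ν ⟧

  -- The constant -10 consists of -6, from three vertices of value 2 - trace τ, and of -4, from
  -- replacing twice the trace of `U` by that of `J = U + 1`.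
  9*permutationCount : + 9 ℤ.* + permutationCount ≡
    + 2 ℤ.* + q ℤ.+ + 3 ℤ.* (trace ⟦ τ ⟧ ℤ.+ trace ⟦ ν ⊗ ν ⟧) ℤ.- + 10 ℤ.+ + 2 ℤ.* trace J
  9*permutationCount = begin
    9N                                 ≡⟨ isolate 9N (trace ⟦ τ ⟧) ⟩
    (9N ℤ.+ (v ℤ.+ (v ℤ.+ v))) ℤ.- + 3 ℤ.* v   ≡⟨ ≡.cong (ℤ._- + 3 ℤ.* v) sum≡ ⟩
    (+ q ℤ.+ + q ℤ.+ (trace U ℤ.+ trace U) ℤ.- trace V) ℤ.- + 3 ℤ.* v
      ≡⟨ ≡.cong (λ t → (+ q ℤ.+ + q ℤ.+ (trace U ℤ.+ trace U) ℤ.- t) ℤ.- + 3 ℤ.* v) trace[V] ⟩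
    (+ q ℤ.+ + q ℤ.+ (trace U ℤ.+ trace U) ℤ.- (ℤ.- n₂ ℤ.+ (ℤ.- n₂ ℤ.+ ℤ.- n₂))) ℤ.- + 3 ℤ.* v
      ≡⟨ collect (+ q) (trace U) n₂ (trace ⟦ τ ⟧) ⟩
    + 2 ℤ.* + q ℤ.+ + 3 ℤ.* (trace ⟦ τ ⟧ ℤ.+ n₂) ℤ.- + 10 ℤ.+ + 2 ℤ.* (trace U ℤ.+ + 2)
      ≡⟨ ≡.cong (λ t → + 2 ℤ.* + q ℤ.+ + 3 ℤ.* (trace ⟦ τ ⟧ ℤ.+ n₂) ℤ.- + 10 ℤ.+ + 2 ℤ.* t) trace[U]+2 ⟩
    + 2 ℤ.* + q ℤ.+ + 3 ℤ.* (trace ⟦ τ ⟧ ℤ.+ n₂) ℤ.- + 10 ℤ.+ + 2 ℤ.* trace J ∎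
    where
    9N = + 9 ℤ.* + permutationCount
    v = + 2 ℤ.- trace ⟦ τ ⟧
    n₂ = trace ⟦ ν ⊗ ν ⟧
    isolate : ∀ m t → m ≡ (m ℤ.+ ((+ 2 ℤ.- t) ℤ.+ ((+ 2 ℤ.- t) ℤ.+ (+ 2 ℤ.- t)))) ℤ.- + 3 ℤ.* (+ 2 ℤ.- t)
    isolate = ℤ-solve
    collect : ∀ q u n t → (q ℤ.+ q ℤ.+ (u ℤ.+ u) ℤ.- (ℤ.- n ℤ.+ (ℤ.- n ℤ.+ ℤ.- n))) ℤ.- + 3 ℤ.* (+ 2 ℤ.- t)
      ≡ + 2 ℤ.* q ℤ.+ + 3 ℤ.* (t ℤ.+ n) ℤ.- + 10 ℤ.+ + 2 ℤ.* (u ℤ.+ + 2)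
    collect = ℤ-solve
    vertex≡ : vertex τ ≡ fromℤ v
    vertex≡ = ≡.cong (λ t → fromℤ (+ 2) E.- t) (Eisenstein.x+conjugate[x] ⟦ τ ⟧)
    sum≡ : 9N ℤ.+ (v ℤ.+ (v ℤ.+ v)) ≡ + q ℤ.+ + q ℤ.+ (trace U ℤ.+ trace U) ℤ.- trace V
    sum≡ = ≡.cong ℤ[ω].constant (begin
      fromℤ 9N E.+ (fromℤ v E.+ (fromℤ v E.+ fromℤ v))
        ≡⟨ ≡.cong₂ (λ a b → a E.+ (b E.+ (b E.+ b))) count-∑ (≡.sym vertex≡) ⟩
      ∑ nineₐ E.+ (vertex τ E.+ (vertex τ E.+ vertex τ))
        ≡⟨ ≡.trans total ∑-polynomial ⟩
      fromℤ (+ q ℤ.+ + q ℤ.+ (trace U ℤ.+ trace U) ℤ.- trace V) ∎)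

-- Powers of primes in ℤ[ω]

module EisensteinArithmetic where

  open Eisenstein
  open CommutativeRing commutativeRing using (semiring; *-assoc; *-comm; *-identityʳ)
  private
    module Eℤ = IntegersIn commutativeRing
  open Exp semiring using (_^_)
  open ≡.≡-Reasoning

  euclidsLemmaℤ : ∀ {p} → Prime p → ∀ x y → + p ℤ∣.∣ x ℤ.* y → + p ℤ∣.∣ x ⊎ + p ℤ∣.∣ y
  euclidsLemmaℤ {p} p-prime x y p∣xy with euclidsLemma ℤ.∣ x ∣ ℤ.∣ y ∣ p-prime
    (≡.subst (p ℕ∣.∣_) (ℤₚ.∣i*j∣≡∣i∣*∣j∣ x y) (ℤ∣.∣⇒∣ᵤ p∣xy))
  ... | inj₁ p∣x = inj₁ (ℤ∣.∣ᵤ⇒∣ p∣x)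
  ... | inj₂ p∣y = inj₂ (ℤ∣.∣ᵤ⇒∣ p∣y)

  -- The Lucas sequence: V P Q k = a^k + b^k for the roots a, b of x² - P x + Q.
  V : ℤ → ℤ → ℕ → ℤ
  V P Q zero          = + 2
  V P Q (suc zero)    = P
  V P Q (suc (suc k)) = P ℤ.* V P Q (suc k) ℤ.- Q ℤ.* V P Q k

  trace-^ : ∀ π k → trace (π ^ k) ≡ V (trace π) (norm π) k
  trace-^ π zero          = ≡.refl
  trace-^ π (suc zero)    = ≡.cong trace (*-identityʳ π)
  trace-^ π (suc (suc k)) = ≡.trans (recurrence π (π ^ k))
    (≡.cong₂ (λ t u → trace π ℤ.* t ℤ.- norm π ℤ.* u) (trace-^ π (suc k)) (trace-^ π k))
    where
    recurrence : ∀ x y → trace (x * (x * y)) ≡ trace x ℤ.* trace (x * y) ℤ.- norm x ℤ.* trace y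
    recurrence (a +ω b) (c +ω d) = lemma a b c d
      where
      lemma : ∀ a b c d → let e = a ℤ.* c ℤ.- b ℤ.* d
                              f = a ℤ.* d ℤ.+ b ℤ.* c ℤ.- b ℤ.* d
                              g = a ℤ.* e ℤ.- b ℤ.* f
                              h = a ℤ.* f ℤ.+ b ℤ.* e ℤ.- b ℤ.* f in
        g ℤ.+ g ℤ.- h ≡ (a ℤ.+ a ℤ.- b) ℤ.* (e ℤ.+ e ℤ.- f) ℤ.- (a ℤ.* a ℤ.- a ℤ.* b ℤ.+ b ℤ.* b) ℤ.* (c ℤ.+ c ℤ.- d)
      lemma = ℤ-solve

  trace-conjugate : ∀ x → trace (conjugate x) ≡ trace x
  trace-conjugate (a +ω b) = lemma a b
    where
    lemma : ∀ a b → (a ℤ.- b) ℤ.+ (a ℤ.- b) ℤ.- (ℤ.- b) ≡ a ℤ.+ a ℤ.- b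
    lemma = ℤ-solve

  norm-conjugate : ∀ x → norm (conjugate x) ≡ norm x
  norm-conjugate (a +ω b) = lemma a b
    where
    lemma : ∀ a b → (a ℤ.- b) ℤ.* (a ℤ.- b) ℤ.- (a ℤ.- b) ℤ.* (ℤ.- b) ℤ.+ (ℤ.- b) ℤ.* (ℤ.- b) ≡ a ℤ.* a ℤ.- a ℤ.* b ℤ.+ b ℤ.* b
    lemma = ℤ-solve

  fromℤ-* : ∀ n x → fromℤ n * x ≡ (n ℤ.* ℤ[ω].constant x) +ω (n ℤ.* ℤ[ω].ω-coefficient x)
  fromℤ-* n (a +ω b) = ≡.cong₂ _+ω_ (re n a b) (im n a b)
    where
    re : ∀ n a b → n ℤ.* a ℤ.- 0ℤ ℤ.* b ≡ n ℤ.* a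
    re = ℤ-solve
    im : ∀ n a b → n ℤ.* b ℤ.+ 0ℤ ℤ.* a ℤ.- 0ℤ ℤ.* b ≡ n ℤ.* b
    im = ℤ-solve

  fromℤ-cancel : ∀ n .{{_ : ℤ.NonZero n}} {x y} → fromℤ n * x ≡ fromℤ n * y → x ≡ y
  fromℤ-cancel n {x} {y} e = ≡.cong₂ _+ω_
    (ℤₚ.*-cancelˡ-≡ n _ _ (≡.cong ℤ[ω].constant e′)) (ℤₚ.*-cancelˡ-≡ n _ _ (≡.cong ℤ[ω].ω-coefficient e′))
    where
    e′ = ≡.trans (≡.sym (fromℤ-* n x)) (≡.trans e (fromℤ-* n y))

  norm-fromℤ : ∀ n → norm (fromℤ n) ≡ n ℤ.* n
  norm-fromℤ n = lemma n
    where
    lemma : ∀ n → n ℤ.* n ℤ.- n ℤ.* 0ℤ ℤ.+ 0ℤ ℤ.* 0ℤ ≡ n ℤ.* n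
    lemma = ℤ-solve

  trace-fromℤ-* : ∀ n x → trace (fromℤ n * x) ≡ n ℤ.* trace x
  trace-fromℤ-* n (a +ω b) = lemma n a b
    where
    lemma : ∀ n a b → (n ℤ.* a ℤ.- 0ℤ ℤ.* b) ℤ.+ (n ℤ.* a ℤ.- 0ℤ ℤ.* b) ℤ.- (n ℤ.* b ℤ.+ 0ℤ ℤ.* a ℤ.- 0ℤ ℤ.* b) ≡ n ℤ.* (a ℤ.+ a ℤ.- b)
    lemma = ℤ-solve

  -- Among the six units of ℤ[ω] only 1 satisfies this, so the condition turns equality up to units
  -- into equality.
  ≡1[mod3] : ℤ[ω] → Set
  ≡1[mod3] x = ∃ λ y → x ≡ 1# + fromℤ (+ 3) * y

  Divides : ℕ → ℤ[ω] → Set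
  Divides p x = ∃ λ y → x ≡ fromℤ (+ p) * y

  conjugate-≡1[mod3] : ∀ {x} → ≡1[mod3] x → ≡1[mod3] (conjugate x)
  conjugate-≡1[mod3] (y , ≡.refl) = conjugate y , ≡.trans (conjugate-+ 1# (fromℤ (+ 3) * y)) (≡.cong (λ z → 1# + z) (conjugate-* (fromℤ (+ 3)) y))

  quotient-≡1[mod3] : ∀ {α γ ρ} → α ≡ ρ * γ → ≡1[mod3] α → ≡1[mod3] ρ → ≡1[mod3] γ
  quotient-≡1[mod3] {α} {γ} {ρ} α≡ργ (a , α≡) (r , ρ≡) = a + (- (r * γ)) , (begin
    γ                                                 ≡⟨ expand γ r ⟩
    (1# + fromℤ (+ 3) * r) * γ + (- (fromℤ (+ 3) * (r * γ)))  ≡⟨ ≡.cong (λ x → x * γ + (- (fromℤ (+ 3) * (r * γ)))) ρ≡ ⟨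
    ρ * γ + (- (fromℤ (+ 3) * (r * γ)))            ≡⟨ ≡.cong (λ z → z + (- (fromℤ (+ 3) * (r * γ)))) (≡.trans (≡.sym α≡ργ) α≡) ⟩
    1# + fromℤ (+ 3) * a + (- (fromℤ (+ 3) * (r * γ)))  ≡⟨ collect a r γ ⟩
    1# + fromℤ (+ 3) * (a + (- (r * γ)))           ∎)
    where
    expand : ∀ γ r → γ ≡ (1# + fromℤ (+ 3) * r) * γ + (- (fromℤ (+ 3) * (r * γ)))
    expand γ r = Eℤ.solve 3 (λ t γ r → γ Eℤ.:= (Eℤ.con 1ℤ Eℤ.:+ t Eℤ.:* r) Eℤ.:* γ Eℤ.:+ (Eℤ.:- (t Eℤ.:* (r Eℤ.:* γ)))) ≡.refl (fromℤ (+ 3)) γ r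
    collect : ∀ a r γ → 1# + fromℤ (+ 3) * a + (- (fromℤ (+ 3) * (r * γ))) ≡ 1# + fromℤ (+ 3) * (a + (- (r * γ)))
    collect a r γ = Eℤ.solve 4 (λ t a r γ → Eℤ.con 1ℤ Eℤ.:+ t Eℤ.:* a Eℤ.:+ (Eℤ.:- (t Eℤ.:* (r Eℤ.:* γ)))
      Eℤ.:= Eℤ.con 1ℤ Eℤ.:+ t Eℤ.:* (a Eℤ.:+ (Eℤ.:- (r Eℤ.:* γ)))) ≡.refl (fromℤ (+ 3)) a r γ

  i*i≡+∣i∣*∣i∣ : ∀ i → i ℤ.* i ≡ + (ℤ.∣ i ∣ ℕ.* ℤ.∣ i ∣)
  i*i≡+∣i∣*∣i∣ (+ n)      = ≡.sym (ℤₚ.pos-* n n)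
  i*i≡+∣i∣*∣i∣ (-[1+ n ]) = ≡.refl

  i*i≡0⇒i≡0 : ∀ i → i ℤ.* i ≡ 0ℤ → i ≡ 0ℤ
  i*i≡0⇒i≡0 i e with ℤₚ.i*j≡0⇒i≡0∨j≡0 i e
  ... | inj₁ i≡0 = i≡0
  ... | inj₂ i≡0 = i≡0

  -- Four times the norm of 1 + 3 (u + v ω) is t² + 27 v² with t = 2 + 6u - 3v. For norm 1 this is
  -- 4, so v = 0, and then 3u (3u + 2) = 0 leaves only u = 0.
  norm≡1∧≡1[mod3]⇒≡1 : ∀ {x} → norm x ≡ 1ℤ → ≡1[mod3] x → x ≡ 1#
  norm≡1∧≡1[mod3]⇒≡1 norm≡1 (u +ω v , ≡.refl) = x≡1
    where
    four-norm : ∀ u v → let a = 1ℤ ℤ.+ (+ 3 ℤ.* u ℤ.- 0ℤ ℤ.* v)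
                            b = 0ℤ ℤ.+ (+ 3 ℤ.* v ℤ.+ 0ℤ ℤ.* u ℤ.- 0ℤ ℤ.* v) in
      + 4 ℤ.* (a ℤ.* a ℤ.- a ℤ.* b ℤ.+ b ℤ.* b) ≡
      (+ 2 ℤ.+ + 6 ℤ.* u ℤ.- + 3 ℤ.* v) ℤ.* (+ 2 ℤ.+ + 6 ℤ.* u ℤ.- + 3 ℤ.* v) ℤ.+ + 27 ℤ.* (v ℤ.* v)
    four-norm = ℤ-solve
    t : ℤ
    t = + 2 ℤ.+ + 6 ℤ.* u ℤ.- + 3 ℤ.* v
    squares : ℤ.∣ t ∣ ℕ.* ℤ.∣ t ∣ ℕ.+ 27 ℕ.* (ℤ.∣ v ∣ ℕ.* ℤ.∣ v ∣) ≡ 4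
    squares = ℤₚ.+-injective (begin
      + (ℤ.∣ t ∣ ℕ.* ℤ.∣ t ∣) ℤ.+ + (27 ℕ.* (ℤ.∣ v ∣ ℕ.* ℤ.∣ v ∣))   ≡⟨ ≡.cong (λ z → + (ℤ.∣ t ∣ ℕ.* ℤ.∣ t ∣) ℤ.+ z) (ℤₚ.pos-* 27 (ℤ.∣ v ∣ ℕ.* ℤ.∣ v ∣)) ⟩
      + (ℤ.∣ t ∣ ℕ.* ℤ.∣ t ∣) ℤ.+ + 27 ℤ.* + (ℤ.∣ v ∣ ℕ.* ℤ.∣ v ∣)   ≡⟨ ≡.cong₂ (λ a b → a ℤ.+ + 27 ℤ.* b) (i*i≡+∣i∣*∣i∣ t) (i*i≡+∣i∣*∣i∣ v) ⟨
      t ℤ.* t ℤ.+ + 27 ℤ.* (v ℤ.* v)                                 ≡⟨ four-norm u v ⟨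
      + 4 ℤ.* norm (1# + fromℤ (+ 3) * (u +ω v))                  ≡⟨ ≡.cong (λ z → + 4 ℤ.* z) norm≡1 ⟩
      + 4                                                            ∎)
    ∣v∣²≡0 : ∀ m → ℤ.∣ t ∣ ℕ.* ℤ.∣ t ∣ ℕ.+ 27 ℕ.* m ≡ 4 → m ≡ 0
    ∣v∣²≡0 zero    e = ≡.refl
    ∣v∣²≡0 (suc m) e = contradiction (ℕₚ.≤-trans (ℕₚ.m≤m*n 27 (suc m)) (ℕₚ.≤-trans (ℕₚ.m≤n+m (27 ℕ.* suc m) (ℤ.∣ t ∣ ℕ.* ℤ.∣ t ∣)) (ℕₚ.≤-reflexive e)))
      (ℕₚ.<⇒≱ (from-yes (5 ℕₚ.≤? 27)))
    v≡0 : v ≡ 0ℤ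
    v≡0 = i*i≡0⇒i≡0 v (≡.trans (i*i≡+∣i∣*∣i∣ v) (≡.cong +_ (∣v∣²≡0 _ squares)))
    factored : ∀ u → let a = 1ℤ ℤ.+ (+ 3 ℤ.* u ℤ.- 0ℤ ℤ.* 0ℤ)
                         b = 0ℤ ℤ.+ (+ 3 ℤ.* 0ℤ ℤ.+ 0ℤ ℤ.* u ℤ.- 0ℤ ℤ.* 0ℤ) in
      + 3 ℤ.* (u ℤ.* (u ℤ.* + 3 ℤ.+ + 2)) ≡ (a ℤ.* a ℤ.- a ℤ.* b ℤ.+ b ℤ.* b) ℤ.- 1ℤ
    factored = ℤ-solve
    3u[3u+2]≡0 : + 3 ℤ.* (u ℤ.* (u ℤ.* + 3 ℤ.+ + 2)) ≡ 0ℤ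
    3u[3u+2]≡0 = ≡.trans (factored u) (ℤₚ.i≡j⇒i-j≡0 (≡.subst (λ v → norm (1# + fromℤ (+ 3) * (u +ω v)) ≡ 1ℤ) v≡0 norm≡1))
    u≡0 : u ≡ 0ℤ
    u≡0 = [ (λ ()) , (λ e → [ id , (λ 3u+2≡0 → contradiction (ℤ∣.∣⇒∣ᵤ (divides (ℤ.- u) (2≡ u 3u+2≡0))) (from-no (3 ℕ∣.∣? 2))) ]′
        (ℤₚ.i*j≡0⇒i≡0∨j≡0 u e)) ]′ (ℤₚ.i*j≡0⇒i≡0∨j≡0 (+ 3) 3u[3u+2]≡0)
      where
      2≡ : ∀ u → u ℤ.* + 3 ℤ.+ + 2 ≡ 0ℤ → + 2 ≡ ℤ.- u ℤ.* + 3
      2≡ u e = ≡.trans (rearrange u) (≡.trans (≡.cong (λ z → z ℤ.+ ℤ.- u ℤ.* + 3) e) (ℤₚ.+-identityˡ _))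
        where
        rearrange : ∀ u → + 2 ≡ (u ℤ.* + 3 ℤ.+ + 2) ℤ.+ ℤ.- u ℤ.* + 3
        rearrange = ℤ-solve
    x≡1 : 1# + fromℤ (+ 3) * (u +ω v) ≡ 1#
    x≡1 = ≡.cong₂ (λ u v → 1# + fromℤ (+ 3) * (u +ω v)) u≡0 v≡0

  module _ {p} (p-prime : Prime p) where

    private
      instance
        p≢0 : ℤ.NonZero (+ p)
        p≢0 = ℤ.≢-nonZero λ e → ℕ.≢-nonZero⁻¹ p {{prime⇒nonZero p-prime}} (ℤₚ.+-injective e)

    p∣norm∧p∣ω-coefficient⇒p∣ : ∀ x → + p ℤ∣.∣ norm x → + p ℤ∣.∣ ℤ[ω].ω-coefficient x → Divides p x
    p∣norm∧p∣ω-coefficient⇒p∣ (a +ω b) p∣N p∣b = assemble p∣a p∣b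
      where
      square : ∀ a b → (a ℤ.* a ℤ.- a ℤ.* b ℤ.+ b ℤ.* b) ℤ.+ (a ℤ.- b) ℤ.* b ≡ a ℤ.* a
      square = ℤ-solve
      p∣a² : + p ℤ∣.∣ a ℤ.* a
      p∣a² = ≡.subst (+ p ℤ∣.∣_) (square a b) (ℤ∣.∣m∣n⇒∣m+n p∣N (ℤ∣.∣n⇒∣m*n (a ℤ.- b) p∣b))
      p∣a : + p ℤ∣.∣ a
      p∣a = [ id , id ]′ (euclidsLemmaℤ p-prime a a p∣a²)
      assemble : + p ℤ∣.∣ a → + p ℤ∣.∣ b → Divides p (a +ω b)
      assemble (divides u a≡) (divides v b≡) = u +ω v , ≡.trans
        (≡.cong₂ _+ω_ (≡.trans a≡ (ℤₚ.*-comm u (+ p))) (≡.trans b≡ (ℤₚ.*-comm v (+ p)))) (≡.sym (fromℤ-* (+ p) (u +ω v)))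

    -- (b c - a d) (a d + b c - b d) = b² N(π) - d² N(α) for α = a + b ω and π = c + d ω, and the two factors
    -- are the ω-coefficients of α π̄ and α π.
    divides-product : ∀ {α π} → norm π ≡ + p → + p ℤ∣.∣ norm α → Divides p (α * conjugate π) ⊎ Divides p (α * π)
    divides-product {a +ω b} {c +ω d} Nπ≡p p∣Nα with euclidsLemmaℤ p-prime _ _ p∣product
      where
      identity : ∀ a b c d → (a ℤ.* (ℤ.- d) ℤ.+ b ℤ.* (c ℤ.- d) ℤ.- b ℤ.* (ℤ.- d)) ℤ.* (a ℤ.* d ℤ.+ b ℤ.* c ℤ.- b ℤ.* d) ≡
        b ℤ.* b ℤ.* (c ℤ.* c ℤ.- c ℤ.* d ℤ.+ d ℤ.* d) ℤ.+ (ℤ.- (d ℤ.* d)) ℤ.* (a ℤ.* a ℤ.- a ℤ.* b ℤ.+ b ℤ.* b)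
      identity = ℤ-solve
      p∣product : + p ℤ∣.∣ (a ℤ.* (ℤ.- d) ℤ.+ b ℤ.* (c ℤ.- d) ℤ.- b ℤ.* (ℤ.- d)) ℤ.* (a ℤ.* d ℤ.+ b ℤ.* c ℤ.- b ℤ.* d)
      p∣product = ≡.subst (+ p ℤ∣.∣_) (≡.sym (identity a b c d)) (ℤ∣.∣m∣n⇒∣m+n
        (ℤ∣.∣n⇒∣m*n (b ℤ.* b) (divides 1ℤ (≡.trans Nπ≡p (≡.sym (ℤₚ.*-identityˡ (+ p)))))) (ℤ∣.∣n⇒∣m*n (ℤ.- (d ℤ.* d)) p∣Nα))
    ... | inj₁ h = inj₁ (p∣norm∧p∣ω-coefficient⇒p∣ ((a +ω b) * conjugate (c +ω d))
      (≡.subst (+ p ℤ∣.∣_) (≡.sym (norm-* (a +ω b) (conjugate (c +ω d)))) (ℤ∣.∣m⇒∣m*n _ p∣Nα)) h)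
    ... | inj₂ h = inj₂ (p∣norm∧p∣ω-coefficient⇒p∣ ((a +ω b) * (c +ω d))
      (≡.subst (+ p ℤ∣.∣_) (≡.sym (norm-* (a +ω b) (c +ω d))) (ℤ∣.∣m⇒∣m*n _ p∣Nα)) h)

    -- Division by ρ is multiplication by its conjugate followed by division by p.
    cofactor : ∀ {α ρ ρ̄} → ρ * ρ̄ ≡ fromℤ (+ p) → Divides p (α * ρ̄) → ∃ λ γ → α ≡ ρ * γ
    cofactor {α} {ρ} {ρ̄} ρρ̄≡p (γ , αρ̄≡pγ) = γ , fromℤ-cancel (+ p) (begin
      fromℤ (+ p) * α     ≡⟨ ≡.cong (_* α) ρρ̄≡p ⟨
      ρ * ρ̄ * α              ≡⟨ Eℤ.solve 3 (λ a b c → a Eℤ.:* b Eℤ.:* c Eℤ.:= a Eℤ.:* (c Eℤ.:* b)) ≡.refl ρ ρ̄ α ⟩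
      ρ * (α * ρ̄)            ≡⟨ ≡.cong (ρ *_) αρ̄≡pγ ⟩
      ρ * (fromℤ (+ p) * γ) ≡⟨ Eℤ.solve 3 (λ a b c → a Eℤ.:* (b Eℤ.:* c) Eℤ.:= b Eℤ.:* (a Eℤ.:* c)) ≡.refl ρ (fromℤ (+ p)) γ ⟩
      fromℤ (+ p) * (ρ * γ) ∎)

    -- Each step splits off π or its conjugate. Both cannot occur, as their product is p, and the
    -- congruence modulo 3 forces the cofactor left at the end to be 1.
    power-of-prime : ∀ {π} → norm π ≡ + p → ≡1[mod3] π → ∀ k {α} → norm α ≡ + (p ℕ.^ k) → ≡1[mod3] α → ¬ Divides p α →
      α ≡ π ^ k ⊎ α ≡ conjugate π ^ k
    power-of-prime {π} Nπ≡p π≡1 zero    Nα≡ α≡1 p∤α = inj₁ (norm≡1∧≡1[mod3]⇒≡1 Nα≡ α≡1)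
    power-of-prime {π} Nπ≡p π≡1 (suc k) {α} Nα≡ α≡1 p∤α = split (divides-product {α} {π} Nπ≡p p∣Nα)
      where
      p∣Nα : + p ℤ∣.∣ norm α
      p∣Nα = divides (+ (p ℕ.^ k)) (≡.trans Nα≡ (≡.trans (ℤₚ.pos-* p (p ℕ.^ k)) (ℤₚ.*-comm (+ p) (+ (p ℕ.^ k)))))
      ππ̄≡p : π * conjugate π ≡ fromℤ (+ p)
      ππ̄≡p = ≡.trans (x*conjugate[x] π) (≡.cong fromℤ Nπ≡p)
      descend : ∀ {ρ γ} → norm ρ ≡ + p → ≡1[mod3] ρ → α ≡ ρ * γ → γ ≡ π ^ k ⊎ γ ≡ conjugate π ^ k
      descend {ρ} {γ} Nρ≡p ρ≡1 α≡ργ = power-of-prime Nπ≡p π≡1 k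
        (ℤₚ.*-cancelˡ-≡ (+ p) _ _ (begin
          + p ℤ.* norm γ      ≡⟨ ≡.cong (ℤ._* norm γ) Nρ≡p ⟨
          norm ρ ℤ.* norm γ   ≡⟨ norm-* ρ γ ⟨
          norm (ρ * γ)        ≡⟨ ≡.cong norm α≡ργ ⟨
          norm α              ≡⟨ Nα≡ ⟩
          + (p ℕ.^ suc k)     ≡⟨ ℤₚ.pos-* p (p ℕ.^ k) ⟩
          + p ℤ.* + (p ℕ.^ k) ∎))
        (quotient-≡1[mod3] α≡ργ α≡1 ρ≡1)
        (λ (δ , γ≡pδ) → p∤α (ρ * δ , ≡.trans α≡ργ (≡.trans (≡.cong (ρ *_) γ≡pδ)
          (Eℤ.solve 3 (λ a b c → a Eℤ.:* (b Eℤ.:* c) Eℤ.:= b Eℤ.:* (a Eℤ.:* c)) ≡.refl ρ (fromℤ (+ p)) δ))))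
      -- A positive power of the conjugate would meet the factor ρ and produce p; for j = 0 the
      -- cofactor is 1, which is equally a power of ρ.
      mixed : ∀ j {ρ ρ̄ γ} → ρ * ρ̄ ≡ fromℤ (+ p) → α ≡ ρ * γ → γ ≡ ρ̄ ^ j → α ≡ ρ ^ suc j
      mixed zero    {ρ} ρρ̄≡p α≡ργ γ≡ = ≡.trans α≡ργ (≡.cong (ρ *_) γ≡)
      mixed (suc j) {ρ} {ρ̄} ρρ̄≡p α≡ργ γ≡ = contradiction (ρ̄ ^ j , ≡.trans α≡ργ (≡.trans (≡.cong (ρ *_) γ≡)
        (≡.trans (≡.sym (*-assoc ρ ρ̄ (ρ̄ ^ j))) (≡.cong (_* ρ̄ ^ j) ρρ̄≡p)))) p∤α
      extend : ∀ {γ} → α ≡ π * γ → γ ≡ π ^ k ⊎ γ ≡ conjugate π ^ k → α ≡ π ^ suc k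
      extend α≡πγ (inj₁ γ≡) = ≡.trans α≡πγ (≡.cong (π *_) γ≡)
      extend α≡πγ (inj₂ γ≡) = mixed k {π} {conjugate π} ππ̄≡p α≡πγ γ≡
      extend̄ : ∀ {γ} → α ≡ conjugate π * γ → γ ≡ π ^ k ⊎ γ ≡ conjugate π ^ k → α ≡ conjugate π ^ suc k
      extend̄ α≡π̄γ (inj₁ γ≡) = mixed k {conjugate π} {π} (≡.trans (*-comm (conjugate π) π) ππ̄≡p) α≡π̄γ γ≡
      extend̄ α≡π̄γ (inj₂ γ≡) = ≡.trans α≡π̄γ (≡.cong (conjugate π *_) γ≡)
      split : Divides p (α * conjugate π) ⊎ Divides p (α * π) → α ≡ π ^ suc k ⊎ α ≡ conjugate π ^ suc k
      split (inj₁ h) =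
        let (γ , α≡πγ) = cofactor {α} {π} {conjugate π} ππ̄≡p h in
        inj₁ (extend α≡πγ (descend {π} Nπ≡p π≡1 α≡πγ))
      split (inj₂ h) =
        let (γ , α≡π̄γ) = cofactor {α} {conjugate π} {π} (≡.trans (*-comm (conjugate π) π) ππ̄≡p) h in
        inj₂ (extend̄ α≡π̄γ (descend {conjugate π} (≡.trans (norm-conjugate π) Nπ≡p) (conjugate-≡1[mod3] π≡1) α≡π̄γ))

    trace-conjugate-^ : ∀ π k → trace (conjugate π ^ k) ≡ V (trace π) (norm π) k
    trace-conjugate-^ π k = ≡.trans (trace-^ (conjugate π) k) (≡.cong₂ (λ t n → V t n k) (trace-conjugate π) (norm-conjugate π))

    trace-split : ∀ {π} → norm π ≡ + p → ≡1[mod3] π → ∀ k {α} → norm α ≡ + (p ℕ.^ k) → ≡1[mod3] α → ¬ Divides p α →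
      trace α ≡ V (trace π) (+ p) k
    trace-split {π} Nπ≡p π≡1 k {α} Nα≡ α≡1 p∤α = ≡.trans (resolve (power-of-prime Nπ≡p π≡1 k Nα≡ α≡1 p∤α)) (≡.cong (λ n → V (trace π) n k) Nπ≡p)
      where
      resolve : α ≡ π ^ k ⊎ α ≡ conjugate π ^ k → trace α ≡ V (trace π) (norm π) k
      resolve (inj₁ e) = ≡.trans (≡.cong trace e) (trace-^ π k)
      resolve (inj₂ e) = ≡.trans (≡.cong trace e) (trace-conjugate-^ π k)

    -- The factor split off is -p rather than p, because -p ≡ 1 modulo 3 preserves the congruence.
    -- On the other side, the recurrence of `V` with P = 0 multiplies by -Q every two steps.
    trace-inert : ∀ {r} → p ≡ 2 ℕ.+ 3 ℕ.* r → (∀ x → + p ℤ∣.∣ norm x → Divides p x) →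
      ∀ m {α} → norm α ≡ + (p ℕ.^ (m ℕ.* 2)) → ≡1[mod3] α → trace α ≡ V 0ℤ (+ p) (m ℕ.* 2)
    trace-inert p≡2 inert zero    Nα≡ α≡1 = ≡.cong trace (norm≡1∧≡1[mod3]⇒≡1 Nα≡ α≡1)
    trace-inert {r} p≡2 inert (suc m) {α} Nα≡ α≡1 = begin
      trace α                              ≡⟨ ≡.cong trace α≡-pγ ⟩
      trace (fromℤ (ℤ.- + p) * γ)       ≡⟨ trace-fromℤ-* (ℤ.- + p) γ ⟩
      ℤ.- + p ℤ.* trace γ                  ≡⟨ ≡.cong (λ z → ℤ.- + p ℤ.* z) (trace-inert {r} p≡2 inert m Nγ≡ γ≡1) ⟩
      ℤ.- + p ℤ.* V 0ℤ (+ p) (m ℕ.* 2)     ≡⟨ recurrence (+ p) (V 0ℤ (+ p) (suc (m ℕ.* 2))) (V 0ℤ (+ p) (m ℕ.* 2)) ⟩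
      V 0ℤ (+ p) (suc m ℕ.* 2)             ∎
      where
      p∣Nα : + p ℤ∣.∣ norm α
      p∣Nα = divides (+ (p ℕ.^ suc (m ℕ.* 2)))
        (≡.trans Nα≡ (≡.trans (ℤₚ.pos-* p (p ℕ.^ suc (m ℕ.* 2))) (ℤₚ.*-comm (+ p) (+ (p ℕ.^ suc (m ℕ.* 2))))))
      δ γ : ℤ[ω]
      δ = proj₁ (inert α p∣Nα)
      γ = - δ
      α≡pδ : α ≡ fromℤ (+ p) * δ
      α≡pδ = proj₂ (inert α p∣Nα)
      recurrence : ∀ p v u → ℤ.- p ℤ.* u ≡ 0ℤ ℤ.* v ℤ.- p ℤ.* u
      recurrence = ℤ-solve
      α≡-pγ : α ≡ fromℤ (ℤ.- + p) * γ
      α≡-pγ = ≡.trans α≡pδ (Eℤ.solve 2 (λ p δ → p Eℤ.:* δ Eℤ.:= (Eℤ.:- p) Eℤ.:* (Eℤ.:- δ)) ≡.refl (fromℤ (+ p)) δ)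
      γ≡1 : ≡1[mod3] γ
      γ≡1 = quotient-≡1[mod3] α≡-pγ α≡1 (fromℤ (ℤ.- (1ℤ ℤ.+ + r)) , ≡.cong fromℤ (begin
        ℤ.- + p                          ≡⟨ ≡.cong (λ n → ℤ.- + n) p≡2 ⟩
        ℤ.- (+ 2 ℤ.+ + (3 ℕ.* r))        ≡⟨ ≡.cong (λ n → ℤ.- (+ 2 ℤ.+ n)) (ℤₚ.pos-* 3 r) ⟩
        ℤ.- (+ 2 ℤ.+ + 3 ℤ.* + r)        ≡⟨ residue (+ r) ⟩
        1ℤ ℤ.+ (+ 3 ℤ.* (ℤ.- (1ℤ ℤ.+ + r)) ℤ.- 0ℤ ℤ.* 0ℤ) ∎))
        where
        residue : ∀ r → ℤ.- (+ 2 ℤ.+ + 3 ℤ.* r) ≡ 1ℤ ℤ.+ (+ 3 ℤ.* (ℤ.- (1ℤ ℤ.+ r)) ℤ.- 0ℤ ℤ.* 0ℤ)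
        residue = ℤ-solve
      Nγ≡ : norm γ ≡ + (p ℕ.^ (m ℕ.* 2))
      Nγ≡ = ℤₚ.*-cancelˡ-≡ (+ p) _ _ (ℤₚ.*-cancelˡ-≡ (+ p) _ _ (begin
        + p ℤ.* (+ p ℤ.* norm γ)                   ≡⟨ signs (+ p) (norm γ) ⟩
        (ℤ.- + p ℤ.* ℤ.- + p) ℤ.* norm γ           ≡⟨ ≡.cong (ℤ._* norm γ) (norm-fromℤ (ℤ.- + p)) ⟨
        norm (fromℤ (ℤ.- + p)) ℤ.* norm γ       ≡⟨ norm-* (fromℤ (ℤ.- + p)) γ ⟨
        norm (fromℤ (ℤ.- + p) * γ)              ≡⟨ ≡.cong norm α≡-pγ ⟨
        norm α                                     ≡⟨ Nα≡ ⟩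
        + (p ℕ.* (p ℕ.* p ℕ.^ (m ℕ.* 2)))          ≡⟨ ≡.trans (ℤₚ.pos-* p _) (≡.cong (λ z → + p ℤ.* z) (ℤₚ.pos-* p _)) ⟩
        + p ℤ.* (+ p ℤ.* + (p ℕ.^ (m ℕ.* 2)))      ∎))
        where
        signs : ∀ p n → p ℤ.* (p ℤ.* n) ≡ (ℤ.- p ℤ.* ℤ.- p) ℤ.* n
        signs = ℤ-solve

-- The field ℤ/p

module IntegersModulo {p} (p-prime : Prime p) where

  private
    instance
      p≢0 : NonZero p
      p≢0 = prime⇒nonZero p-prime

  infix 4 _≈ₚ_

  -- The carrier remains ℤ with congruence as equality, so the ring laws are those of ℤ and
  -- divisibility by p reads as vanishing.
  _≈ₚ_ : ℤ → ℤ → Set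
  x ≈ₚ y = + p ℤ∣.∣ x ℤ.- y

  private
    reflexive : ∀ {x y} → x ≡ y → x ≈ₚ y
    reflexive {x} ≡.refl = ≡.subst (+ p ℤ∣.∣_) (≡.sym (ℤₚ.+-inverseʳ x)) (divides 0ℤ ≡.refl)

    ≈ₚ-trans : ∀ {x y z} → x ≈ₚ y → y ≈ₚ z → x ≈ₚ z
    ≈ₚ-trans {x} {y} {z} e e′ = ≡.subst (+ p ℤ∣.∣_) (lemma x y z) (ℤ∣.∣m∣n⇒∣m+n e e′)
      where
      lemma : ∀ x y z → (x ℤ.- y) ℤ.+ (y ℤ.- z) ≡ x ℤ.- z
      lemma = ℤ-solve

    neg-difference : ∀ x y → ℤ.-1ℤ ℤ.* (x ℤ.- y) ≡ y ℤ.- x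
    neg-difference = ℤ-solve

    ≈ₚ-sym : ∀ {x y} → x ≈ₚ y → y ≈ₚ x
    ≈ₚ-sym {x} {y} e = ≡.subst (+ p ℤ∣.∣_) (neg-difference x y) (ℤ∣.∣n⇒∣m*n ℤ.-1ℤ e)

    +-cong : ∀ {x y u v} → x ≈ₚ y → u ≈ₚ v → x ℤ.+ u ≈ₚ y ℤ.+ v
    +-cong {x} {y} {u} {v} e e′ = ≡.subst (+ p ℤ∣.∣_) (lemma x y u v) (ℤ∣.∣m∣n⇒∣m+n e e′)
      where
      lemma : ∀ x y u v → (x ℤ.- y) ℤ.+ (u ℤ.- v) ≡ (x ℤ.+ u) ℤ.- (y ℤ.+ v)
      lemma = ℤ-solve

    *-cong : ∀ {x y u v} → x ≈ₚ y → u ≈ₚ v → x ℤ.* u ≈ₚ y ℤ.* v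
    *-cong {x} {y} {u} {v} e e′ = ≡.subst (+ p ℤ∣.∣_) (lemma x y u v) (ℤ∣.∣m∣n⇒∣m+n (ℤ∣.∣n⇒∣m*n u e) (ℤ∣.∣n⇒∣m*n y e′))
      where
      lemma : ∀ x y u v → u ℤ.* (x ℤ.- y) ℤ.+ y ℤ.* (u ℤ.- v) ≡ x ℤ.* u ℤ.- y ℤ.* v
      lemma = ℤ-solve

    neg-cong : ∀ {x y} → x ≈ₚ y → ℤ.- x ≈ₚ ℤ.- y
    neg-cong {x} {y} e = ≡.subst (+ p ℤ∣.∣_) (lemma x y) (ℤ∣.∣n⇒∣m*n ℤ.-1ℤ e)
      where
      lemma : ∀ x y → ℤ.-1ℤ ℤ.* (x ℤ.- y) ≡ (ℤ.- x) ℤ.- (ℤ.- y)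
      lemma = ℤ-solve

  x≈0⇒p∣x : ∀ {x} → x ≈ₚ 0ℤ → + p ℤ∣.∣ x
  x≈0⇒p∣x {x} = ≡.subst (+ p ℤ∣.∣_) (ℤₚ.+-identityʳ x)

  p∣x⇒x≈0 : ∀ {x} → + p ℤ∣.∣ x → x ≈ₚ 0ℤ
  p∣x⇒x≈0 {x} = ≡.subst (+ p ℤ∣.∣_) (≡.sym (ℤₚ.+-identityʳ x))

  commutativeRing : CommutativeRing 0ℓ 0ℓ
  commutativeRing = record
    { Carrier = ℤ ; _≈_ = _≈ₚ_ ; _+_ = ℤ._+_ ; _*_ = ℤ._*_ ; -_ = ℤ.-_ ; 0# = 0ℤ ; 1# = 1ℤ
    ; isCommutativeRing = record
      { isRing = record
        { +-isAbelianGroup = record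
          { isGroup = record
            { isMonoid = record
              { isSemigroup = record
                { isMagma = record
                  { isEquivalence = record { refl = λ {x} → reflexive {x} ≡.refl ; sym = λ {x} {y} → ≈ₚ-sym {x} {y} ; trans = λ {x} {y} {z} → ≈ₚ-trans {x} {y} {z} }
                  ; ∙-cong = λ {x} {y} {u} {v} → +-cong {x} {y} {u} {v} }
                ; assoc = λ x y z → reflexive (ℤₚ.+-assoc x y z) }
              ; identity = (λ x → reflexive (ℤₚ.+-identityˡ x)) , (λ x → reflexive (ℤₚ.+-identityʳ x)) }
            ; inverse = (λ x → reflexive (ℤₚ.+-inverseˡ x)) , (λ x → reflexive (ℤₚ.+-inverseʳ x))
            ; ⁻¹-cong = λ {x} {y} → neg-cong {x} {y} }
          ; comm = λ x y → reflexive (ℤₚ.+-comm x y) }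
        ; *-cong = λ {x} {y} {u} {v} → *-cong {x} {y} {u} {v}
        ; *-assoc = λ x y z → reflexive (ℤₚ.*-assoc x y z)
        ; *-identity = (λ x → reflexive (ℤₚ.*-identityˡ x)) , (λ x → reflexive (ℤₚ.*-identityʳ x))
        ; distrib = (λ x y z → reflexive (ℤₚ.*-distribˡ-+ x y z)) , (λ x y z → reflexive (ℤₚ.*-distribʳ-+ x y z)) }
      ; *-comm = λ x y → reflexive (ℤₚ.*-comm x y) } }

  private
    1≉0 : ¬ 1ℤ ≈ₚ 0ℤ
    1≉0 e = ℕ.nonTrivial⇒≢1 {{prime⇒nonTrivial p-prime}} (ℕ∣.∣1⇒≡1 (ℤ∣.∣⇒∣ᵤ (x≈0⇒p∣x {1ℤ} e)))

    ℕ-invertible : ∀ m → ¬ p ℕ∣.∣ m → ∃ λ y → + m ℤ.* y ≈ₚ 1ℤ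
    ℕ-invertible m p∤m with coprime-Bézout (prime∤⇒coprime p-prime p∤m)
    ... | Bézout.+- i j eq = ℤ.- + j , divides (ℤ.- + i) (≡.trans (lemma (+ m) (+ j))
      (≡.trans (≡.cong ℤ.-_ (≡.trans (≡.cong (λ z → 1ℤ ℤ.+ z) (≡.sym (ℤₚ.pos-* j m))) (≡.trans (≡.cong +_ eq) (ℤₚ.pos-* i p))))
        (ℤₚ.neg-distribˡ-* (+ i) (+ p))))
      where
      lemma : ∀ m j → m ℤ.* ℤ.- j ℤ.- 1ℤ ≡ ℤ.- (1ℤ ℤ.+ j ℤ.* m)
      lemma = ℤ-solve
    ... | Bézout.-+ i j eq = + j , divides (+ i) (≡.trans
      (≡.cong (ℤ._- 1ℤ) (≡.trans (ℤₚ.*-comm (+ m) (+ j)) (≡.trans (≡.sym (ℤₚ.pos-* j m)) (≡.trans (≡.cong +_ (≡.sym eq)) (≡.cong (λ z → 1ℤ ℤ.+ z) (ℤₚ.pos-* i p))))))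
      (lemma (+ i ℤ.* + p)))
      where
      lemma : ∀ z → (1ℤ ℤ.+ z) ℤ.- 1ℤ ≡ z
      lemma = ℤ-solve

    invertible : ∀ x → ¬ x ≈ₚ 0ℤ → ∃ λ y → x ℤ.* y ≈ₚ 1ℤ
    invertible (+ m) x≉0 = ℕ-invertible m (x≉0 ∘ p∣x⇒x≈0 {+ m} ∘ ℤ∣.∣ᵤ⇒∣)
    invertible (-[1+ m ]) x≉0 =
      let (y , e) = ℕ-invertible (suc m) (x≉0 ∘ p∣x⇒x≈0 { -[1+ m ]} ∘ ℤ∣.∣ᵤ⇒∣) in
      ℤ.- y , ≡.subst (_≈ₚ 1ℤ) (lemma (+ suc m) y) e
      where
      lemma : ∀ m y → m ℤ.* y ≡ (ℤ.- m) ℤ.* (ℤ.- y)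
      lemma = ℤ-solve

    residue-unique : ∀ {r r′} → r ℕ.< p → r′ ℕ.< p → + r ≈ₚ + r′ → r ≡ r′
    residue-unique {r} {r′} r<p r′<p e = ℤₚ.+-injective (ℤₚ.i-j≡0⇒i≡j (+ r) (+ r′) (ℤₚ.∣i∣≡0⇒i≡0 (p∣d∧d<p⇒d≡0 (ℤ∣.∣⇒∣ᵤ e) bound)))
      where
      bound : ℤ.∣ + r ℤ.- + r′ ∣ ℕ.< p
      bound = ℕₚ.≤-<-trans (ℕₚ.≤-trans (ℕₚ.≤-reflexive (≡.cong ℤ.∣_∣ (ℤₚ.[+m]-[+n]≡m⊖n r r′))) (ℤₚ.∣m⊝n∣≤m⊔n r r′)) (ℕₚ.⊔-lub r<p r′<p)

    x%p≈x : ∀ x → + (x %ℕ p) ≈ₚ x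
    x%p≈x x = ≈ₚ-sym {x} {+ (x %ℕ p)} (divides (x /ℕ p) (≡.trans (≡.cong (ℤ._- + (x %ℕ p)) (a≡a%ℕn+[a/ℕn]*n x p)) (lemma (+ (x %ℕ p)) _)))
      where
      lemma : ∀ r z → (r ℤ.+ z) ℤ.- r ≡ z
      lemma = ℤ-solve

    to : ℤ → Fin p
    to x = Fin.fromℕ< (n%ℕd<d x p)

    from : Fin p → ℤ
    from i = + toℕ i

    from-to : ∀ x → from (to x) ≈ₚ x
    from-to x = ≡.subst (λ r → + r ≈ₚ x) (≡.sym (Finₚ.toℕ-fromℕ< (n%ℕd<d x p))) (x%p≈x x)

    from-injective : ∀ {i j} → from i ≈ₚ from j → i ≡ j
    from-injective {i} {j} e = Finₚ.toℕ-injective (residue-unique (Finₚ.toℕ<n i) (Finₚ.toℕ<n j) e)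

    to-unique : ∀ {x i} → x ≈ₚ from i → to x ≡ i
    to-unique {x} {i} e = from-injective (≈ₚ-trans {from (to x)} {x} {from i} (from-to x) e)

  -- It serves twice: for p ≡ 1 modulo 3 its Jacobi sum supplies an element of norm p, and for p ≡ 2
  -- the injectivity of cubing in it shows that p is inert.
  field-ℤ/p : FiniteField 0ℓ 0ℓ p
  field-ℤ/p = record
    { commutativeRing = commutativeRing
    ; 1≉0 = 1≉0
    ; invertible = invertible
    ; enumeration = record
      { to = to
      ; from = from
      ; to-cong = λ {x} {y} e → to-unique {x} {to y} (≈ₚ-trans {x} {y} {from (to y)} e (≈ₚ-sym {from (to y)} {y} (from-to y)))
      ; from-cong = λ e → reflexive (≡.cong from e)
      ; inverse = (λ {i} {x} e → to-unique {x} {i} e) , (λ {x} {i} e → ≡.subst (λ i → from i ≈ₚ x) (≡.sym e) (from-to x))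
      }
    }

module CubesInjective {c ℓ q} (F : FiniteField c ℓ q) (r : ℕ) (q≡2+3r : q ≡ 2 ℕ.+ 3 ℕ.* r) where

  open FiniteField F hiding (zero)
  open FieldTheory F
  open import Relation.Binary.Reasoning.Setoid ≈-setoid

  -- 3 (1 + 2r) = 1 + 2 (q - 1), so the exponent 1 + 2r inverts cubing.
  x≈[x³]^[1+2r] : ∀ x → (x ^ 3) ^ (1 ℕ.+ 2 ℕ.* r) ≈ x
  x≈[x³]^[1+2r] x with x ≈? 0#
  ... | yes x≈0 = trans (*-congʳ (trans (*-congʳ x≈0) (zeroˡ _))) (trans (zeroˡ _) (sym x≈0))
  ... | no x≉0  = begin
    (x ^ 3) ^ (1 ℕ.+ 2 ℕ.* r)        ≈⟨ ^-assocʳ x 3 (1 ℕ.+ 2 ℕ.* r) ⟩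
    x ^ (3 ℕ.* (1 ℕ.+ 2 ℕ.* r))      ≡⟨ ≡.cong (x ^_) (lemma r) ⟩
    x ^ (1 ℕ.+ m ℕ.+ m)              ≈⟨ *-congˡ (^-homo-* x m m) ⟩
    x * (x ^ m * x ^ m)              ≈⟨ *-congˡ (*-cong (x^[q-1]≈1 q≡2+3r x≉0) (x^[q-1]≈1 q≡2+3r x≉0)) ⟩
    x * (1# * 1#)                    ≈⟨ trans (*-congˡ (*-identityˡ 1#)) (*-identityʳ x) ⟩
    x                                ∎
    where
    m = 1 ℕ.+ 3 ℕ.* r
    lemma : ∀ r → 3 ℕ.* (1 ℕ.+ 2 ℕ.* r) ≡ 1 ℕ.+ (1 ℕ.+ 3 ℕ.* r) ℕ.+ (1 ℕ.+ 3 ℕ.* r)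
    lemma = ℕ-solve

  x³≈y³⇒x≈y : ∀ {x y} → x ^ 3 ≈ y ^ 3 → x ≈ y
  x³≈y³⇒x≈y {x} {y} e = trans (sym (x≈[x³]^[1+2r] x)) (trans (^-congˡ (1 ℕ.+ 2 ℕ.* r) e) (x≈[x³]^[1+2r] y))

  -- The norm form divides a³ + b³, so a = - b by injectivity of cubing, and it becomes 3 b².
  norm-form-anisotropic : ¬ 3 × 1# ≈ 0# → ∀ {a b} → a * a - a * b + b * b ≈ 0# → b ≈ 0#
  norm-form-anisotropic 3≉0 {a} {b} N≈0 = [ (λ 3≈0 → contradiction 3≈0 3≉0) , (λ b²≈0 → [ id , id ]′ (x*y≈0⇒x≈0∨y≈0 b²≈0)) ]′
    (x*y≈0⇒x≈0∨y≈0 (begin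
      3 × 1# * (b * b)                            ≈⟨ triple b ⟩
      (- b) * (- b) - (- b) * b + b * b           ≈⟨ +-congʳ (+-cong (*-cong a≈-b a≈-b) (-‿cong (*-congʳ a≈-b))) ⟨
      a * a - a * b + b * b                       ≈⟨ N≈0 ⟩
      0#                                          ∎))
    where
    triple : ∀ b → 3 × 1# * (b * b) ≈ (- b) * (- b) - (- b) * b + b * b
    triple = solve 1 (λ b → (con 1ℤ :+ (con 1ℤ :+ (con 1ℤ :+ con 0ℤ))) :* (b :* b) := (:- b) :* (:- b) :- (:- b) :* b :+ b :* b) refl
    cubes : ∀ a b → a ^ 3 ≈ (a + b) * (a * a - a * b + b * b) + (- b) ^ 3
    cubes = solve 2 (λ a b → a :* (a :* (a :* con 1ℤ)) := (a :+ b) :* (a :* a :- a :* b :+ b :* b) :+ (:- b) :* ((:- b) :* ((:- b) :* con 1ℤ))) refl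
    a≈-b : a ≈ - b
    a≈-b = x³≈y³⇒x≈y (trans (cubes a b) (trans (+-congʳ (trans (*-congˡ N≈0) (zeroʳ _))) (+-identityˡ _)))

p≡2[mod3]⇒inert : ∀ {p r} → Prime p → p ≡ 2 ℕ.+ 3 ℕ.* r → ∀ x → + p ℤ∣.∣ Eisenstein.norm x → EisensteinArithmetic.Divides p x
p≡2[mod3]⇒inert {p} {r} p-prime p≡2+3r x@(a +ω b) p∣N = EisensteinArithmetic.p∣norm∧p∣ω-coefficient⇒p∣ p-prime x p∣N
  (x≈0⇒p∣x (norm-form-anisotropic 3≉0 {a} {b} (p∣x⇒x≈0 p∣N)))
  where
  open IntegersModulo p-prime
  open CubesInjective field-ℤ/p r p≡2+3r
  3≉0 : ¬ + 3 ≈ₚ 0ℤ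
  3≉0 e = impossible r (ℤ∣.∣⇒∣ᵤ (x≈0⇒p∣x {+ 3} e)) p≡2+3r
    where
    impossible : ∀ r → p ℕ∣.∣ 3 → p ≡ 2 ℕ.+ 3 ℕ.* r → ⊥
    impossible zero    p∣3 ≡.refl = from-no (2 ℕ∣.∣? 3) p∣3
    impossible (suc r) p∣3 ≡.refl = ℕₚ.<⇒≱ (ℕₚ.<-≤-trans (from-yes (3 ℕₚ.<? 5)) (ℕₚ.+-monoʳ-≤ 2 (ℕₚ.m≤m*n 3 (suc r)))) (ℕ∣.∣⇒≤ p∣3)

-- Factorials and binomial coefficients modulo p

C-factorials : ∀ m n → ((m ℕ.+ n) C m) ℕ.* (m ! ℕ.* n !) ≡ (m ℕ.+ n) !
C-factorials m n = ≡.subst (λ j → ((m ℕ.+ n) C m) ℕ.* (m ! ℕ.* j !) ≡ (m ℕ.+ n) !) (ℕₚ.m+n∸m≡n m n)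
  (≡.trans (≡.cong (ℕ._* (m ! ℕ.* (m ℕ.+ n ℕ.∸ m) !)) (nCk≡n!/k![n-k]! m≤m+n))
    (m/n*n≡m {{m ℕₚ.!* (m ℕ.+ n ℕ.∸ m) !≢0}} (k![n∸k]!∣n! m≤m+n)))
  where
  m≤m+n : m ℕ.≤ m ℕ.+ n
  m≤m+n = ℕₚ.m≤m+n m n

C-central-factorials : ∀ m → ((2 ℕ.* m) C m) ℕ.* (m ! ℕ.* m !) ≡ (2 ℕ.* m) !
C-central-factorials m = ≡.subst (λ j → (j C m) ℕ.* (m ! ℕ.* m !) ≡ j !) (≡.cong (m ℕ.+_) (≡.sym (ℕₚ.+-identityʳ m))) (C-factorials m m)

module FactorialsModulo {p} (p-prime : Prime p) where

  ∤-* : ∀ {m n} → ¬ p ℕ∣.∣ m → ¬ p ℕ∣.∣ n → ¬ p ℕ∣.∣ m ℕ.* n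
  ∤-* {m} {n} p∤m p∤n p∣mn = [ p∤m , p∤n ]′ (euclidsLemma m n p-prime p∣mn)

  p∤1 : ¬ p ℕ∣.∣ 1
  p∤1 p∣1 = ℕ.nonTrivial⇒≢1 {{prime⇒nonTrivial p-prime}} (ℕ∣.∣1⇒≡1 p∣1)

  p∤! : ∀ {n} → n ℕ.< p → ¬ p ℕ∣.∣ n !
  p∤! {zero}  n<p = p∤1
  p∤! {suc n} n<p = ∤-* (ℕ∣.>⇒∤ n<p) (p∤! (ℕₚ.<-trans (ℕₚ.n<1+n n) n<p))

  -- The multiples of p among the factors are p, 2p, ..., a p, with product p^a a!; the remaining
  -- factors make up U.
  factorial-p-part : ∀ a b → b ℕ.< p → ∃ λ U → ¬ p ℕ∣.∣ U ∧ (a ℕ.* p ℕ.+ b) ! ≡ p ℕ.^ a ℕ.* a ! ℕ.* U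
  factorial-p-part zero zero b<p = 1 , p∤1 , ≡.refl
  factorial-p-part (suc a) zero b<p =
    let (U , p∤U , e) = factorial-p-part a r (ℕₚ.≤-reflexive 1+r≡p) in
    U , p∤U , (begin
      (suc a ℕ.* p ℕ.+ 0) !                     ≡⟨ ≡.cong _! (≡.trans (ℕₚ.+-identityʳ (suc a ℕ.* p)) (≡.sym head)) ⟩
      suc (a ℕ.* p ℕ.+ r) ℕ.* (a ℕ.* p ℕ.+ r) ! ≡⟨ ≡.cong₂ ℕ._*_ head e ⟩
      suc a ℕ.* p ℕ.* (p ℕ.^ a ℕ.* a ! ℕ.* U)   ≡⟨ regroup (suc a) p (p ℕ.^ a) (a !) U ⟩
      p ℕ.* p ℕ.^ a ℕ.* (suc a ℕ.* a !) ℕ.* U   ∎)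
    where
    open ≡.≡-Reasoning
    r = ℕ.pred p
    1+r≡p : suc r ≡ p
    1+r≡p = ℕₚ.suc-pred p {{prime⇒nonZero p-prime}}
    head : suc (a ℕ.* p ℕ.+ r) ≡ suc a ℕ.* p
    head = ≡.trans (≡.sym (ℕₚ.+-suc (a ℕ.* p) r)) (≡.trans (≡.cong (a ℕ.* p ℕ.+_) 1+r≡p) (ℕₚ.+-comm (a ℕ.* p) p))
    regroup : ∀ a r x y u → a ℕ.* r ℕ.* (x ℕ.* y ℕ.* u) ≡ r ℕ.* x ℕ.* (a ℕ.* y) ℕ.* u
    regroup = ℕ-solve
  factorial-p-part a (suc b) 1+b<p =
    let (U , p∤U , e) = factorial-p-part a b (ℕₚ.<-trans (ℕₚ.n<1+n b) 1+b<p) in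
    (a ℕ.* p ℕ.+ suc b) ℕ.* U
    , ∤-* (λ p∣ → ℕ∣.>⇒∤ 1+b<p (ℕ∣.∣m+n∣m⇒∣n p∣ (ℕ∣.n∣m*n a))) p∤U
    , (begin
      (a ℕ.* p ℕ.+ suc b) !                                    ≡⟨ ≡.cong _! (ℕₚ.+-suc (a ℕ.* p) b) ⟩
      suc (a ℕ.* p ℕ.+ b) ℕ.* (a ℕ.* p ℕ.+ b) !                ≡⟨ ≡.cong₂ ℕ._*_ (≡.sym (ℕₚ.+-suc (a ℕ.* p) b)) e ⟩
      (a ℕ.* p ℕ.+ suc b) ℕ.* (p ℕ.^ a ℕ.* a ! ℕ.* U)          ≡⟨ regroup (a ℕ.* p ℕ.+ suc b) (p ℕ.^ a ℕ.* a !) U ⟩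
      p ℕ.^ a ℕ.* a ! ℕ.* ((a ℕ.* p ℕ.+ suc b) ℕ.* U)          ∎)
    where
    open ≡.≡-Reasoning
    regroup : ∀ x y u → x ℕ.* (y ℕ.* u) ≡ y ℕ.* (x ℕ.* u)
    regroup = ℕ-solve

  -- A weak form of Lucas' theorem: since 2t < p, doubling a p + t carries nothing from the last
  -- digit, so the powers of p cancel and the new binomial coefficient equals the old one up to
  -- factors prime to p.
  p∤C[2s,s]-step : ∀ {a t} → 2 ℕ.* t ℕ.< p → ¬ p ℕ∣.∣ (2 ℕ.* a) C a → ¬ p ℕ∣.∣ (2 ℕ.* (a ℕ.* p ℕ.+ t)) C (a ℕ.* p ℕ.+ t)
  p∤C[2s,s]-step {a} {t} 2t<p p∤C p∣C′ =
    let (U , p∤U , eU) = factorial-p-part a t (ℕₚ.≤-<-trans (ℕₚ.m≤m+n t _) 2t<p)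
        (W , p∤W , eW) = factorial-p-part (2 ℕ.* a) (2 ℕ.* t) 2t<p
        b = a ℕ.* p ℕ.+ t
        M = p ℕ.^ (2 ℕ.* a) ℕ.* (a ! ℕ.* a !)
        C′UU≡CW : ((2 ℕ.* b) C b) ℕ.* (U ℕ.* U) ≡ ((2 ℕ.* a) C a) ℕ.* W
        C′UU≡CW = ℕₚ.*-cancelˡ-≡ _ _ M {{ℕₚ.m*n≢0 _ _ {{ℕₚ.m^n≢0 p (2 ℕ.* a) {{prime⇒nonZero p-prime}}}} {{a ℕₚ.!* a !≢0}}}} (begin
          M ℕ.* (((2 ℕ.* b) C b) ℕ.* (U ℕ.* U))
            ≡⟨ ≡.cong (λ x → x ℕ.* (a ! ℕ.* a !) ℕ.* (((2 ℕ.* b) C b) ℕ.* (U ℕ.* U))) p^2a ⟩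
          p ℕ.^ a ℕ.* p ℕ.^ a ℕ.* (a ! ℕ.* a !) ℕ.* (((2 ℕ.* b) C b) ℕ.* (U ℕ.* U))
            ≡⟨ square (p ℕ.^ a) (a !) ((2 ℕ.* b) C b) U ⟩
          ((2 ℕ.* b) C b) ℕ.* ((p ℕ.^ a ℕ.* a ! ℕ.* U) ℕ.* (p ℕ.^ a ℕ.* a ! ℕ.* U))
            ≡⟨ ≡.cong (λ x → ((2 ℕ.* b) C b) ℕ.* (x ℕ.* x)) eU ⟨
          ((2 ℕ.* b) C b) ℕ.* (b ! ℕ.* b !)
            ≡⟨ C-central-factorials b ⟩
          (2 ℕ.* b) !
            ≡⟨ ≡.cong _! (double a p t) ⟩
          (2 ℕ.* a ℕ.* p ℕ.+ 2 ℕ.* t) !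
            ≡⟨ eW ⟩
          p ℕ.^ (2 ℕ.* a) ℕ.* (2 ℕ.* a) ! ℕ.* W
            ≡⟨ ≡.cong (λ x → p ℕ.^ (2 ℕ.* a) ℕ.* x ℕ.* W) (C-central-factorials a) ⟨
          p ℕ.^ (2 ℕ.* a) ℕ.* (((2 ℕ.* a) C a) ℕ.* (a ! ℕ.* a !)) ℕ.* W
            ≡⟨ regroup (p ℕ.^ (2 ℕ.* a)) ((2 ℕ.* a) C a) (a ! ℕ.* a !) W ⟩
          M ℕ.* (((2 ℕ.* a) C a) ℕ.* W) ∎)
    in ∤-* p∤C p∤W (≡.subst (p ℕ∣.∣_) C′UU≡CW (ℕ∣.∣m⇒∣m*n (U ℕ.* U) p∣C′))
    where
    open ≡.≡-Reasoning
    p^2a : p ℕ.^ (2 ℕ.* a) ≡ p ℕ.^ a ℕ.* p ℕ.^ a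
    p^2a = ≡.trans (≡.cong (λ x → p ℕ.^ (a ℕ.+ x)) (ℕₚ.+-identityʳ a)) (ℕₚ.^-distribˡ-+-* p a a)
    double : ∀ a p t → 2 ℕ.* (a ℕ.* p ℕ.+ t) ≡ 2 ℕ.* a ℕ.* p ℕ.+ 2 ℕ.* t
    double = ℕ-solve
    square : ∀ x f c u → x ℕ.* x ℕ.* (f ℕ.* f) ℕ.* (c ℕ.* (u ℕ.* u)) ≡ c ℕ.* ((x ℕ.* f ℕ.* u) ℕ.* (x ℕ.* f ℕ.* u))
    square = ℕ-solve
    regroup : ∀ x c f w → x ℕ.* (c ℕ.* f) ℕ.* w ≡ x ℕ.* f ℕ.* (c ℕ.* w)
    regroup = ℕ-solve

  -- All base-p digits of s = (p^k - 1)/3 are t = (p - 1)/3, and doubling s produces no carries.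
  p∤C[2s,s] : ∀ {t} → p ≡ suc (3 ℕ.* t) → ∀ k {s} → suc (3 ℕ.* s) ≡ p ℕ.^ k → ¬ p ℕ∣.∣ (2 ℕ.* s) C s
  p∤C[2s,s] {t} p≡1+3t k {s} 1+3s≡p^k = ≡.subst (λ s → ¬ p ℕ∣.∣ (2 ℕ.* s) C s)
    (ℕₚ.*-cancelˡ-≡ (S k) s 3 (ℕₚ.suc-injective (≡.trans (1+3S k) (≡.sym 1+3s≡p^k)))) (p∤C[2S,S] k)
    where
    S : ℕ → ℕ
    S zero    = 0
    S (suc k) = S k ℕ.* p ℕ.+ t
    step : ∀ a t → suc (3 ℕ.* (a ℕ.* suc (3 ℕ.* t) ℕ.+ t)) ≡ suc (3 ℕ.* t) ℕ.* suc (3 ℕ.* a)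
    step = ℕ-solve
    1+3S : ∀ k → suc (3 ℕ.* S k) ≡ p ℕ.^ k
    1+3S zero    = ≡.refl
    1+3S (suc k) = ≡.trans (≡.subst (λ p → suc (3 ℕ.* (S k ℕ.* p ℕ.+ t)) ≡ p ℕ.* suc (3 ℕ.* S k)) (≡.sym p≡1+3t) (step (S k) t)) (≡.cong (p ℕ.*_) (1+3S k))
    2t<p : 2 ℕ.* t ℕ.< p
    2t<p = ≡.subst (2 ℕ.* t ℕ.<_) (≡.sym p≡1+3t) (ℕ.s≤s (ℕₚ.*-monoˡ-≤ t (from-yes (2 ℕₚ.≤? 3))))
    p∤C[2S,S] : ∀ k → ¬ p ℕ∣.∣ (2 ℕ.* S k) C S k
    p∤C[2S,S] zero    = p∤1
    p∤C[2S,S] (suc k) = p∤C[2s,s]-step {S k} {t} 2t<p (p∤C[2S,S] k)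

  module _ {m} (p≡1+6m : p ≡ suc (6 ℕ.* m)) where

    open ≡.≡-Reasoning

    -- By induction on j, as 2 (3m + j + 1) = p + (2j + 1).
    half-factorial : ∀ j → + p ℤ∣.∣ + ((3 ℕ.* m ℕ.+ j) ! ℕ.* (4 ℕ.^ j ℕ.* j !)) ℤ.- + ((3 ℕ.* m) ! ℕ.* (2 ℕ.* j) !)
    half-factorial zero = divides 0ℤ (≡.trans (≡.cong (λ x → + (x ! ℕ.* 1) ℤ.- + ((3 ℕ.* m) ! ℕ.* 1)) (ℕₚ.+-identityʳ (3 ℕ.* m))) (ℤₚ.+-inverseʳ (+ ((3 ℕ.* m) ! ℕ.* 1))))
    half-factorial (suc j) = ≡.subst (+ p ℤ∣.∣_) difference≡
      (ℤ∣.∣m∣n⇒∣m+n (ℤ∣.∣n⇒∣m*n (+ ((2 ℕ.* j ℕ.+ 1) ℕ.* (2 ℕ.* j ℕ.+ 2))) (half-factorial j)) (ℤ∣.∣n⇒∣m*n (+ (x ℕ.* (2 ℕ.* j ℕ.+ 2))) (divides 1ℤ (≡.sym (ℤₚ.*-identityˡ (+ p))))))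
      where
      x y : ℕ
      x = (3 ℕ.* m ℕ.+ j) ! ℕ.* (4 ℕ.^ j ℕ.* j !)
      y = (3 ℕ.* m) ! ℕ.* (2 ℕ.* j) !
      x-step : (3 ℕ.* m ℕ.+ suc j) ! ℕ.* (4 ℕ.^ suc j ℕ.* suc j !) ≡ x ℕ.* ((p ℕ.+ (2 ℕ.* j ℕ.+ 1)) ℕ.* (2 ℕ.* j ℕ.+ 2))
      x-step = begin
        (3 ℕ.* m ℕ.+ suc j) ! ℕ.* (4 ℕ.^ suc j ℕ.* suc j !)   ≡⟨ ≡.cong (λ n → n ! ℕ.* (4 ℕ.^ suc j ℕ.* suc j !)) (ℕₚ.+-suc (3 ℕ.* m) j) ⟩
        (suc (3 ℕ.* m ℕ.+ j) ℕ.* (3 ℕ.* m ℕ.+ j) !) ℕ.* (4 ℕ.* 4 ℕ.^ j ℕ.* (suc j ℕ.* j !))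
          ≡⟨ lemma m j ((3 ℕ.* m ℕ.+ j) !) (4 ℕ.^ j) (j !) ⟩
        x ℕ.* ((suc (6 ℕ.* m) ℕ.+ (2 ℕ.* j ℕ.+ 1)) ℕ.* (2 ℕ.* j ℕ.+ 2))
          ≡⟨ ≡.cong (λ n → x ℕ.* ((n ℕ.+ (2 ℕ.* j ℕ.+ 1)) ℕ.* (2 ℕ.* j ℕ.+ 2))) p≡1+6m ⟨
        x ℕ.* ((p ℕ.+ (2 ℕ.* j ℕ.+ 1)) ℕ.* (2 ℕ.* j ℕ.+ 2)) ∎
        where
        lemma : ∀ m j f g h → (suc (3 ℕ.* m ℕ.+ j) ℕ.* f) ℕ.* (4 ℕ.* g ℕ.* (suc j ℕ.* h)) ≡ f ℕ.* (g ℕ.* h) ℕ.* ((suc (6 ℕ.* m) ℕ.+ (2 ℕ.* j ℕ.+ 1)) ℕ.* (2 ℕ.* j ℕ.+ 2))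
        lemma = ℕ-solve
      y-step : (3 ℕ.* m) ! ℕ.* (2 ℕ.* suc j) ! ≡ y ℕ.* ((2 ℕ.* j ℕ.+ 1) ℕ.* (2 ℕ.* j ℕ.+ 2))
      y-step = ≡.trans (≡.cong (λ n → (3 ℕ.* m) ! ℕ.* n !) (index j)) (lemma j ((3 ℕ.* m) !) ((2 ℕ.* j) !))
        where
        index : ∀ j → 2 ℕ.* suc j ≡ suc (suc (2 ℕ.* j))
        index = ℕ-solve
        lemma : ∀ j f g → f ℕ.* (suc (suc (2 ℕ.* j)) ℕ.* (suc (2 ℕ.* j) ℕ.* g)) ≡ f ℕ.* g ℕ.* ((2 ℕ.* j ℕ.+ 1) ℕ.* (2 ℕ.* j ℕ.+ 2))
        lemma = ℕ-solve
      difference≡ : + ((2 ℕ.* j ℕ.+ 1) ℕ.* (2 ℕ.* j ℕ.+ 2)) ℤ.* (+ x ℤ.- + y) ℤ.+ + (x ℕ.* (2 ℕ.* j ℕ.+ 2)) ℤ.* + p ≡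
        + ((3 ℕ.* m ℕ.+ suc j) ! ℕ.* (4 ℕ.^ suc j ℕ.* suc j !)) ℤ.- + ((3 ℕ.* m) ! ℕ.* (2 ℕ.* suc j) !)
      difference≡ = begin
        + (u ℕ.* v) ℤ.* (+ x ℤ.- + y) ℤ.+ + (x ℕ.* v) ℤ.* + p
          ≡⟨ ≡.cong₂ (λ a b → a ℤ.* (+ x ℤ.- + y) ℤ.+ b ℤ.* + p) (ℤₚ.pos-* u v) (ℤₚ.pos-* x v) ⟩
        + u ℤ.* + v ℤ.* (+ x ℤ.- + y) ℤ.+ + x ℤ.* + v ℤ.* + p
          ≡⟨ lemma (+ x) (+ y) (+ p) (+ u) (+ v) ⟩
        + x ℤ.* ((+ p ℤ.+ + u) ℤ.* + v) ℤ.- + y ℤ.* (+ u ℤ.* + v)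
          ≡⟨ ≡.cong₂ (λ a b → + x ℤ.* a ℤ.- + y ℤ.* b) (ℤₚ.pos-* (p ℕ.+ u) v) (ℤₚ.pos-* u v) ⟨
        + x ℤ.* + ((p ℕ.+ u) ℕ.* v) ℤ.- + y ℤ.* + (u ℕ.* v)
          ≡⟨ ≡.cong₂ ℤ._-_ (ℤₚ.pos-* x ((p ℕ.+ u) ℕ.* v)) (ℤₚ.pos-* y (u ℕ.* v)) ⟨
        + (x ℕ.* ((p ℕ.+ u) ℕ.* v)) ℤ.- + (y ℕ.* (u ℕ.* v))
          ≡⟨ ≡.cong₂ (λ a b → + a ℤ.- + b) x-step y-step ⟨
        + ((3 ℕ.* m ℕ.+ suc j) ! ℕ.* (4 ℕ.^ suc j ℕ.* suc j !)) ℤ.- + ((3 ℕ.* m) ! ℕ.* (2 ℕ.* suc j) !) ∎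
        where
        u = 2 ℕ.* j ℕ.+ 1
        v = 2 ℕ.* j ℕ.+ 2
        lemma : ∀ x y p u v → u ℤ.* v ℤ.* (x ℤ.- y) ℤ.+ x ℤ.* v ℤ.* p ≡ x ℤ.* ((p ℤ.+ u) ℤ.* v) ℤ.- y ℤ.* (u ℤ.* v)
        lemma = ℤ-solve

    -- This is `half-factorial` at j = m divided by (2m)!² m!, which is prime to p because 2m < p.
    C[4m,2m]*4^m : + p ℤ∣.∣ + (((2 ℕ.* (2 ℕ.* m)) C (2 ℕ.* m)) ℕ.* 4 ℕ.^ m) ℤ.- + ((3 ℕ.* m) C (2 ℕ.* m))
    C[4m,2m]*4^m = [ id , (λ p∣D → contradiction (ℤ∣.∣⇒∣ᵤ p∣D) (∤-* (∤-* (p∤! 2m<p) (p∤! 2m<p)) (p∤! m<p))) ]′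
      (EisensteinArithmetic.euclidsLemmaℤ p-prime _ (+ D) (≡.subst (+ p ℤ∣.∣_) factored (half-factorial m)))
      where
      c₁ = (2 ℕ.* (2 ℕ.* m)) C (2 ℕ.* m)
      c₂ = (3 ℕ.* m) C (2 ℕ.* m)
      D = (2 ℕ.* m) ! ℕ.* (2 ℕ.* m) ! ℕ.* m !
      2m<p : 2 ℕ.* m ℕ.< p
      2m<p = ≡.subst (2 ℕ.* m ℕ.<_) (≡.sym p≡1+6m) (ℕ.s≤s (ℕₚ.*-monoˡ-≤ m (from-yes (2 ℕₚ.≤? 6))))
      m<p : m ℕ.< p
      m<p = ℕₚ.≤-<-trans (ℕₚ.m≤m+n m _) 2m<p
      3m! : c₂ ℕ.* ((2 ℕ.* m) ! ℕ.* m !) ≡ (3 ℕ.* m) !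
      3m! = ≡.subst (λ j → (j C (2 ℕ.* m)) ℕ.* ((2 ℕ.* m) ! ℕ.* m !) ≡ j !) (index m) (C-factorials (2 ℕ.* m) m)
        where
        index : ∀ m → 2 ℕ.* m ℕ.+ m ≡ 3 ℕ.* m
        index = ℕ-solve
      4m! : c₁ ℕ.* ((2 ℕ.* m) ! ℕ.* (2 ℕ.* m) !) ≡ (3 ℕ.* m ℕ.+ m) !
      4m! = ≡.trans (C-central-factorials (2 ℕ.* m)) (≡.cong _! (index m))
        where
        index : ∀ m → 2 ℕ.* (2 ℕ.* m) ≡ 3 ℕ.* m ℕ.+ m
        index = ℕ-solve
      factored : + ((3 ℕ.* m ℕ.+ m) ! ℕ.* (4 ℕ.^ m ℕ.* m !)) ℤ.- + ((3 ℕ.* m) ! ℕ.* (2 ℕ.* m) !) ≡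
        (+ (c₁ ℕ.* 4 ℕ.^ m) ℤ.- + c₂) ℤ.* + D
      factored = begin
        + ((3 ℕ.* m ℕ.+ m) ! ℕ.* (4 ℕ.^ m ℕ.* m !)) ℤ.- + ((3 ℕ.* m) ! ℕ.* (2 ℕ.* m) !)
          ≡⟨ ≡.cong₂ (λ a b → + (a ℕ.* (4 ℕ.^ m ℕ.* m !)) ℤ.- + (b ℕ.* (2 ℕ.* m) !)) 4m! 3m! ⟨
        + (c₁ ℕ.* ((2 ℕ.* m) ! ℕ.* (2 ℕ.* m) !) ℕ.* (4 ℕ.^ m ℕ.* m !)) ℤ.- + (c₂ ℕ.* ((2 ℕ.* m) ! ℕ.* m !) ℕ.* (2 ℕ.* m) !)
          ≡⟨ ≡.cong₂ (λ a b → + a ℤ.- + b) (regroup₁ c₁ ((2 ℕ.* m) !) (4 ℕ.^ m) (m !)) (regroup₂ c₂ ((2 ℕ.* m) !) (m !)) ⟩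
        + (c₁ ℕ.* 4 ℕ.^ m ℕ.* D) ℤ.- + (c₂ ℕ.* D)
          ≡⟨ ≡.cong₂ ℤ._-_ (ℤₚ.pos-* (c₁ ℕ.* 4 ℕ.^ m) D) (ℤₚ.pos-* c₂ D) ⟩
        + (c₁ ℕ.* 4 ℕ.^ m) ℤ.* + D ℤ.- + c₂ ℤ.* + D
          ≡⟨ lemma (+ (c₁ ℕ.* 4 ℕ.^ m)) (+ c₂) (+ D) ⟩
        (+ (c₁ ℕ.* 4 ℕ.^ m) ℤ.- + c₂) ℤ.* + D ∎
        where
        regroup₁ : ∀ c x g y → c ℕ.* (x ℕ.* x) ℕ.* (g ℕ.* y) ≡ c ℕ.* g ℕ.* (x ℕ.* x ℕ.* y)
        regroup₁ = ℕ-solve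
        regroup₂ : ∀ c x y → c ℕ.* (x ℕ.* y) ℕ.* x ≡ c ℕ.* (x ℕ.* x ℕ.* y)
        regroup₂ = ℕ-solve
        lemma : ∀ a b d → a ℤ.* d ℤ.- b ℤ.* d ≡ (a ℤ.- b) ℤ.* d
        lemma = ℤ-solve

-- The trace of the Jacobi sum

module _ {p} {P : Pred ℤ p} (P? : Decidable P) where

  filter-singleton : ∀ {xs z} → Unique xs → z ∈ xs → P z → (∀ {y} → P y → y ≡ z) → filter P? xs ≡ z List.∷ List.[]
  filter-singleton {x List.∷ xs} {z} (x∉xs ∷ unique) z∈ Pz only-z with P? x
  ... | yes Px = ≡.cong₂ List._∷_ (only-z Px) (filter-none P? (All.map (λ x≢y Py → x≢y (≡.trans (only-z Px) (≡.sym (only-z Py)))) x∉xs))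
  ... | no ¬Px with z∈
  ...   | here ≡.refl = contradiction Pz ¬Px
  ...   | there z∈xs  = filter-singleton unique z∈xs Pz only-z

n≤n*n : ∀ n → n ℕ.≤ n ℕ.* n
n≤n*n zero    = ℕ.z≤n
n≤n*n (suc n) = ℕₚ.m≤m*n (suc n) (suc n)

integersUpTo2p-unique : ∀ p → Unique (integersUpTo2p p)
integersUpTo2p-unique p = Unique.map⁺ (λ {i} {j} e → ℤₚ.+-injective (≡.trans (restore (+ i) (+ (2 ℕ.* p)))
  (≡.trans (≡.cong (ℤ._+ + (2 ℕ.* p)) e) (≡.sym (restore (+ j) (+ (2 ℕ.* p))))))) (Unique.upTo⁺ (suc (4 ℕ.* p)))
  where
  restore : ∀ i c → i ≡ (i ℤ.- c) ℤ.+ c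
  restore = ℤ-solve

∈-integersUpTo2p : ∀ p z → ℤ.∣ z ∣ ℕ.≤ 2 ℕ.* p → z ∈ integersUpTo2p p
∈-integersUpTo2p p z ∣z∣≤2p = ≡.subst (_∈ integersUpTo2p p) (proj₂ (proj₂ (index z ∣z∣≤2p)))
  (∈-map⁺ (λ i → + i ℤ.- + (2 ℕ.* p)) (∈-upTo⁺ (ℕ.s≤s (proj₁ (proj₂ (index z ∣z∣≤2p))))))
  where
  double : ∀ p → 2 ℕ.* p ℕ.+ 2 ℕ.* p ≡ 4 ℕ.* p
  double = ℕ-solve
  index : ∀ z → ℤ.∣ z ∣ ℕ.≤ 2 ℕ.* p → ∃ λ i → i ℕ.≤ 4 ℕ.* p ∧ + i ℤ.- + (2 ℕ.* p) ≡ z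
  index (+ n) n≤2p = n ℕ.+ 2 ℕ.* p
    , ℕₚ.≤-trans (ℕₚ.+-monoˡ-≤ (2 ℕ.* p) n≤2p) (ℕₚ.≤-reflexive (double p))
    , cancel (+ n) (+ (2 ℕ.* p))
    where
    cancel : ∀ n m → (n ℤ.+ m) ℤ.- m ≡ n
    cancel = ℤ-solve
  index (-[1+ n ]) n<2p = 2 ℕ.* p ℕ.∸ suc n
    , ℕₚ.≤-trans (ℕₚ.m∸n≤m (2 ℕ.* p) (suc n)) (ℕₚ.*-monoˡ-≤ p (from-yes (2 ℕₚ.≤? 4)))
    , ≡.trans (≡.cong (ℤ._- + (2 ℕ.* p)) (≡.trans (≡.sym (ℤₚ.⊖-≥ n<2p)) (≡.sym (ℤₚ.[+m]-[+n]≡m⊖n (2 ℕ.* p) (suc n))))) (cancel (+ (2 ℕ.* p)) (+ suc n))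
    where
    cancel : ∀ m n → (m ℤ.- n) ℤ.- m ≡ ℤ.- n
    cancel = ℤ-solve

-- `κ` matches on the numerals 7 and 13, so its general clause is reached by computation only for
-- each other small numeral and for numbers of the form 14 + r.
κ≡0 : ∀ p → p % 3 ≢ 1 → κ p ≡ 0ℤ
κ≡0 7  h = contradiction ≡.refl h
κ≡0 13 h = contradiction ≡.refl h
κ≡0 0  h = ≡.refl
κ≡0 1  h = contradiction ≡.refl h
κ≡0 2  h = ≡.refl
κ≡0 3  h = ≡.refl
κ≡0 4  h = contradiction ≡.refl h
κ≡0 5  h = ≡.refl
κ≡0 6  h = ≡.refl
κ≡0 8  h = ≡.refl
κ≡0 9  h = ≡.refl
κ≡0 10 h = contradiction ≡.refl h
κ≡0 11 h = ≡.refl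
κ≡0 12 h = ≡.refl
κ≡0 p@(suc (suc (suc (suc (suc (suc (suc (suc (suc (suc (suc (suc (suc (suc r)))))))))))))) h =
  ≡.cong (if_then theUnique (filter (κ-condition? p) (integersUpTo2p p)) else 0ℤ) (dec-false (p % 3 ℕₚ.≟ 1) h)

κ-generic : ∀ r → let p = 14 ℕ.+ r in p % 3 ≡ 1 → κ p ≡ theUnique (filter (κ-condition? p) (integersUpTo2p p))
κ-generic r h = ≡.cong (if_then theUnique (filter (κ-condition? p) (integersUpTo2p p)) else 0ℤ) (dec-true (p % 3 ℕₚ.≟ 1) h)
  where p = 14 ℕ.+ r

module _ {p} (p-prime : Prime p) {m} (p≡1+6m : p ≡ suc (6 ℕ.* m)) where

  open EisensteinArithmetic using (euclidsLemmaℤ)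

  p-1/6≡m : (p ℕ.∸ 1) / 6 ≡ m
  p-1/6≡m = ≡.trans (≡.cong (_/ 6) (≡.trans (≡.cong ℕ.pred p≡1+6m) (ℕₚ.*-comm 6 m))) (m*n/n≡m m 6)

  p-1/3≡2m : (p ℕ.∸ 1) / 3 ≡ 2 ℕ.* m
  p-1/3≡2m = ≡.trans (≡.cong (_/ 3) (≡.trans (≡.cong ℕ.pred p≡1+6m) (lemma m))) (m*n/n≡m (2 ℕ.* m) 3)
    where
    lemma : ∀ m → 6 ℕ.* m ≡ 2 ℕ.* m ℕ.* 3
    lemma = ℕ-solve

  p-1/2≡3m : (p ℕ.∸ 1) / 2 ≡ 3 ℕ.* m
  p-1/2≡3m = ≡.trans (≡.cong (_/ 2) (≡.trans (≡.cong ℕ.pred p≡1+6m) (lemma m))) (m*n/n≡m (3 ℕ.* m) 2)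
    where
    lemma : ∀ m → 6 ℕ.* m ≡ 3 ℕ.* m ℕ.* 2
    lemma = ℕ-solve

  Condition : ℤ → Set
  Condition z = ℤ.∣ z ∣ ℕ.* ℤ.∣ z ∣ ℕ.≤ 4 ℕ.* p ∧ + p ℤ∣.∣ z ℤ.* + (4 ℕ.^ m) ℤ.+ + ((3 ℕ.* m) C (2 ℕ.* m))

  private
    residue≡ : ∀ z → z ℤ.* + (4 ℕ.^ ((p ℕ.∸ 1) / 6)) ℤ.- ℤ.- + (((p ℕ.∸ 1) / 2) C ((p ℕ.∸ 1) / 3)) ≡
      z ℤ.* + (4 ℕ.^ m) ℤ.+ + ((3 ℕ.* m) C (2 ℕ.* m))
    residue≡ z = ≡.cong₂ (λ a b → z ℤ.* + (4 ℕ.^ a) ℤ.+ b) p-1/6≡m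
      (≡.trans (ℤₚ.neg-involutive _) (≡.cong₂ (λ a b → + (a C b)) p-1/2≡3m p-1/3≡2m))

  condition⇒κ-condition : ∀ {z} → Condition z → κ-Condition p z
  condition⇒κ-condition {z} (bound , p∣) = bound , ℤ∣.∣⇒∣ᵤ (≡.subst (+ p ℤ∣.∣_) (≡.sym (residue≡ z)) p∣)

  κ-condition⇒condition : ∀ {z} → κ-Condition p z → Condition z
  κ-condition⇒condition {z} (bound , p∣) = bound , ≡.subst (+ p ℤ∣.∣_) (residue≡ z) (ℤ∣.∣ᵤ⇒∣ p∣)

  -- Otherwise the larger of a and b, called c, satisfies p ≤ 2c, whence p² ≤ 4c² ≤ 16p and p ≤ 16.
  small-sum : 16 ℕ.< p → ∀ {a b} → a ℕ.* a ℕ.≤ 4 ℕ.* p → b ℕ.* b ℕ.≤ 4 ℕ.* p → a ℕ.+ b ℕ.< p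
  small-sum 16<p {a} {b} a²≤4p b²≤4p = ℕₚ.≰⇒> λ p≤a+b → [ (λ a≤b → impossible b b²≤4p (ℕₚ.≤-trans p≤a+b (ℕₚ.+-monoˡ-≤ b a≤b)))
                                                       , (λ b≤a → impossible a a²≤4p (ℕₚ.≤-trans p≤a+b (ℕₚ.+-monoʳ-≤ a b≤a))) ]′ (ℕₚ.≤-total a b)
    where
    impossible : ∀ c → c ℕ.* c ℕ.≤ 4 ℕ.* p → p ℕ.≤ c ℕ.+ c → ⊥
    impossible c c²≤4p p≤2c = ℕₚ.<⇒≱ (ℕₚ.*-monoˡ-< p {{prime⇒nonZero p-prime}} 16<p) (ℕₚ.≤-trans (ℕₚ.*-mono-≤ p≤2c p≤2c)
      (ℕₚ.≤-trans (ℕₚ.≤-reflexive (square c)) (ℕₚ.≤-trans (ℕₚ.*-monoʳ-≤ 4 c²≤4p) (ℕₚ.≤-reflexive (≡.sym (ℕₚ.*-assoc 4 4 p))))))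
      where
      square : ∀ c → (c ℕ.+ c) ℕ.* (c ℕ.+ c) ≡ 4 ℕ.* (c ℕ.* c)
      square = ℕ-solve

  -- Two solutions are congruent modulo p because 4 is a unit, and their difference is smaller than
  -- p in absolute value.
  condition-unique : 16 ℕ.< p → ∀ {y z} → Condition y → Condition z → y ≡ z
  condition-unique 16<p {y} {z} (∣y∣ , p∣y) (∣z∣ , p∣z) = ℤₚ.i-j≡0⇒i≡j y z (ℤₚ.∣i∣≡0⇒i≡0 (p∣d∧d<p⇒d≡0 (ℤ∣.∣⇒∣ᵤ p∣y-z)
    (ℕₚ.≤-<-trans (ℤₚ.∣i-j∣≤∣i∣+∣j∣ y z) (small-sum 16<p {ℤ.∣ y ∣} {ℤ.∣ z ∣} ∣y∣ ∣z∣))))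
    where
    p∤4^ : ∀ j → ¬ p ℕ∣.∣ 4 ℕ.^ j
    p∤4^ zero    = FactorialsModulo.p∤1 p-prime
    p∤4^ (suc j) = FactorialsModulo.∤-* p-prime (ℕ∣.>⇒∤ (ℕₚ.<-trans (from-yes (4 ℕₚ.<? 16)) 16<p)) (p∤4^ j)
    difference : ∀ y z c b → (y ℤ.* c ℤ.+ b) ℤ.+ ℤ.-1ℤ ℤ.* (z ℤ.* c ℤ.+ b) ≡ (y ℤ.- z) ℤ.* c
    difference = ℤ-solve
    p∣y-z : + p ℤ∣.∣ y ℤ.- z
    p∣y-z = [ id , (λ p∣4^m → contradiction (ℤ∣.∣⇒∣ᵤ p∣4^m) (p∤4^ m)) ]′ (euclidsLemmaℤ p-prime (y ℤ.- z) (+ (4 ℕ.^ m))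
      (≡.subst (+ p ℤ∣.∣_) (difference y z (+ (4 ℕ.^ m)) (+ ((3 ℕ.* m) C (2 ℕ.* m)))) (ℤ∣.∣m∣n⇒∣m+n p∣y (ℤ∣.∣n⇒∣m*n ℤ.-1ℤ p∣z))))

  κ≡-large : 16 ℕ.< p → ∀ r → p ≡ 14 ℕ.+ r → ∀ {z} → Condition z → κ p ≡ z
  κ≡-large 16<p r p≡14+r {z} cond = ≡.trans κ≡theUnique (≡.cong theUnique
    (filter-singleton (κ-condition? p) (integersUpTo2p-unique p) (∈-integersUpTo2p p z ∣z∣≤2p) (condition⇒κ-condition {z} cond)
      (λ {y} cond′ → condition-unique 16<p {y} {z} (κ-condition⇒condition {y} cond′) cond)))
    where
    p%3≡1 : p % 3 ≡ 1
    p%3≡1 = ≡.trans (≡.cong (_% 3) (≡.trans p≡1+6m (lemma m))) ([m+kn]%n≡m%n 1 (2 ℕ.* m) 3)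
      where
      lemma : ∀ m → suc (6 ℕ.* m) ≡ 1 ℕ.+ 2 ℕ.* m ℕ.* 3
      lemma = ℕ-solve
    κ≡theUnique : κ p ≡ theUnique (filter (κ-condition? p) (integersUpTo2p p))
    κ≡theUnique = ≡.subst (λ p → p % 3 ≡ 1 → κ p ≡ theUnique (filter (κ-condition? p) (integersUpTo2p p))) (≡.sym p≡14+r) (κ-generic r) p%3≡1
    ∣z∣≤2p : ℤ.∣ z ∣ ℕ.≤ 2 ℕ.* p
    ∣z∣≤2p = ℕₚ.≮⇒≥ λ 2p<∣z∣ → ℕₚ.<⇒≱ (ℕₚ.*-mono-< 2p<∣z∣ 2p<∣z∣) (ℕₚ.≤-trans (proj₁ cond)
      (ℕₚ.≤-trans (ℕₚ.*-monoʳ-≤ 4 (n≤n*n p)) (ℕₚ.≤-reflexive (square p))))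
      where
      square : ∀ p → 4 ℕ.* (p ℕ.* p) ≡ 2 ℕ.* p ℕ.* (2 ℕ.* p)
      square = ℕ-solve

n,D≤n²+27D : ∀ N n D → n ℕ.* n ℕ.+ 27 ℕ.* D ≡ N → n ℕ.< suc N ∧ D ℕ.< suc N
n,D≤n²+27D N n D e = ℕ.s≤s (ℕₚ.≤-trans (n≤n*n n) (ℕₚ.≤-trans (ℕₚ.m≤m+n (n ℕ.* n) _) (ℕₚ.≤-reflexive e)))
  , ℕ.s≤s (ℕₚ.≤-trans (ℕₚ.m≤n*m D 27) (ℕₚ.≤-trans (ℕₚ.m≤n+m (27 ℕ.* D) (n ℕ.* n)) (ℕₚ.≤-reflexive e)))

n-unique-by-search : ∀ N r → (∀ (i j : Fin (suc N)) → toℕ i ℕ.* toℕ i ℕ.+ 27 ℕ.* toℕ j ≡ N → toℕ i ≡ r) →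
  ∀ n D → n ℕ.* n ℕ.+ 27 ℕ.* D ≡ N → n ≡ r
n-unique-by-search N r check n D e = ≡.trans (≡.sym (Finₚ.toℕ-fromℕ< n<)) (check (Fin.fromℕ< n<) (Fin.fromℕ< D<)
  (≡.trans (≡.cong₂ (λ n D → n ℕ.* n ℕ.+ 27 ℕ.* D) (Finₚ.toℕ-fromℕ< n<) (Finₚ.toℕ-fromℕ< D<)) e))
  where
  n< = proj₁ (n,D≤n²+27D N n D e)
  D< = proj₂ (n,D≤n²+27D N n D e)

check? : ∀ N r → Dec (∀ (i j : Fin (suc N)) → toℕ i ℕ.* toℕ i ℕ.+ 27 ℕ.* toℕ j ≡ N → toℕ i ≡ r)
check? N r = Finₚ.all? λ i → Finₚ.all? λ j → (toℕ i ℕ.* toℕ i ℕ.+ 27 ℕ.* toℕ j ℕₚ.≟ N) →-dec (toℕ i ℕₚ.≟ r)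

28=n²+27D⇒n≡1 : ∀ n D → n ℕ.* n ℕ.+ 27 ℕ.* D ≡ 28 → n ≡ 1
28=n²+27D⇒n≡1 = n-unique-by-search 28 1 (from-yes (check? 28 1))

52=n²+27D⇒n≡5 : ∀ n D → n ℕ.* n ℕ.+ 27 ℕ.* D ≡ 52 → n ≡ 5
52=n²+27D⇒n≡5 = n-unique-by-search 52 5 (from-yes (check? 52 5))

z≡4+3u⇒z-4≡3u : ∀ z u → z ≡ + 4 ℤ.+ u ℤ.* + 3 → z ℤ.- + 4 ≡ u ℤ.* + 3
z≡4+3u⇒z-4≡3u z u ≡.refl = lemma u
  where
  lemma : ∀ u → (+ 4 ℤ.+ u ℤ.* + 3) ℤ.- + 4 ≡ u ℤ.* + 3
  lemma = ℤ-solve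

∣z∣≡n⇒z≡±n : ∀ z {n} → ℤ.∣ z ∣ ≡ n → z ≡ + n ⊎ z ≡ ℤ.- + n
∣z∣≡n⇒z≡±n (+ n)      ≡.refl = inj₁ ≡.refl
∣z∣≡n⇒z≡±n (-[1+ n ]) ≡.refl = inj₂ ≡.refl

-- The cases m = 0, 1, 2 are p = 1, 7, 13. For larger m the number p is at least 19, above the bound
-- 16 beyond which the residue modulo p determines z.
κ-determined : ∀ {p m} → Prime p → p ≡ suc (6 ℕ.* m) → ∀ {z u D} → z ≡ + 4 ℤ.+ u ℤ.* + 3 →
  ℤ.∣ z ∣ ℕ.* ℤ.∣ z ∣ ℕ.+ 27 ℕ.* D ≡ 4 ℕ.* p → + p ℤ∣.∣ z ℤ.+ + ((2 ℕ.* (2 ℕ.* m)) C (2 ℕ.* m)) → κ p ≡ z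
κ-determined {p} {zero} p-prime ≡.refl _ _ _ = contradiction ≡.refl (ℕ.nonTrivial⇒≢1 {{prime⇒nonTrivial p-prime}})
κ-determined {p} {suc zero} p-prime ≡.refl {z} {u} {D} z≡4+3u z²+27D _ = sign (∣z∣≡n⇒z≡±n z (28=n²+27D⇒n≡1 ℤ.∣ z ∣ D z²+27D))
  where
  sign : z ≡ 1ℤ ⊎ z ≡ ℤ.-1ℤ → 1ℤ ≡ z
  sign (inj₁ z≡1)  = ≡.sym z≡1
  sign (inj₂ z≡-1) = contradiction (ℤ∣.∣⇒∣ᵤ {+ 3} {ℤ.- + 5} (divides u (z≡4+3u⇒z-4≡3u ℤ.-1ℤ u (≡.trans (≡.sym z≡-1) z≡4+3u)))) (from-no (3 ℕ∣.∣? 5))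
κ-determined {p} {suc (suc zero)} p-prime ≡.refl {z} {u} {D} z≡4+3u z²+27D _ = sign (∣z∣≡n⇒z≡±n z (52=n²+27D⇒n≡5 ℤ.∣ z ∣ D z²+27D))
  where
  sign : z ≡ + 5 ⊎ z ≡ ℤ.- + 5 → ℤ.- + 5 ≡ z
  sign (inj₁ z≡5)  = contradiction (ℤ∣.∣⇒∣ᵤ {+ 3} {+ 1} (divides u (z≡4+3u⇒z-4≡3u (+ 5) u (≡.trans (≡.sym z≡5) z≡4+3u)))) (from-no (3 ℕ∣.∣? 1))
  sign (inj₂ z≡-5) = ≡.sym z≡-5
κ-determined {p} {m@(suc (suc (suc j)))} p-prime p≡1+6m {z} {u} {D} _ z²+27D p∣ =
  -- Multiplying by 4^m and subtracting the congruence between the binomial coefficients exchanges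
  -- C(4m, 2m) for the C(3m, 2m) in the definition of `κ`.
  κ≡-large p-prime {m} p≡1+6m 16<p (5 ℕ.+ 6 ℕ.* j) (≡.trans p≡1+6m (index j)) {z}
    (ℕₚ.≤-trans (ℕₚ.m≤m+n _ (27 ℕ.* D)) (ℕₚ.≤-reflexive z²+27D) , ≡.subst (+ p ℤ∣.∣_) combine
      (ℤ∣.∣m∣n⇒∣m+n (ℤ∣.∣n⇒∣m*n (+ (4 ℕ.^ m)) p∣) (ℤ∣.∣n⇒∣m*n ℤ.-1ℤ (FactorialsModulo.C[4m,2m]*4^m p-prime {m} p≡1+6m))))
  where
  index : ∀ j → suc (6 ℕ.* suc (suc (suc j))) ≡ 14 ℕ.+ (5 ℕ.+ 6 ℕ.* j)
  index = ℕ-solve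
  16<p : 16 ℕ.< p
  16<p = ≡.subst (16 ℕ.<_) (≡.sym (≡.trans p≡1+6m (index j))) (ℕₚ.≤-trans (from-yes (16 ℕₚ.<? 19)) (ℕₚ.m≤m+n 19 (6 ℕ.* j)))
  c₁ c₂ : ℕ
  c₁ = (2 ℕ.* (2 ℕ.* m)) C (2 ℕ.* m)
  c₂ = (3 ℕ.* m) C (2 ℕ.* m)
  lemma : ∀ z f c d → f ℤ.* (z ℤ.+ c) ℤ.+ ℤ.-1ℤ ℤ.* (c ℤ.* f ℤ.- d) ≡ z ℤ.* f ℤ.+ d
  lemma = ℤ-solve
  combine : + (4 ℕ.^ m) ℤ.* (z ℤ.+ + c₁) ℤ.+ ℤ.-1ℤ ℤ.* (+ (c₁ ℕ.* 4 ℕ.^ m) ℤ.- + c₂) ≡ z ℤ.* + (4 ℕ.^ m) ℤ.+ + c₂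
  combine = ≡.trans (≡.cong (λ x → + (4 ℕ.^ m) ℤ.* (z ℤ.+ + c₁) ℤ.+ ℤ.-1ℤ ℤ.* (x ℤ.- + c₂)) (ℤₚ.pos-* c₁ (4 ℕ.^ m)))
    (lemma z (+ (4 ℕ.^ m)) (+ c₁) (+ c₂))

module JacobiSumTrace {c ℓ q} (F : FiniteField c ℓ q) (s : ℕ) .{{_ : NonZero s}} (q≡1+3s : q ≡ suc (3 ℕ.* s)) where

  open JacobiSumNorm F s q≡1+3s using (J; norm[J]≡q; J≡2[mod3])
  open JacobiSumEvaluations F s q≡1+3s using (p∣trace[J]+C[2s,s])
  open FieldTheory F using (_×_)
  open Eisenstein using (trace; norm; fromℤ)
  open EisensteinArithmetic using (Divides; ≡1[mod3]; i*i≡+∣i∣*∣i∣; trace-fromℤ-*)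
  private
    module E = CommutativeRing Eisenstein.commutativeRing
    module Eℤ = IntegersIn Eisenstein.commutativeRing
  open ≡.≡-Reasoning

  u v : ℤ
  u = ℤ[ω].constant (proj₁ J≡2[mod3])
  v = ℤ[ω].ω-coefficient (proj₁ J≡2[mod3])

  private
    J≡ : J ≡ fromℤ (+ 2) E.+ fromℤ (+ 3) E.* (u +ω v)
    J≡ = proj₂ J≡2[mod3]

  trace[J]≡4+3 : trace J ≡ + 4 ℤ.+ (+ 2 ℤ.* u ℤ.- v) ℤ.* + 3
  trace[J]≡4+3 = ≡.trans (≡.cong trace J≡) (lemma u v)
    where
    lemma : ∀ u v → let a = + 2 ℤ.+ (+ 3 ℤ.* u ℤ.- 0ℤ ℤ.* v)
                        b = 0ℤ ℤ.+ (+ 3 ℤ.* v ℤ.+ 0ℤ ℤ.* u ℤ.- 0ℤ ℤ.* v) in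
      a ℤ.+ a ℤ.- b ≡ + 4 ℤ.+ (+ 2 ℤ.* u ℤ.- v) ℤ.* + 3
    lemma = ℤ-solve

  -- Four times a norm is the square of the trace plus 3 b² for the ω-coefficient b, and here b =
  -- 3v.
  trace[J]²+27v² : ℤ.∣ trace J ∣ ℕ.* ℤ.∣ trace J ∣ ℕ.+ 27 ℕ.* (ℤ.∣ v ∣ ℕ.* ℤ.∣ v ∣) ≡ 4 ℕ.* q
  trace[J]²+27v² = ℤₚ.+-injective (begin
    + (ℤ.∣ t ∣ ℕ.* ℤ.∣ t ∣) ℤ.+ + (27 ℕ.* (ℤ.∣ v ∣ ℕ.* ℤ.∣ v ∣))
      ≡⟨ ≡.cong (λ x → + (ℤ.∣ t ∣ ℕ.* ℤ.∣ t ∣) ℤ.+ x) (ℤₚ.pos-* 27 (ℤ.∣ v ∣ ℕ.* ℤ.∣ v ∣)) ⟩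
    + (ℤ.∣ t ∣ ℕ.* ℤ.∣ t ∣) ℤ.+ + 27 ℤ.* + (ℤ.∣ v ∣ ℕ.* ℤ.∣ v ∣)
      ≡⟨ ≡.cong₂ (λ a b → a ℤ.+ + 27 ℤ.* b) (i*i≡+∣i∣*∣i∣ t) (i*i≡+∣i∣*∣i∣ v) ⟨
    t ℤ.* t ℤ.+ + 27 ℤ.* (v ℤ.* v)
      ≡⟨ ≡.cong (λ x → trace x ℤ.* trace x ℤ.+ + 27 ℤ.* (v ℤ.* v)) J≡ ⟩
    trace J′ ℤ.* trace J′ ℤ.+ + 27 ℤ.* (v ℤ.* v)
      ≡⟨ lemma u v ⟩
    + 4 ℤ.* norm J′
      ≡⟨ ≡.cong (λ x → + 4 ℤ.* norm x) J≡ ⟨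
    + 4 ℤ.* norm J
      ≡⟨ ≡.cong (λ x → + 4 ℤ.* x) norm[J]≡q ⟩
    + 4 ℤ.* + q
      ≡⟨ ℤₚ.pos-* 4 q ⟨
    + (4 ℕ.* q) ∎)
    where
    t = trace J
    J′ = fromℤ (+ 2) E.+ fromℤ (+ 3) E.* (u +ω v)
    lemma : ∀ u v → let a = + 2 ℤ.+ (+ 3 ℤ.* u ℤ.- 0ℤ ℤ.* v)
                        b = 0ℤ ℤ.+ (+ 3 ℤ.* v ℤ.+ 0ℤ ℤ.* u ℤ.- 0ℤ ℤ.* v) in
      (a ℤ.+ a ℤ.- b) ℤ.* (a ℤ.+ a ℤ.- b) ℤ.+ + 27 ℤ.* (v ℤ.* v) ≡ + 4 ℤ.* (a ℤ.* a ℤ.- a ℤ.* b ℤ.+ b ℤ.* b)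
    lemma = ℤ-solve

  -- J ≡ -1 modulo 3, so the sign produces the associate congruent to 1.
  α : ℤ[ω]
  α = E.- J

  norm[α]≡q : norm α ≡ + q
  norm[α]≡q = ≡.trans (norm-neg J) norm[J]≡q
    where
    norm-neg : ∀ x → norm (E.- x) ≡ norm x
    norm-neg (a +ω b) = lemma a b
      where
      lemma : ∀ a b → (ℤ.- a) ℤ.* (ℤ.- a) ℤ.- (ℤ.- a) ℤ.* (ℤ.- b) ℤ.+ (ℤ.- b) ℤ.* (ℤ.- b) ≡ a ℤ.* a ℤ.- a ℤ.* b ℤ.+ b ℤ.* b
      lemma = ℤ-solve

  trace[α]≡-trace[J] : trace α ≡ ℤ.- trace J
  trace[α]≡-trace[J] = trace-neg J
    where
    trace-neg : ∀ x → trace (E.- x) ≡ ℤ.- trace x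
    trace-neg (a +ω b) = lemma a b
      where
      lemma : ∀ a b → (ℤ.- a) ℤ.+ (ℤ.- a) ℤ.- (ℤ.- b) ≡ ℤ.- (a ℤ.+ a ℤ.- b)
      lemma = ℤ-solve

  α≡1[mod3] : ≡1[mod3] α
  α≡1[mod3] = E.- (E.1# E.+ (u +ω v)) , ≡.trans (≡.cong (λ x → E.- x) J≡) (negate (fromℤ (+ 3)) (u +ω v) ≡.refl)
    where
    negate : ∀ three M → E.1# E.+ fromℤ (+ 2) ≡ three → E.- (fromℤ (+ 2) E.+ three E.* M) ≡ E.1# E.+ three E.* (E.- (E.1# E.+ M))
    negate _ M ≡.refl = Eℤ.solve 1 (λ M → Eℤ.:- (Eℤ.con (+ 2) Eℤ.:+ (Eℤ.con 1ℤ Eℤ.:+ Eℤ.con (+ 2)) Eℤ.:* M)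
      Eℤ.:= Eℤ.con 1ℤ Eℤ.:+ (Eℤ.con 1ℤ Eℤ.:+ Eℤ.con (+ 2)) Eℤ.:* (Eℤ.:- (Eℤ.con 1ℤ Eℤ.:+ M))) ≡.refl M

  p∤α : ∀ {p t} → Prime p → FiniteField._≈_ F (p × FiniteField.1# F) (FiniteField.0# F) → p ≡ suc (3 ℕ.* t) → ∀ k → q ≡ p ℕ.^ k → ¬ Divides p α
  p∤α {p} {t} p-prime p×1≈0 p≡1+3t k q≡p^k (γ , α≡pγ) = FactorialsModulo.p∤C[2s,s] p-prime {t} p≡1+3t k {s} (≡.trans (≡.sym q≡1+3s) q≡p^k)
    (ℤ∣.∣⇒∣ᵤ (≡.subst (+ p ℤ∣.∣_) (cancel (trace J) (+ ((2 ℕ.* s) C s)))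
      (ℤ∣.∣m∣n⇒∣m+n (p∣trace[J]+C[2s,s] p-prime p×1≈0) p∣-trace[J])))
    where
    cancel : ∀ t c → (t ℤ.+ c) ℤ.+ ℤ.- t ≡ c
    cancel = ℤ-solve
    p∣-trace[J] : + p ℤ∣.∣ ℤ.- trace J
    p∣-trace[J] = divides (trace γ) (begin
      ℤ.- trace J                 ≡⟨ trace[α]≡-trace[J] ⟨
      trace α                     ≡⟨ ≡.cong trace α≡pγ ⟩
      trace (fromℤ (+ p) E.* γ) ≡⟨ trace-fromℤ-* (+ p) γ ⟩
      + p ℤ.* trace γ             ≡⟨ ℤₚ.*-comm (+ p) (trace γ) ⟩
      trace γ ℤ.* + p             ∎)

modulo-3 : ∀ n → ∃ λ t → n ≡ 3 ℕ.* t ⊎ n ≡ 1 ℕ.+ 3 ℕ.* t ⊎ n ≡ 2 ℕ.+ 3 ℕ.* t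
modulo-3 zero    = 0 , inj₁ ≡.refl
modulo-3 (suc n) with modulo-3 n
... | t , inj₁ ≡.refl        = t , inj₂ (inj₁ ≡.refl)
... | t , inj₂ (inj₁ ≡.refl) = t , inj₂ (inj₂ ≡.refl)
... | t , inj₂ (inj₂ ≡.refl) = suc t , inj₁ (≡.sym (ℕₚ.*-suc 3 t))

parity : ∀ n → ∃ λ m → n ≡ m ℕ.* 2 ⊎ n ≡ suc (m ℕ.* 2)
parity zero    = 0 , inj₁ ≡.refl
parity (suc n) with parity n
... | m , inj₁ ≡.refl = m , inj₂ ≡.refl
... | m , inj₂ ≡.refl = suc m , inj₁ ≡.refl

prime≡1[mod6] : ∀ {p t} → Prime p → p ≡ suc (3 ℕ.* t) → ∃ λ m → t ≡ 2 ℕ.* m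
prime≡1[mod6] {p} {t} p-prime p≡1+3t with parity t
... | m , inj₁ t≡2m = m , ≡.trans t≡2m (ℕₚ.*-comm m 2)
... | m , inj₂ ≡.refl = contradiction p≡2[2+3m] (not-even (prime⇒irreducible p-prime (ℕ∣.divides (2 ℕ.+ 3 ℕ.* m) p≡2[2+3m])))
  where
  lemma : ∀ m → suc (3 ℕ.* suc (m ℕ.* 2)) ≡ (2 ℕ.+ 3 ℕ.* m) ℕ.* 2
  lemma = ℕ-solve
  p≡2[2+3m] : p ≡ (2 ℕ.+ 3 ℕ.* m) ℕ.* 2
  p≡2[2+3m] = ≡.trans p≡1+3t (lemma m)
  not-even : 2 ≡ 1 ⊎ 2 ≡ p → p ≢ (2 ℕ.+ 3 ℕ.* m) ℕ.* 2
  not-even (inj₂ ≡.refl) ()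

κ≡trace[J] : ∀ {p} (p-prime : Prime p) (t : ℕ) .{{_ : NonZero t}} (p≡1+3t : p ≡ suc (3 ℕ.* t)) →
  κ p ≡ Eisenstein.trace (JacobiSumNorm.J (IntegersModulo.field-ℤ/p p-prime) t p≡1+3t)
κ≡trace[J] {p} p-prime t p≡1+3t =
  let (m , t≡2m) = prime≡1[mod6] {p} {t} p-prime p≡1+3t in
  κ-determined {p} {m} p-prime (≡.trans p≡1+3t (≡.cong suc (≡.trans (≡.cong (3 ℕ.*_) t≡2m) (≡.sym (ℕₚ.*-assoc 3 2 m)))))
    {trace J} {+ 2 ℤ.* u ℤ.- v} {ℤ.∣ v ∣ ℕ.* ℤ.∣ v ∣} trace[J]≡4+3 trace[J]²+27v²
    (≡.subst (λ t → + p ℤ∣.∣ trace J ℤ.+ + ((2 ℕ.* t) C t)) t≡2m (p∣trace[J]+C[2s,s] p-prime p×1≈0))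
  where
  F = IntegersModulo.field-ℤ/p p-prime
  open Eisenstein using (trace)
  open JacobiSumNorm F t p≡1+3t using (J)
  open JacobiSumTrace F t p≡1+3t
  open JacobiSumEvaluations F t p≡1+3t using (p∣trace[J]+C[2s,s])
  p×1≈0 = Characteristic.q≡p^k⇒p×1≈0 F p 1 (≡.sym (ℕₚ.*-identityʳ p))

¬3∣1+3x : ∀ x → ¬ 3 ℕ∣.∣ 1 ℕ.+ 3 ℕ.* x
¬3∣1+3x x 3∣1+3x = from-no (3 ℕ∣.∣? 1) (ℕ∣.∣m+n∣m⇒∣n (≡.subst (3 ℕ∣.∣_) (ℕₚ.+-comm 1 (3 ℕ.* x)) 3∣1+3x) (ℕ∣.m∣m*n x))

module _ {c ℓ q} (F : FiniteField c ℓ q) (s : ℕ) .{{_ : NonZero s}} (q≡1+3s : q ≡ suc (3 ℕ.* s)) where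

  open Eisenstein using (trace)
  open EisensteinArithmetic using (V; trace-split; trace-inert)
  open JacobiSumNorm F s q≡1+3s using (J)
  open JacobiSumTrace F s q≡1+3s
  open ≡.≡-Reasoning

  trace[J]≡-V : ∀ {p} k → Prime p → NonZero k → q ≡ p ℕ.^ k → trace J ≡ ℤ.- V (ℤ.- κ p) (+ p) k
  trace[J]≡-V {p} k@(suc k-1) p-prime _ q≡p^k = ≡.trans (≡.sym (ℤₚ.neg-involutive (trace J))) (≡.cong ℤ.-_ (≡.trans (≡.sym trace[α]≡-trace[J]) (cases (modulo-3 p))))
    where
    cases : (∃ λ t → p ≡ 3 ℕ.* t ⊎ p ≡ 1 ℕ.+ 3 ℕ.* t ⊎ p ≡ 2 ℕ.+ 3 ℕ.* t) → trace α ≡ V (ℤ.- κ p) (+ p) k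
    cases (t , inj₁ p≡3t) = contradiction (≡.subst (3 ℕ∣.∣_) (≡.trans (≡.sym q≡p^k) q≡1+3s)
      (ℕ∣.∣m⇒∣m*n (p ℕ.^ k-1) (≡.subst (3 ℕ∣.∣_) (≡.sym p≡3t) (ℕ∣.m∣m*n t)))) (¬3∣1+3x s)
    cases (zero , inj₂ (inj₁ p≡1)) = contradiction p≡1 (ℕ.nonTrivial⇒≢1 {{prime⇒nonTrivial p-prime}})
    cases (t@(suc _) , inj₂ (inj₁ p≡1+3t)) = begin
      trace α                       ≡⟨ trace-split p-prime T.norm[α]≡q T.α≡1[mod3] k (≡.trans norm[α]≡q (≡.cong +_ q≡p^k)) α≡1[mod3]
                                         (p∤α {p} {t} p-prime (Characteristic.q≡p^k⇒p×1≈0 F p k q≡p^k) p≡1+3t k q≡p^k) ⟩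
      V (trace T.α) (+ p) k         ≡⟨ ≡.cong (λ z → V z (+ p) k) T.trace[α]≡-trace[J] ⟩
      V (ℤ.- trace Jₚ) (+ p) k      ≡⟨ ≡.cong (λ z → V (ℤ.- z) (+ p) k) (κ≡trace[J] p-prime t p≡1+3t) ⟨
      V (ℤ.- κ p) (+ p) k           ∎
      where
      module T = JacobiSumTrace (IntegersModulo.field-ℤ/p p-prime) t p≡1+3t
      Jₚ = JacobiSumNorm.J (IntegersModulo.field-ℤ/p p-prime) t p≡1+3t
    cases (t , inj₂ (inj₂ p≡2+3t)) = even-odd (parity k)
      where
      p%3≢1 : p % 3 ≢ 1
      p%3≢1 e = contradiction (≡.trans (≡.sym e) (≡.trans (≡.cong (_% 3) (≡.trans p≡2+3t (≡.cong (2 ℕ.+_) (ℕₚ.*-comm 3 t)))) ([m+kn]%n≡m%n 2 t 3))) λ ()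
      even-power : ∀ m → ∃ λ j → p ℕ.^ (m ℕ.* 2) ≡ 1 ℕ.+ 3 ℕ.* j
      even-power zero    = 0 , ≡.refl
      even-power (suc m) =
        let (j , e) = even-power m in
        1 ℕ.+ 4 ℕ.* t ℕ.+ 3 ℕ.* t ℕ.* t ℕ.+ (2 ℕ.+ 3 ℕ.* t) ℕ.* (2 ℕ.+ 3 ℕ.* t) ℕ.* j
        , ≡.trans (≡.cong₂ (λ p x → p ℕ.* (p ℕ.* x)) p≡2+3t e) (square t j)
        where
        square : ∀ t j → (2 ℕ.+ 3 ℕ.* t) ℕ.* ((2 ℕ.+ 3 ℕ.* t) ℕ.* (1 ℕ.+ 3 ℕ.* j)) ≡
          1 ℕ.+ 3 ℕ.* (1 ℕ.+ 4 ℕ.* t ℕ.+ 3 ℕ.* t ℕ.* t ℕ.+ (2 ℕ.+ 3 ℕ.* t) ℕ.* (2 ℕ.+ 3 ℕ.* t) ℕ.* j)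
        square = ℕ-solve
      even-odd : (∃ λ m → k ≡ m ℕ.* 2 ⊎ k ≡ suc (m ℕ.* 2)) → trace α ≡ V (ℤ.- κ p) (+ p) k
      even-odd (m , inj₁ k≡2m) = begin
        trace α                       ≡⟨ trace-inert p-prime {t} p≡2+3t (p≡2[mod3]⇒inert {p} {t} p-prime p≡2+3t) m
                                           (≡.trans norm[α]≡q (≡.cong +_ (≡.trans q≡p^k (≡.cong (p ℕ.^_) k≡2m)))) α≡1[mod3] ⟩
        V 0ℤ (+ p) (m ℕ.* 2)          ≡⟨ ≡.cong₂ (λ z k → V (ℤ.- z) (+ p) k) (κ≡0 p p%3≢1) k≡2m ⟨
        V (ℤ.- κ p) (+ p) k           ∎
      -- An odd power of p ≡ 2 is congruent to 2 modulo 3, whereas q ≡ 1.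
      even-odd (m , inj₂ k≡1+2m) =
        let (j , e) = even-power m in
        contradiction (ℕ∣.divides s (ℕₚ.suc-injective (≡.trans (≡.sym (odd t j)) (≡.trans (≡.cong₂ ℕ._*_ (≡.sym p≡2+3t) (≡.sym e))
          (≡.trans (≡.sym (≡.trans q≡p^k (≡.cong (p ℕ.^_) k≡1+2m))) (≡.trans q≡1+3s (≡.cong suc (ℕₚ.*-comm 3 s)))))))) (¬3∣1+3x (t ℕ.+ 2 ℕ.* j ℕ.+ 3 ℕ.* t ℕ.* j))
        where
        odd : ∀ t j → (2 ℕ.+ 3 ℕ.* t) ℕ.* (1 ℕ.+ 3 ℕ.* j) ≡ suc (1 ℕ.+ 3 ℕ.* (t ℕ.+ 2 ℕ.* j ℕ.+ 3 ℕ.* t ℕ.* j))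
        odd = ℕ-solve

-- The formula

-- The trace of ω^m is 2 if 3 divides m and -1 otherwise, so each ε is minus the trace of a power of
-- ω.
trace-cω^ : ∀ m → Eisenstein.trace ⟦ cω ⊗^ m ⟧ ≡ ℤ.- (if does (3 ℕ∣.∣? m) then ℤ.- + 2 else 1ℤ)
trace-cω^ m = cases (modulo-3 m)
  where
  open Eisenstein using (trace)
  ε-yes : 3 ℕ∣.∣ m → ℤ.- (if does (3 ℕ∣.∣? m) then ℤ.- + 2 else 1ℤ) ≡ + 2
  ε-yes 3∣m = ≡.cong (λ b → ℤ.- (if b then ℤ.- + 2 else 1ℤ)) (dec-true (3 ℕ∣.∣? m) 3∣m)
  ε-no : ¬ 3 ℕ∣.∣ m → ℤ.- (if does (3 ℕ∣.∣? m) then ℤ.- + 2 else 1ℤ) ≡ ℤ.-1ℤ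
  ε-no 3∤m = ≡.cong (λ b → ℤ.- (if b then ℤ.- + 2 else 1ℤ)) (dec-false (3 ℕ∣.∣? m) 3∤m)
  cω^[r+3t] : ∀ r t → cω ⊗^ (r ℕ.+ 3 ℕ.* t) ≡ cω ⊗^ r
  cω^[r+3t] r t = ≡.trans (⊗^-homo-⊗ cω r (3 ℕ.* t)) (≡.trans (≡.cong (cω ⊗^ r ⊗_) (cω^[3t] t)) (⊗-identityʳ (cω ⊗^ r)))
    where
    cω^[3t] : ∀ t → cω ⊗^ (3 ℕ.* t) ≡ c1
    cω^[3t] zero    = ≡.refl
    cω^[3t] (suc t) = ≡.trans (≡.cong (cω ⊗^_) (ℕₚ.*-suc 3 t)) (≡.trans (⊗^-homo-⊗ cω 3 (3 ℕ.* t)) (cω^[3t] t))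
  3∤ : ∀ r t → ¬ 3 ℕ∣.∣ r → ¬ 3 ℕ∣.∣ r ℕ.+ 3 ℕ.* t
  3∤ r t 3∤r 3∣ = 3∤r (ℕ∣.∣m+n∣m⇒∣n (≡.subst (3 ℕ∣.∣_) (ℕₚ.+-comm r (3 ℕ.* t)) 3∣) (ℕ∣.m∣m*n t))
  cases : (∃ λ t → m ≡ 3 ℕ.* t ⊎ m ≡ 1 ℕ.+ 3 ℕ.* t ⊎ m ≡ 2 ℕ.+ 3 ℕ.* t) →
    trace ⟦ cω ⊗^ m ⟧ ≡ ℤ.- (if does (3 ℕ∣.∣? m) then ℤ.- + 2 else 1ℤ)
  cases (t , inj₁ m≡) = ≡.trans (≡.cong (trace ∘ ⟦_⟧) (≡.trans (≡.cong (cω ⊗^_) m≡) (cω^[r+3t] 0 t)))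
    (≡.sym (ε-yes (≡.subst (3 ℕ∣.∣_) (≡.sym m≡) (ℕ∣.m∣m*n t))))
  cases (t , inj₂ (inj₁ m≡)) = ≡.trans (≡.cong (trace ∘ ⟦_⟧) (≡.trans (≡.cong (cω ⊗^_) m≡) (cω^[r+3t] 1 t)))
    (≡.sym (ε-no (3∤ 1 t (from-no (3 ℕ∣.∣? 1)) ∘ ≡.subst (3 ℕ∣.∣_) m≡)))
  cases (t , inj₂ (inj₂ m≡)) = ≡.trans (≡.cong (trace ∘ ⟦_⟧) (≡.trans (≡.cong (cω ⊗^_) m≡) (cω^[r+3t] 2 t)))
    (≡.sym (ε-no (3∤ 2 t (from-no (3 ℕ∣.∣? 2)) ∘ ≡.subst (3 ℕ∣.∣_) m≡)))

trace-ε₂ : ∀ n → Eisenstein.trace ⟦ cω ⊗^ n ⊗ cω ⊗^ n ⟧ ≡ ℤ.- ε₂ n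
trace-ε₂ n = ≡.trans (≡.cong (Eisenstein.trace ∘ ⟦_⟧) (≡.sym (⊗^-homo-⊗ cω n n))) (≡.trans (trace-cω^ (n ℕ.+ n))
  (≡.cong (λ b → ℤ.- (if b then ℤ.- + 2 else 1ℤ)) (does-⇔ (mk⇔ ⇒ ⇐) (3 ℕ∣.∣? (n ℕ.+ n)) (+ n ≡? 0ℤ [mod 3 ]))))
  where
  ⇒ : 3 ℕ∣.∣ n ℕ.+ n → + n ≡ 0ℤ [mod 3 ]
  ⇒ h = ≡.subst (3 ℕ∣.∣_) (≡.cong ℤ.∣_∣ (≡.sym (ℤₚ.+-identityʳ (+ n))))
    (ℕ∣.∣m+n∣m⇒∣n {m = n ℕ.+ n} (≡.subst (3 ℕ∣.∣_) (triple n) (ℕ∣.m∣m*n n)) h)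
    where
    triple : ∀ n → 3 ℕ.* n ≡ n ℕ.+ n ℕ.+ n
    triple = ℕ-solve
  ⇐ : + n ≡ 0ℤ [mod 3 ] → 3 ℕ∣.∣ n ℕ.+ n
  ⇐ h = let 3∣n = ≡.subst (3 ℕ∣.∣_) (≡.cong ℤ.∣_∣ (ℤₚ.+-identityʳ (+ n))) h in ℕ∣.∣m∣n⇒∣m+n 3∣n 3∣n

-- q - 3n - 1 = 3 (2n + s) - 9n, so 9 divides the left side exactly when 3 divides 2n + s, the
-- exponent of ω.
trace-ε₁ : ∀ {q s} n → q ≡ suc (3 ℕ.* s) → Eisenstein.trace ⟦ cω ⊗^ n ⊗ cω ⊗^ n ⊗ cω ⊗^ s ⟧ ≡ ℤ.- ε₁ q n
trace-ε₁ {q} {s} n q≡1+3s = ≡.trans (≡.cong (Eisenstein.trace ∘ ⟦_⟧) power) (≡.trans (trace-cω^ (n ℕ.+ n ℕ.+ s))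
  (≡.cong (λ b → ℤ.- (if b then ℤ.- + 2 else 1ℤ)) (does-⇔ (mk⇔ ⇒ ⇐) (3 ℕ∣.∣? (n ℕ.+ n ℕ.+ s)) (+ q ℤ.- + (3 ℕ.* n) ≡? 1ℤ [mod 9 ]))))
  where
  power : cω ⊗^ n ⊗ cω ⊗^ n ⊗ cω ⊗^ s ≡ cω ⊗^ (n ℕ.+ n ℕ.+ s)
  power = ≡.sym (≡.trans (⊗^-homo-⊗ cω (n ℕ.+ n) s) (≡.cong (_⊗ cω ⊗^ s) (⊗^-homo-⊗ cω n n)))
  difference≡ : + q ℤ.- + (3 ℕ.* n) ℤ.- 1ℤ ≡ (1ℤ ℤ.+ + 3 ℤ.* + s) ℤ.- + 3 ℤ.* + n ℤ.- 1ℤ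
  difference≡ = ≡.cong₂ (λ a b → a ℤ.- b ℤ.- 1ℤ)
    (≡.trans (≡.cong +_ q≡1+3s) (≡.cong (λ x → 1ℤ ℤ.+ x) (ℤₚ.pos-* 3 s))) (ℤₚ.pos-* 3 n)
  ⇒ : 3 ℕ∣.∣ n ℕ.+ n ℕ.+ s → + q ℤ.- + (3 ℕ.* n) ≡ 1ℤ [mod 9 ]
  ⇒ (ℕ∣.divides j e) = ℤ∣.∣⇒∣ᵤ (divides (+ j ℤ.- + n) (≡.trans difference≡ (≡.trans (expand (+ s) (+ n))
    (≡.trans (≡.cong (λ x → + 3 ℤ.* x ℤ.- + 9 ℤ.* + n) (≡.trans (≡.cong +_ e) (ℤₚ.pos-* j 3))) (collect (+ j) (+ n))))))
    where
    expand : ∀ s n → (1ℤ ℤ.+ + 3 ℤ.* s) ℤ.- + 3 ℤ.* n ℤ.- 1ℤ ≡ + 3 ℤ.* (n ℤ.+ n ℤ.+ s) ℤ.- + 9 ℤ.* n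
    expand = ℤ-solve
    collect : ∀ j n → + 3 ℤ.* (j ℤ.* + 3) ℤ.- + 9 ℤ.* n ≡ (j ℤ.- n) ℤ.* + 9
    collect = ℤ-solve
  ⇐ : + q ℤ.- + (3 ℕ.* n) ≡ 1ℤ [mod 9 ] → 3 ℕ∣.∣ n ℕ.+ n ℕ.+ s
  ⇐ h = extract (ℤ∣.∣ᵤ⇒∣ h)
    where
    scaled : ∀ n s j → (1ℤ ℤ.+ + 3 ℤ.* s) ℤ.- + 3 ℤ.* n ℤ.- 1ℤ ≡ j ℤ.* + 9 → + 3 ℤ.* (n ℤ.+ n ℤ.+ s) ≡ + 3 ℤ.* ((j ℤ.* + 3) ℤ.+ n ℤ.* + 3)
    scaled n s j e = ≡.trans (split n s) (≡.trans (≡.cong (ℤ._+ + 9 ℤ.* n) e) (join n j))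
      where
      split : ∀ n s → + 3 ℤ.* (n ℤ.+ n ℤ.+ s) ≡ ((1ℤ ℤ.+ + 3 ℤ.* s) ℤ.- + 3 ℤ.* n ℤ.- 1ℤ) ℤ.+ + 9 ℤ.* n
      split = ℤ-solve
      join : ∀ n j → j ℤ.* + 9 ℤ.+ + 9 ℤ.* n ≡ + 3 ℤ.* ((j ℤ.* + 3) ℤ.+ n ℤ.* + 3)
      join = ℤ-solve
    extract : + 9 ℤ∣.∣ + q ℤ.- + (3 ℕ.* n) ℤ.- 1ℤ → 3 ℕ∣.∣ n ℕ.+ n ℕ.+ s
    extract (divides j e) = ℤ∣.∣⇒∣ᵤ {+ 3} {+ (n ℕ.+ n ℕ.+ s)} (divides (j ℤ.+ + n)
      (≡.trans (ℤₚ.*-cancelˡ-≡ (+ 3) _ _ (scaled (+ n) (+ s) j (≡.trans (≡.sym difference≡) e))) (≡.sym (ℤₚ.*-distribʳ-+ (+ 3) j (+ n)))))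

-- The quadratic field of `π p`

module Fractions where

  fromℚᵘ-+ : ∀ x y → fromℚᵘ x ℚ.+ fromℚᵘ y ≡ fromℚᵘ (x ℚᵘ.+ y)
  fromℚᵘ-+ x y = ℚₚ.toℚᵘ-injective (ℚᵘₚ.≃-trans (ℚₚ.toℚᵘ-homo-+ (fromℚᵘ x) (fromℚᵘ y))
    (ℚᵘₚ.≃-trans (ℚᵘₚ.+-cong (ℚₚ.toℚᵘ-fromℚᵘ x) (ℚₚ.toℚᵘ-fromℚᵘ y)) (ℚᵘₚ.≃-sym (ℚₚ.toℚᵘ-fromℚᵘ (x ℚᵘ.+ y)))))

  fromℚᵘ-* : ∀ x y → fromℚᵘ x ℚ.* fromℚᵘ y ≡ fromℚᵘ (x ℚᵘ.* y)
  fromℚᵘ-* x y = ℚₚ.toℚᵘ-injective (ℚᵘₚ.≃-trans (ℚₚ.toℚᵘ-homo-* (fromℚᵘ x) (fromℚᵘ y))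
    (ℚᵘₚ.≃-trans (ℚᵘₚ.*-cong (ℚₚ.toℚᵘ-fromℚᵘ x) (ℚₚ.toℚᵘ-fromℚᵘ y)) (ℚᵘₚ.≃-sym (ℚₚ.toℚᵘ-fromℚᵘ (x ℚᵘ.* y)))))

  /1-+ : ∀ a b → a ℚ./ 1 ℚ.+ b ℚ./ 1 ≡ (a ℤ.+ b) ℚ./ 1
  /1-+ a b = ≡.trans (fromℚᵘ-+ (mkℚᵘ a 0) (mkℚᵘ b 0)) (ℚₚ.fromℚᵘ-cong {mkℚᵘ a 0 ℚᵘ.+ mkℚᵘ b 0} {mkℚᵘ (a ℤ.+ b) 0} (*≡* (lemma a b)))
    where
    lemma : ∀ a b → (a ℤ.* 1ℤ ℤ.+ b ℤ.* 1ℤ) ℤ.* 1ℤ ≡ (a ℤ.+ b) ℤ.* 1ℤ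
    lemma = ℤ-solve

  /1-* : ∀ a b → (a ℚ./ 1) ℚ.* (b ℚ./ 1) ≡ (a ℤ.* b) ℚ./ 1
  /1-* a b = fromℚᵘ-* (mkℚᵘ a 0) (mkℚᵘ b 0)

  /1-neg : ∀ a → ℚ.- (a ℚ./ 1) ≡ (ℤ.- a) ℚ./ 1
  /1-neg (+ zero)   = ≡.refl
  /1-neg (+ suc n)  = ≡.refl
  /1-neg (-[1+ n ]) = solve 1 (λ x → :- (:- x) := x) ≡.refl (+ suc n ℚ./ 1)
    where open IntegersIn ℚₚ.+-*-commutativeRing using (solve; :-_; _:=_)

  /2+/2 : ∀ a → a ℚ./ 2 ℚ.+ a ℚ./ 2 ≡ a ℚ./ 1
  /2+/2 a = ≡.trans (fromℚᵘ-+ (mkℚᵘ a 1) (mkℚᵘ a 1)) (ℚₚ.fromℚᵘ-cong {mkℚᵘ a 1 ℚᵘ.+ mkℚᵘ a 1} {mkℚᵘ a 0} (*≡* (lemma a)))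
    where
    lemma : ∀ a → (a ℤ.* + 2 ℤ.+ a ℤ.* + 2) ℤ.* 1ℤ ≡ a ℤ.* + 4
    lemma = ℤ-solve

  /2*/2 : ∀ a b → (a ℚ./ 2) ℚ.* (b ℚ./ 2) ≡ (a ℤ.* b) ℚ./ 4
  /2*/2 a b = fromℚᵘ-* (mkℚᵘ a 1) (mkℚᵘ b 1)

  9*/9 : ∀ a → ((+ 9 ℤ.* a) ℚ./ 1) ℚ.* (+ 1 ℚ./ 9) ≡ a ℚ./ 1
  9*/9 a = ≡.trans (fromℚᵘ-* (mkℚᵘ (+ 9 ℤ.* a) 0) (mkℚᵘ (+ 1) 8)) (ℚₚ.fromℚᵘ-cong {mkℚᵘ (+ 9 ℤ.* a) 0 ℚᵘ.* mkℚᵘ (+ 1) 8} {mkℚᵘ a 0} (*≡* (lemma a)))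
    where
    lemma : ∀ a → + 9 ℤ.* a ℤ.* + 1 ℤ.* 1ℤ ≡ a ℤ.* + 9
    lemma = ℤ-solve

module QuadraticField {D : ℚ} where

  open Fractions
  open EisensteinArithmetic using (V)
  open IntegersIn ℚₚ.+-*-commutativeRing using (solve; con; _:+_; _:*_; _:-_; :-_; _:=_)
  open ≡.≡-Reasoning
  open ℚ[i√_] using (re)

  integer-minus : ∀ a b → integer {D} a -ᶜ integer b ≡ integer (a ℤ.- b)
  integer-minus a b = ≡.cong (λ x → x ⊕ 0ℚ i√D) (≡.trans (≡.cong (a ℚ./ 1 ℚ.+_) (/1-neg b)) (/1-+ a (ℤ.- b)))

  rational-* : ∀ x y → rational {D} x *ᶜ rational y ≡ rational (x ℚ.* y)
  rational-* x y = ≡.cong₂ _⊕_i√D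
    (solve 3 (λ D x y → x :* y :- D :* (con 0ℤ :* con 0ℤ) := x :* y) ≡.refl D x y)
    (solve 2 (λ x y → x :* con 0ℤ :+ con 0ℤ :* y := con 0ℤ) ≡.refl x y)

  integer-* : ∀ a b → integer {D} a *ᶜ integer b ≡ integer (a ℤ.* b)
  integer-* a b = ≡.trans (rational-* (a ℚ./ 1) (b ℚ./ 1)) (≡.cong rational (/1-* a b))

  conj-* : ∀ (z w : ℚ[i√ D ]) → conj (z *ᶜ w) ≡ conj z *ᶜ conj w
  conj-* (x ⊕ y i√D) (u ⊕ v i√D) = ≡.cong₂ _⊕_i√D
    (solve 5 (λ D x y u v → x :* u :- D :* (y :* v) := x :* u :- D :* ((:- y) :* (:- v))) ≡.refl D x y u v)
    (solve 4 (λ x y u v → :- (x :* v :+ y :* u) := x :* (:- v) :+ (:- y) :* u) ≡.refl x y u v)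

  conj-^ : ∀ (z : ℚ[i√ D ]) k → conj z ^ᶜ k ≡ conj (z ^ᶜ k)
  conj-^ z zero    = ≡.refl
  conj-^ z (suc k) = ≡.trans (≡.cong (conj z *ᶜ_) (conj-^ z k)) (≡.sym (conj-* z (z ^ᶜ k)))

  module _ (h : ℚ) (P Q : ℤ) (2h≡P : h ℚ.+ h ≡ P ℚ./ 1) (h²+D≡Q : h ℚ.* h ℚ.+ D ≡ Q ℚ./ 1) where

    private
      z : ℚ[i√ D ]
      z = h ⊕ 1ℚ i√D

      twice : ∀ w → w +ᶜ conj w ≡ rational {D} (re w ℚ.+ re w)
      twice (x ⊕ y i√D) = ≡.cong ((x ℚ.+ x) ⊕_i√D) (ℚₚ.+-inverseʳ y)

      recurrence : ∀ w → re (z *ᶜ (z *ᶜ w)) ≡ (h ℚ.+ h) ℚ.* re (z *ᶜ w) ℚ.- (h ℚ.* h ℚ.+ D) ℚ.* re w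
      recurrence (x ⊕ y i√D) = solve 4 (λ h D x y →
        h :* (h :* x :- D :* (con 1ℤ :* y)) :- D :* (con 1ℤ :* (h :* y :+ con 1ℤ :* x)) :=
        (h :+ h) :* (h :* x :- D :* (con 1ℤ :* y)) :- (h :* h :+ D) :* x) ≡.refl h D x y

      -- z is a root of x² - P x + Q, so twice the real parts of its powers satisfy the recurrence
      -- of `V`, with the same initial values 2 and P.
      2re≡V : ∀ k → re (z ^ᶜ k) ℚ.+ re (z ^ᶜ k) ≡ V P Q k ℚ./ 1
      2re≡V zero          = ≡.refl
      2re≡V (suc zero)    = ≡.trans (solve 2 (λ h D → (h :* con 1ℤ :- D :* (con 1ℤ :* con 0ℤ)) :+ (h :* con 1ℤ :- D :* (con 1ℤ :* con 0ℤ)) := h :+ h) ≡.refl h D) 2h≡P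
      2re≡V (suc (suc k)) = begin
        r₂ ℚ.+ r₂
          ≡⟨ ≡.cong (λ r → r ℚ.+ r) (≡.trans (recurrence (z ^ᶜ k)) (≡.cong₂ (λ p q → p ℚ.* r₁ ℚ.- q ℚ.* r₀) 2h≡P h²+D≡Q)) ⟩
        ((P ℚ./ 1) ℚ.* r₁ ℚ.- (Q ℚ./ 1) ℚ.* r₀) ℚ.+ ((P ℚ./ 1) ℚ.* r₁ ℚ.- (Q ℚ./ 1) ℚ.* r₀)
          ≡⟨ solve 4 (λ P Q r₁ r₀ → (P :* r₁ :- Q :* r₀) :+ (P :* r₁ :- Q :* r₀) := P :* (r₁ :+ r₁) :- Q :* (r₀ :+ r₀)) ≡.refl (P ℚ./ 1) (Q ℚ./ 1) r₁ r₀ ⟩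
        (P ℚ./ 1) ℚ.* (r₁ ℚ.+ r₁) ℚ.- (Q ℚ./ 1) ℚ.* (r₀ ℚ.+ r₀)
          ≡⟨ ≡.cong₂ (λ a b → (P ℚ./ 1) ℚ.* a ℚ.- (Q ℚ./ 1) ℚ.* b) (2re≡V (suc k)) (2re≡V k) ⟩
        (P ℚ./ 1) ℚ.* (V P Q (suc k) ℚ./ 1) ℚ.- (Q ℚ./ 1) ℚ.* (V P Q k ℚ./ 1)
          ≡⟨ ≡.cong₂ ℚ._-_ (/1-* P (V P Q (suc k))) (/1-* Q (V P Q k)) ⟩
        (P ℤ.* V P Q (suc k)) ℚ./ 1 ℚ.- (Q ℤ.* V P Q k) ℚ./ 1
          ≡⟨ ≡.trans (≡.cong ((P ℤ.* V P Q (suc k)) ℚ./ 1 ℚ.+_) (/1-neg (Q ℤ.* V P Q k))) (/1-+ (P ℤ.* V P Q (suc k)) (ℤ.- (Q ℤ.* V P Q k))) ⟩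
        V P Q (suc (suc k)) ℚ./ 1 ∎
        where
        r₀ = re (z ^ᶜ k)
        r₁ = re (z ^ᶜ suc k)
        r₂ = re (z ^ᶜ suc (suc k))

    z^k+conj[z]^k : ∀ k → z ^ᶜ k +ᶜ conj z ^ᶜ k ≡ integer (V P Q k)
    z^k+conj[z]^k k = ≡.trans (≡.cong (z ^ᶜ k +ᶜ_) (conj-^ z k)) (≡.trans (twice (z ^ᶜ k)) (≡.cong rational (2re≡V k)))

-- Twice the real part of `π p` is `- κ p`, and `Δ` is chosen so that its norm is p.
π^k+conj[π]^k : ∀ p k → π p ^ᶜ k +ᶜ conj (π p) ^ᶜ k ≡ integer (EisensteinArithmetic.V (ℤ.- κ p) (+ p) k)
π^k+conj[π]^k p k = QuadraticField.z^k+conj[z]^k ((ℤ.- κ p) ℚ./ 2) (ℤ.- κ p) (+ p) (/2+/2 (ℤ.- κ p)) h²+Δ≡p k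
  where
  open Fractions
  open IntegersIn ℚₚ.+-*-commutativeRing using (solve; _:+_; _:-_; _:=_)
  square : ∀ z → ℤ.- z ℤ.* ℤ.- z ≡ z ℤ.* z
  square = ℤ-solve
  h²+Δ≡p : ((ℤ.- κ p) ℚ./ 2) ℚ.* ((ℤ.- κ p) ℚ./ 2) ℚ.+ Δ p ≡ + p ℚ./ 1
  h²+Δ≡p = ≡.trans (≡.cong (ℚ._+ Δ p) (≡.trans (/2*/2 (ℤ.- κ p) (ℤ.- κ p)) (≡.cong (ℚ._/ 4) (square (κ p)))))
    (solve 2 (λ a b → a :+ (b :- a) := b) ≡.refl ((κ p ℤ.* κ p) ℚ./ 4) (+ p ℚ./ 1))

q≡1+3[[q-1]/3] : ∀ {q} → q % 3 ≡ 1 → q ≡ suc (3 ℕ.* ((q ℕ.∸ 1) / 3))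
q≡1+3[[q-1]/3] {q} q%3≡1 = ≡.trans q≡1+3t (≡.cong (λ s → suc (3 ℕ.* s)) t≡[q-1]/3)
  where
  t = q / 3
  q≡1+3t : q ≡ suc (3 ℕ.* t)
  q≡1+3t = ≡.trans (m≡m%n+[m/n]*n q 3) (≡.cong₂ ℕ._+_ q%3≡1 (ℕₚ.*-comm t 3))
  t≡[q-1]/3 : t ≡ (q ℕ.∸ 1) / 3
  t≡[q-1]/3 = ≡.sym (≡.trans (≡.cong (_/ 3) (≡.trans (≡.cong ℕ.pred q≡1+3t) (ℕₚ.*-comm 3 t))) (m*n/n≡m t 3))

1<p^k : ∀ {p} k → Prime p → NonZero k → 1 ℕ.< p ℕ.^ k
1<p^k {p} (suc k) p-prime _ = ℕₚ.<-≤-trans (ℕ.nonTrivial⇒n>1 p {{prime⇒nonTrivial p-prime}})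
  (ℕₚ.m≤m*n p (p ℕ.^ k) {{ℕₚ.m^n≢0 p k {{prime⇒nonZero p-prime}}}})

module _ {c ℓ q} (F : FiniteField c ℓ q) (s n : ℕ) .{{_ : NonZero s}} .{{_ : NonZero n}}
  (q≡1+3s : q ≡ suc (3 ℕ.* s)) (gcd≡1 : gcd n s ≡ 1) where

  open PermutationCount F s n q≡1+3s gcd≡1
  open CubicCharacter F s q≡1+3s using (χ[w])
  open JacobiSumNorm F s q≡1+3s using (J)
  open Eisenstein using (trace)
  open EisensteinArithmetic using (V)
  open ≡.≡-Reasoning

  9*permutationCount≡ : ∀ {p} k → Prime p → NonZero k → q ≡ p ℕ.^ k →
    (+ (2 ℕ.* q) ℤ.- + 3 ℤ.* (ε₁ q n ℤ.+ ε₂ n) ℤ.- + 10) ℤ.- + 2 ℤ.* V (ℤ.- κ p) (+ p) k ≡ + 9 ℤ.* + permutationCount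
  9*permutationCount≡ {p} k p-prime k≢0 q≡p^k = begin
    (+ (2 ℕ.* q) ℤ.- + 3 ℤ.* (ε₁ q n ℤ.+ ε₂ n) ℤ.- + 10) ℤ.- + 2 ℤ.* v
      ≡⟨ ≡.cong (λ x → (x ℤ.- + 3 ℤ.* (ε₁ q n ℤ.+ ε₂ n) ℤ.- + 10) ℤ.- + 2 ℤ.* v) (ℤₚ.pos-* 2 q) ⟩
    (+ 2 ℤ.* + q ℤ.- + 3 ℤ.* (ε₁ q n ℤ.+ ε₂ n) ℤ.- + 10) ℤ.- + 2 ℤ.* v
      ≡⟨ signs (+ q) (ε₁ q n) (ε₂ n) v ⟩
    + 2 ℤ.* + q ℤ.+ + 3 ℤ.* (ℤ.- ε₁ q n ℤ.+ ℤ.- ε₂ n) ℤ.- + 10 ℤ.+ + 2 ℤ.* ℤ.- v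
      ≡⟨ ≡.cong₂ (λ x y → + 2 ℤ.* + q ℤ.+ + 3 ℤ.* (x ℤ.+ y) ℤ.- + 10 ℤ.+ + 2 ℤ.* ℤ.- v) trace[τ]≡-ε₁ (trace-ε₂ n) ⟨
    + 2 ℤ.* + q ℤ.+ + 3 ℤ.* (trace ⟦ τ ⟧ ℤ.+ trace ⟦ ν ⊗ ν ⟧) ℤ.- + 10 ℤ.+ + 2 ℤ.* ℤ.- v
      ≡⟨ ≡.cong (λ x → + 2 ℤ.* + q ℤ.+ + 3 ℤ.* (trace ⟦ τ ⟧ ℤ.+ trace ⟦ ν ⊗ ν ⟧) ℤ.- + 10 ℤ.+ + 2 ℤ.* x) (trace[J]≡-V F s q≡1+3s k p-prime k≢0 q≡p^k) ⟨
    + 2 ℤ.* + q ℤ.+ + 3 ℤ.* (trace ⟦ τ ⟧ ℤ.+ trace ⟦ ν ⊗ ν ⟧) ℤ.- + 10 ℤ.+ + 2 ℤ.* trace J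
      ≡⟨ 9*permutationCount ⟨
    + 9 ℤ.* + permutationCount ∎
    where
    v = V (ℤ.- κ p) (+ p) k
    signs : ∀ q a b v → (+ 2 ℤ.* q ℤ.- + 3 ℤ.* (a ℤ.+ b) ℤ.- + 10) ℤ.- + 2 ℤ.* v ≡
      + 2 ℤ.* q ℤ.+ + 3 ℤ.* (ℤ.- a ℤ.+ ℤ.- b) ℤ.- + 10 ℤ.+ + 2 ℤ.* ℤ.- v
    signs = ℤ-solve
    trace[τ]≡-ε₁ : trace ⟦ τ ⟧ ≡ ℤ.- ε₁ q n
    trace[τ]≡-ε₁ = ≡.trans (≡.cong (λ a → trace ⟦ ν ⊗ ν ⊗ a ⟧) χ[w]) (trace-ε₁ {q} {s} n q≡1+3s)

open import Data.Nat.Base using (_∸_; _^_; _*_)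
open import Data.Vec.Base using (count)

theorem4p5 : ∀ {c ℓ} (p k q n : ℕ) → Prime p → NonZero k → q ≡ p ^ k → q % 3 ≡ 1 →
    NonZero n → gcd n ((q ∸ 1) / 3) ≡ 1 →
    (F : FiniteField c ℓ q) →
    let open Polynomials (FiniteField.commutativeRing F)
        N : ℕ
        N = count (λ a → isPermutationPolynomial? F (X^ n *ₚ (X^ ((q ∸ 1) / 3) +ₚ C a))) (FiniteField.elements F)
    in
    integer (+ N) ≡
      (integer (+ (2 * q) ℤ.- + 3 ℤ.* (ε₁ q n ℤ.+ ε₂ n) ℤ.- + 10)
        -ᶜ integer (+ 2) *ᶜ (π p ^ᶜ k +ᶜ conj (π p) ^ᶜ k))
      *ᶜ rational (+ 1 ℚ./ 9)
theorem4p5 p k q n p-prime k≢0 q≡p^k q%3≡1 n≢0 gcd≡1 F = ≡.sym (begin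
  (integer A -ᶜ integer (+ 2) *ᶜ (π p ^ᶜ k +ᶜ conj (π p) ^ᶜ k)) *ᶜ ninth
    ≡⟨ ≡.cong (λ t → (integer A -ᶜ integer (+ 2) *ᶜ t) *ᶜ ninth) (π^k+conj[π]^k p k) ⟩
  (integer A -ᶜ integer (+ 2) *ᶜ integer v) *ᶜ ninth
    ≡⟨ ≡.cong (λ t → (integer A -ᶜ t) *ᶜ ninth) (integer-* (+ 2) v) ⟩
  (integer A -ᶜ integer (+ 2 ℤ.* v)) *ᶜ ninth
    ≡⟨ ≡.cong (_*ᶜ ninth) (integer-minus A (+ 2 ℤ.* v)) ⟩
  integer (A ℤ.- + 2 ℤ.* v) *ᶜ ninth
    ≡⟨ ≡.cong (λ x → integer x *ᶜ ninth) (9*permutationCount≡ F s n {{s≢0}} {{n≢0}} q≡1+3s gcd≡1 k p-prime k≢0 q≡p^k) ⟩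
  integer (+ 9 ℤ.* + N) *ᶜ ninth
    ≡⟨ rational-* ((+ 9 ℤ.* + N) ℚ./ 1) (+ 1 ℚ./ 9) ⟩
  rational (((+ 9 ℤ.* + N) ℚ./ 1) ℚ.* (+ 1 ℚ./ 9))
    ≡⟨ ≡.cong rational (Fractions.9*/9 (+ N)) ⟩
  integer (+ N) ∎)
  where
  open ≡.≡-Reasoning
  open QuadraticField {Δ p}
  s = (q ∸ 1) / 3
  q≡1+3s : q ≡ suc (3 * s)
  q≡1+3s = q≡1+3[[q-1]/3] q%3≡1
  s≢0 : NonZero s
  s≢0 = ℕ.≢-nonZero λ s≡0 → ℕₚ.<⇒≢ (1<p^k k p-prime k≢0) (≡.sym (≡.trans (≡.sym q≡p^k) (≡.trans q≡1+3s (≡.cong (λ s → suc (3 * s)) s≡0))))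
  N : ℕ
  N = PermutationCount.permutationCount F s n {{s≢0}} {{n≢0}} q≡1+3s gcd≡1
  A v : ℤ
  A = + (2 * q) ℤ.- + 3 ℤ.* (ε₁ q n ℤ.+ ε₂ n) ℤ.- + 10
  v = EisensteinArithmetic.V (ℤ.- κ p) (+ p) k
  ninth : ℚ[i√ Δ p ]
  ninth = rational (+ 1 ℚ./ 9)
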